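{- Let $q$ be a prime power, $n\ge 1$, $\mathcal{E}=\mathbb{F}_q^n$, and let $\mathcal{M}=(\mathcal{E},\rho)$ be a $q$-matroid of rank $r=\rho(\mathcal{E})$. Let $C_1,\dots,C_s$ be the $q$-circuits of $\mathcal{M}$, $S=\{1,\dots,s\}$, and for $X\subseteq S$ let $C_X$ be the $\mathbb{F}_q$-linear span of $\{C_i: i\in X\}$. For $i\ge1$ and $l\ge 0$ let $\lambda_{i,l}$ be the number of subsets $X\subseteq S$ with $|X|=i$ such that $C_X$ has codimension $l$ in $\mathcal{E}$. Then $$\chi(I_{\mathcal{M}})=(-1)^{r-1}q^{\binom{n}{2}}\,\overline{\mu}(\mathcal{M})+\sum_{l=1}^{n-1}\sum_{i=1}^{s}\lambda_{i,l}\sum_{j=0}^{l}(-1)^{n+i+j-1}q^{\binom{n-j}{2}}{l \brack j}_q ,$$ where ${l\brack j}_q$ is the number of $j$-dimensional subspaces of $\mathbb{F}_q^l$.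
   Context: A $q$-matroid is a pair $(\mathcal{E},\rho)$ with $\rho$ a function from the set of $\mathbb{F}_q$-subspaces of $\mathcal{E}$ to $\mathbb{Z}_{\ge0}$ such that $0\le\rho(X)\le\dim X$, $\rho(X)\le\rho(Y)$ when $X\subseteq Y$, and $\rho(X+Y)+\rho(X\cap Y)\le\rho(X)+\rho(Y)$. The nullity is $\eta(X)=\dim X-\rho(X)$. A subspace $X$ is independent if $\rho(X)=\dim X$. A $q$-cycle of nullity $i$ is a subspace minimal under inclusion among subspaces of nullity $i$; $q$-circuits are the $q$-cycles of nullity $1$. $L$ denotes the lattice of $q$-cycles of $\mathcal{M}$ ordered by inclusion (minimum $\{0\}$, and a maximum element), and $\mu(L)=\mu(0,1)$ its Möbius number, where $\mu(x,x)=1$ and $\mu(x,y)=-\sum_{x\le z<y}\mu(x,z)$. The dual rank function is $\rho^*(X)=\dim X+\rho(X^\perp)-\rho(\mathcal{E})$ (orthogonal complement with respect to the standard bilinear form), and a coloop of $\mathcal{M}$ is a $1$-dimensional subspace $X$ with $\rho^*(X)=0$. Set $\overline{\mu}(\mathcal{M})=|\mu(L)|$ if $\mathcal{M}$ has no coloop, and $\overline{\mu}(\mathcal{M})=0$ otherwise. $I_{\mathcal{M}}$ is the order complex: the simplicial complex whose vertices are the nonzero independent subspaces of $\mathcal{M}$ and whose faces are chains $V_1\subsetneq\cdots\subsetneq V_k$ of nonzero independent subspaces (including the empty chain). Its reduced Euler characteristic is $\chi(I_{\mathcal{M}})=\sum_{k\ge0}(-1)^{k-1}f_k$, where $f_k$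 is the number of such chains of length $k$ (so $f_0=1$). -}

module Defs where

open import Data.Nat as ℕ using (ℕ; zero; suc; _∸_; _≤_; _^_)
open import Data.Nat.Combinatorics using (_C_)
open import Data.Fin using (Fin)
open import Data.Fin.Properties using (_≟_)
open import Data.Bool using (Bool; true; false; _∧_; _∨_; not; if_then_else_; T)
open import Data.List as L using (List; []; _∷_; _++_; map; length; foldr; concatMap; filterᵇ; allFin; upTo)
open import Data.Bool.ListAction using (all; any)
open import Data.Nat.ListAction using (sum)
open import Data.Vec as V using (Vec; []; _∷_)
open import Data.Integer as ℤ using (ℤ; +_)
open import Relation.Binary.PropositionalEquality using (_≡_)
open import Relation.Nullary using (¬_; does)
open import Algebra.Structures using (IsCommutativeRing)

-- A finite field with q elements, carried by Fin q.
-- (Every finite field of order q is isomorphic to one of these; q is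
-- then automatically a prime power.)

record FiniteField (q : ℕ) : Set where
  field
    _+_ _*_ : Fin q → Fin q → Fin q
    -_      : Fin q → Fin q
    0# 1#   : Fin q
    _⁻¹     : Fin q → Fin q
    isCommutativeRing : IsCommutativeRing _≡_ _+_ _*_ -_ 0# 1#
    0≢1     : ¬ (0# ≡ 1#)
    ⁻¹-inverse : ∀ x → ¬ (x ≡ 0#) → x * (x ⁻¹) ≡ 1#

allVecsOf : {A : Set} → List A → (k : ℕ) → List (Vec A k)
allVecsOf xs zero    = [] ∷ []
allVecsOf xs (suc k) = concatMap (λ a → map (a ∷_) (allVecsOf xs k)) xs

sublists : {A : Set} → List A → List (List A)
sublists []       = [] ∷ []
sublists (x ∷ xs) = sublists xs ++ map (x ∷_) (sublists xs)

sumℤ : List ℤ → ℤ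
sumℤ = foldr ℤ._+_ (+ 0)

negOnePow : ℕ → ℤ
negOnePow zero    = + 1
negOnePow (suc k) = ℤ.- negOnePow k

signPow : ℤ → ℤ
signPow k = negOnePow ℤ.∣ k ∣

range : ℕ → ℕ → List ℕ
range a b = map (ℕ._+ a) (upTo (suc b ∸ a))

module QMatroidTheory {q : ℕ} (F : FiniteField q) where
  open FiniteField F

  allF : List (Fin q)
  allF = allFin q

  Vect : ℕ → Set
  Vect n = Vec (Fin q) n

  allVecs : (n : ℕ) → List (Vect n)
  allVecs n = allVecsOf allF n

  _+v_ : {n : ℕ} → Vect n → Vect n → Vect n
  _+v_ = V.zipWith _+_

  _·v_ : {n : ℕ} → Fin q → Vect n → Vect n
  c ·v u = V.map (c *_) u

  _-v_ : {n : ℕ} → Vect n → Vect n → Vect n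
  u -v w = u +v V.map -_ w

  zeroV : {n : ℕ} → Vect n
  zeroV = V.replicate _ 0#

  isZeroV : {n : ℕ} → Vect n → Bool
  isZeroV v = all (λ a → does (a ≟ 0#)) (V.toList v)

  dot : {n : ℕ} → Vect n → Vect n → Fin q
  dot u v = foldr _+_ 0# (V.toList (V.zipWith _*_ u v))

  -- Sets of vectors in F^n, represented canonically as a q-ary trie
  -- of booleans (so that _≡_ is extensional equality of sets and the
  -- collection of all subsets is finitely enumerable without duplicates).
  VSet : ℕ → Set
  VSet zero    = Bool
  VSet (suc n) = Vec (VSet n) q

  member : {n : ℕ} → VSet n → Vect n → Bool
  member {zero}  b []      = b
  member {suc n} t (a ∷ v) = member (V.lookup t a) v

  fromPred : {n : ℕ} → (Vect n → Bool) → VSet n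
  fromPred {zero}  P = P []
  fromPred {suc n} P = V.tabulate (λ a → fromPred (λ v → P (a ∷ v)))

  allVSets : (n : ℕ) → List (VSet n)
  allVSets zero    = true ∷ false ∷ []
  allVSets (suc n) = allVecsOf (allVSets n) q

  _⊆ᵇ_ : {n : ℕ} → VSet n → VSet n → Bool
  _⊆ᵇ_ {n} X Y = all (λ v → not (member X v) ∨ member Y v) (allVecs n)

  _≡ˢ_ : {n : ℕ} → VSet n → VSet n → Bool
  X ≡ˢ Y = (X ⊆ᵇ Y) ∧ (Y ⊆ᵇ X)

  _⊂ᵇ_ : {n : ℕ} → VSet n → VSet n → Bool
  X ⊂ᵇ Y = (X ⊆ᵇ Y) ∧ not (Y ⊆ᵇ X)

  isSubspace : {n : ℕ} → VSet n → Bool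
  isSubspace {n} X =
    member X zeroV
    ∧ all (λ u → all (λ v → not (member X u ∧ member X v) ∨ member X (u +v v)) (allVecs n)) (allVecs n)
    ∧ all (λ c → all (λ u → not (member X u) ∨ member X (c ·v u)) (allVecs n)) allF

  allSubspaces : (n : ℕ) → List (VSet n)
  allSubspaces n = filterᵇ isSubspace (allVSets n)

  zeroSub : {n : ℕ} → VSet n
  zeroSub = fromPred isZeroV

  fullSpace : {n : ℕ} → VSet n
  fullSpace = fromPred (λ _ → true)

  _⊕_ : {n : ℕ} → VSet n → VSet n → VSet n
  _⊕_ {n} X Y = fromPred (λ v → any (λ x → member X x ∧ member Y (v -v x)) (allVecs n))

  _∩ˢ_ : {n : ℕ} → VSet n → VSet n → VSet n
  X ∩ˢ Y = fromPred (λ v → member X v ∧ member Y v)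

  perp : {n : ℕ} → VSet n → VSet n
  perp {n} X = fromPred (λ v → all (λ u → not (member X u) ∨ does (dot u v ≟ 0#)) (allVecs n))

  span : {n : ℕ} → List (VSet n) → VSet n
  span = foldr _⊕_ zeroSub

  lincomb : {n k : ℕ} → Vec (Fin q) k → Vec (Vect n) k → Vect n
  lincomb c w = foldr _+v_ zeroV (V.toList (V.zipWith _·v_ c w))

  linIndep : {n k : ℕ} → Vec (Vect n) k → Bool
  linIndep {n} {k} w = all (λ c → not (isZeroV (lincomb c w)) ∨ isZeroV c) (allVecsOf allF k)

  hasIndep : {n : ℕ} → VSet n → (k : ℕ) → Bool
  hasIndep {n} X k = any (λ w → all (member X) (V.toList w) ∧ linIndep w) (allVecsOf (allVecs n) k)

  dimUpTo : {n : ℕ} → VSet n → ℕ → ℕ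
  dimUpTo X zero    = zero
  dimUpTo X (suc k) = if hasIndep X (suc k) then suc k else dimUpTo X k

  dim : {n : ℕ} → VSet n → ℕ
  dim {n} X = dimUpTo X n

  gauss : ℕ → ℕ → ℕ
  gauss l j = length (filterᵇ (λ X → dim X ℕ.≡ᵇ j) (allSubspaces l))

  -- q-matroids on E = F_q^n.  The rank function is given as a function
  -- on all sets of vectors; only its values on subspaces are ever used,
  -- and the axioms are imposed on subspaces only.

  record IsQMatroid (n : ℕ) (ρ : VSet n → ℕ) : Set where
    field
      rank-≤-dim : ∀ X → T (isSubspace X) → ρ X ≤ dim X
      rank-mono  : ∀ X Y → T (isSubspace X) → T (isSubspace Y) →
                   T (X ⊆ᵇ Y) → ρ X ≤ ρ Y
      rank-submod : ∀ X Y → T (isSubspace X) → T (isSubspace Y) →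
                    ρ (X ⊕ Y) ℕ.+ ρ (X ∩ˢ Y) ≤ ρ X ℕ.+ ρ Y

  module _ {n : ℕ} (ρ : VSet n → ℕ) where

    rk : ℕ
    rk = ρ fullSpace

    nullity : VSet n → ℕ
    nullity X = dim X ∸ ρ X

    isCycle : VSet n → Bool
    isCycle X = isSubspace X ∧
      not (any (λ Y → (Y ⊂ᵇ X) ∧ (nullity Y ℕ.≡ᵇ nullity X)) (allSubspaces n))

    cycles : List (VSet n)
    cycles = filterᵇ isCycle (allSubspaces n)

    circuits : List (VSet n)
    circuits = filterᵇ (λ X → nullity X ℕ.≡ᵇ 1) cycles

    topL : VSet n
    topL = foldr (λ y acc → if all (λ z → z ⊆ᵇ y) cycles then y else acc) fullSpace cycles

    -- μ(0, y) in L, computed by the recursion μ(0,0)=1,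
    -- μ(0,y) = - Σ_{0 ≤ z < y} μ(0,z); the first argument is fuel
    -- (dim strictly increases along chains, so fuel n+1 suffices).
    mobius : ℕ → VSet n → ℤ
    mobius zero    y = + 0
    mobius (suc k) y =
      if y ≡ˢ zeroSub then + 1
      else ℤ.- sumℤ (map (mobius k) (filterᵇ (λ z → z ⊂ᵇ y) cycles))

    μL : ℤ
    μL = mobius (suc n) topL

    ρ* : VSet n → ℤ
    ρ* X = (+ (dim X ℕ.+ ρ (perp X))) ℤ.- (+ rk)

    hasColoop : Bool
    hasColoop = any (λ X → (dim X ℕ.≡ᵇ 1) ∧ does (ρ* X ℤ.≟ + 0)) (allSubspaces n)

    μbar : ℕ
    μbar = if hasColoop then 0 else ℤ.∣ μL ∣

    isIndependent : VSet n → Bool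
    isIndependent X = isSubspace X ∧ (ρ X ℕ.≡ᵇ dim X)

    vertices : List (VSet n)
    vertices = filterᵇ (λ X → isIndependent X ∧ not (X ≡ˢ zeroSub)) (allVSets n)

    chainsEndingAt : ℕ → VSet n → ℕ
    chainsEndingAt zero          V = 0
    chainsEndingAt (suc zero)    V = 1
    chainsEndingAt (suc (suc k)) V =
      sum (map (chainsEndingAt (suc k)) (filterᵇ (λ W → W ⊂ᵇ V) vertices))

    f : ℕ → ℕ
    f zero    = 1
    f (suc k) = sum (map (chainsEndingAt (suc k)) vertices)

    -- reduced Euler characteristic  Σ_{k ≥ 0} (-1)^{k-1} f_k;
    -- chains have length ≤ n, so f_k = 0 for k > n.
    χ : ℤ
    χ = sumℤ (map (λ k → signPow ((+ k) ℤ.- + 1) ℤ.* (+ f k)) (range 0 n))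

    s : ℕ
    s = length circuits

    lam : ℕ → ℕ → ℕ
    lam i l = length (filterᵇ
      (λ X → (length X ℕ.≡ᵇ i) ∧ ((n ∸ dim (span X)) ℕ.≡ᵇ l))
      (sublists circuits))

    rhs : ℤ
    rhs = signPow ((+ rk) ℤ.- + 1) ℤ.* (+ (q ^ (n C 2))) ℤ.* (+ μbar)
      ℤ.+ sumℤ (map (λ l → sumℤ (map (λ i →
            (+ lam i l) ℤ.* sumℤ (map (λ j →
               signPow ((+ (n ℕ.+ i ℕ.+ j)) ℤ.- + 1)
               ℤ.* (+ (q ^ ((n ∸ j) C 2)))
               ℤ.* (+ gauss l j))
             (range 0 l)))
          (range 1 s)))
        (range 1 (n ∸ 1)))

{-# OPTIONS --safe #-}
module Submission where

open import Defs
open import Algebra.Bundles using (AbelianGroup; CommutativeRing)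
open import Algebra.Structures using (IsCommutativeRing)
import Algebra.Properties.Group as GroupProperties
import Algebra.Properties.Ring as RingProperties
open import Data.Bool using (Bool; true; false; _∧_; _∨_; not; if_then_else_; T)
open import Data.Bool.Properties using (T-≡; T-∧; T?)
open import Data.Bool.ListAction using (all; any)
open import Data.Empty using (⊥; ⊥-elim)
open import Data.Fin as Fin using (Fin)
import Data.Fin.Properties as Finₚ
open import Data.Integer as ℤ using (ℤ; +_; 0ℤ; 1ℤ)
import Data.Integer.Properties as ℤₚ
open import Data.Integer.Tactic.RingSolver using (solve-∀)
open import Data.List using (List; concatMap; []; _∷_; _++_; map; length; foldr; filterᵇ; upTo; cartesianProductWith)
open import Data.List.Membership.Propositional using (_∈_; find; lose)
open import Data.List.Membership.Propositional.Properties using (∈-filter⁺; ∈-filter⁻; ∈-map⁺; ∈-map⁻; ∈-allFin; ∈-upTo⁺; ∈-upTo⁻; ∈-cartesianProductWith⁺; ∈-++⁻)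
open import Data.List.Membership.Propositional.Properties.WithK using (unique∧set⇒bag)
import Data.List.Properties as Listₚ
open import Data.List.Relation.Binary.BagAndSetEquality using (∼bag⇒↭)
open import Data.List.Relation.Binary.Permutation.Propositional as Perm using (_↭_)
open import Data.List.Relation.Unary.All as All using (All; []; _∷_)
open import Data.List.Relation.Unary.All.Properties using (all⁺; all⁻)
open import Data.List.Relation.Unary.Any using (here; there)
open import Data.List.Relation.Unary.Any.Properties using (any⁺; any⁻)
open import Data.List.Relation.Unary.AllPairs using ([]; _∷_)
open import Data.List.Relation.Unary.Unique.Propositional using (Unique)
open import Data.List.Relation.Unary.Unique.Propositional.Properties as Uniqueₚ using ()
open import Data.Nat as ℕ using (ℕ; zero; suc; _∸_; _≤_; _<_; _^_; z≤n; s≤s)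
open import Data.Nat.Combinatorics using (nC1≡n; nCk+nC[k+1]≡[n+1]C[k+1]) renaming (_C_ to _choose_)
open import Data.Nat.ListAction using (sum)
import Data.Nat.Properties as ℕₚ
open import Data.Nat.Tactic.RingSolver using () renaming (solve-∀ to ℕ-solve-∀)
open import Data.Product using (∃; _×_; _,_; proj₁; proj₂)
open import Data.Sum using (_⊎_; inj₁; inj₂)
open import Data.Vec as Vec using (Vec; []; _∷_)
import Data.Vec.Properties as Vecₚ
open import Function using (_∘_; id; Equivalence; mk⇔)
open import Relation.Binary.PropositionalEquality using (_≡_; _≢_; refl; sym; trans; cong; cong₂; subst; module ≡-Reasoning)
open import Relation.Nullary using (¬_; Dec; yes; no; does; contradiction)

-- Write w(V) = (-1)^d q^(d choose 2), d = dim V, for the Möbius function of the subspace lattice. By Philip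
-- Hall's theorem χ(I_M) = - Σ w(V), summed over the independent V. Let ν(W) be the sum of (-1)^|X| over the sets
-- X of circuits with span W. Then Σ_{V ⊆ W} ν(V) is 1 if W is independent and 0 otherwise, so
-- χ(I_M) = - Σ_W ν(W) Σ_{V ⊇ W} w(V). Orthogonal complements turn the inner sum into a sum of Gaussian binomials
-- depending only on l = codim W. The codimensions 1 ≤ l ≤ n-1 give the double sum, and l = n (W = 0) contributes
-- Σ_V w(V) = 0. For l = 0 one needs (-1)^n ν(E) = (-1)^r |μ(L)| when there is no coloop, and ν(E) = 0 otherwise.
-- Now ν is the Möbius inverse of the independence indicator; it vanishes off the cycles, hence satisfies the
-- recursion for μ on L, and E is a cycle exactly when there is no coloop. Its sign is (-1)^nullity by induction:
-- for a hyperplane H of W containing Z, the Möbius inverse at W relative to Z is minus the sum of those relative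
-- to the minimal C of nullity one over Z with C ⊆ W and C ⊄ H.

-- The sign of μ(L) is the main obstacle: its induction has to pass from M to contractions of M. A
-- contraction lives on a quotient space, so the ambient space would change at every step. Instead a
-- subspace Z is carried as a parameter, and everything over Z takes place among the subspaces of
-- the one space E: independence over Z means containing Z with the same nullity, and a circuit over
-- Z is a minimal subspace above Z of nullity one more. Identities between functions on subspaces
-- are proved by comparing their sums over the subspaces of each Y, since these sums determine a
-- function. The linear algebra rests on counting. An injection of F^k into F^d forces k ≤ d because
-- q ≥ 2. That Σ w(V) = 0 is seen by projecting F^(m+1) to F^m: above a d-dimensional subspace lie
-- one subspace of dimension d + 1 and q^d of dimension d, and their weights cancel because (d+1
-- choose 2) = d + (d choose 2). This is where the exponents of q come from.

-- Boolean tests as propositions, and membership in filtered lists.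

¬T⇒≡false : ∀ {b} → ¬ T b → b ≡ false
¬T⇒≡false {false} _ = refl
¬T⇒≡false {true}  h = ⊥-elim (h _)

T-ext : ∀ {a b} → (T a → T b) → (T b → T a) → a ≡ b
T-ext {true}          h _ = sym (Equivalence.to T-≡ (h _))
T-ext {false} {false} _ _ = refl
T-ext {false} {true}  _ k = ⊥-elim (k _)

∧⁺ : ∀ {a b} → T a → T b → T (a ∧ b)
∧⁺ x y = Equivalence.from T-∧ (x , y)

∧⁻ : ∀ {a b} → T (a ∧ b) → T a × T b
∧⁻ = Equivalence.to T-∧

not⁺ : ∀ {b} → ¬ T b → T (not b)
not⁺ {false} _ = _
not⁺ {true}  h = ⊥-elim (h _)

not⁻ : ∀ {b} → T (not b) → ¬ T b
not⁻ {false} _ ()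

implies⁺ : ∀ {a b} → (T a → T b) → T (not a ∨ b)
implies⁺ {false} _ = _
implies⁺ {true}  h = h _

implies⁻ : ∀ {a b} → T (not a ∨ b) → T a → T b
implies⁻ {true} h _ = h

does⁺ : ∀ {A : Set} (d : Dec A) → A → T (does d)
does⁺ (yes _) _ = _
does⁺ (no ¬a) a = ⊥-elim (¬a a)

does⁻ : ∀ {A : Set} (d : Dec A) → T (does d) → A
does⁻ (yes a) _ = a

module _ {A : Set} where

  all-T⁺ : ∀ (p : A → Bool) xs → (∀ {x} → x ∈ xs → T (p x)) → T (all p xs)
  all-T⁺ p xs h = all⁻ p (All.tabulate h)

  all-T⁻ : ∀ (p : A → Bool) xs {x} → T (all p xs) → x ∈ xs → T (p x)
  all-T⁻ p xs h = All.lookup (all⁺ p xs h)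

  any-T⁺ : ∀ (p : A → Bool) xs {x} → x ∈ xs → T (p x) → T (any p xs)
  any-T⁺ p xs x∈xs px = any⁺ p (lose x∈xs px)

  any-T⁻ : ∀ (p : A → Bool) xs → T (any p xs) → ∃ λ x → x ∈ xs × T (p x)
  any-T⁻ p xs h = find (any⁻ p xs h)

  filterᵇ⁺ : ∀ (p : A → Bool) xs {x} → x ∈ xs → T (p x) → x ∈ filterᵇ p xs
  filterᵇ⁺ p xs = ∈-filter⁺ (λ x → T? (p x))

  filterᵇ⁻ : ∀ (p : A → Bool) xs {x} → x ∈ filterᵇ p xs → x ∈ xs × T (p x)
  filterᵇ⁻ p xs = ∈-filter⁻ (λ x → T? (p x))

  filterᵇ-unique : ∀ (p : A → Bool) xs → Unique xs → Unique (filterᵇ p xs)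
  filterᵇ-unique p xs = Uniqueₚ.filter⁺ (λ x → T? (p x))

  filterᵇ-step : ∀ (p : A → Bool) x xs →
    filterᵇ p (x ∷ xs) ≡ (if p x then x ∷ filterᵇ p xs else filterᵇ p xs)
  filterᵇ-step p x xs with p x
  ... | true  = refl
  ... | false = refl

unique-map : ∀ {A B : Set} (f : A → B) {xs} →
  (∀ {x y} → x ∈ xs → y ∈ xs → f x ≡ f y → x ≡ y) → Unique xs → Unique (map f xs)
unique-map f inj []          = []
unique-map f {x ∷ xs} inj (x∉ ∷ u) =
  All.tabulate fx≢ ∷ unique-map f (λ p r → inj (there p) (there r)) u
  where
  fx≢ : ∀ {z} → z ∈ map f xs → f x ≢ z
  fx≢ z∈ eq with ∈-map⁻ f z∈
  ... | y , y∈xs , refl = All.lookup x∉ y∈xs (inj (here refl) (there y∈xs) eq)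

-- Finite integer sums over lists.

𝟙 : Bool → ℤ
𝟙 b = if b then 1ℤ else 0ℤ

𝟙-true : ∀ {b} → T b → 𝟙 b ≡ 1ℤ
𝟙-true h = cong 𝟙 (Equivalence.to T-≡ h)

𝟙-false : ∀ {b} → ¬ T b → 𝟙 b ≡ 0ℤ
𝟙-false h = cong 𝟙 (¬T⇒≡false h)

𝟙-∧ : ∀ a b → 𝟙 (a ∧ b) ≡ 𝟙 a ℤ.* 𝟙 b
𝟙-∧ true  b = sym (ℤₚ.*-identityˡ (𝟙 b))
𝟙-∧ false b = refl

∑ : {A : Set} → List A → (A → ℤ) → ℤ
∑ xs f = sumℤ (map f xs)

module _ {A : Set} where

  ∑-cong : ∀ (xs : List A) {f g : A → ℤ} → (∀ {x} → x ∈ xs → f x ≡ g x) → ∑ xs f ≡ ∑ xs g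
  ∑-cong []       h = refl
  ∑-cong (x ∷ xs) h = cong₂ ℤ._+_ (h (here refl)) (∑-cong xs (h ∘ there))

  ∑-0 : ∀ (xs : List A) → ∑ xs (λ _ → 0ℤ) ≡ 0ℤ
  ∑-0 []       = refl
  ∑-0 (x ∷ xs) = trans (ℤₚ.+-identityˡ _) (∑-0 xs)

  ∑-vanish : ∀ (xs : List A) {f} → (∀ {x} → x ∈ xs → f x ≡ 0ℤ) → ∑ xs f ≡ 0ℤ
  ∑-vanish xs h = trans (∑-cong xs h) (∑-0 xs)

  ∑-+ : ∀ (xs : List A) f g → ∑ xs (λ x → f x ℤ.+ g x) ≡ ∑ xs f ℤ.+ ∑ xs g
  ∑-+ []       f g = refl
  ∑-+ (x ∷ xs) f g = trans (cong (λ t → f x ℤ.+ g x ℤ.+ t) (∑-+ xs f g)) (shuffle (f x) (g x) (∑ xs f) (∑ xs g))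
    where
    shuffle : ∀ a b c d → a ℤ.+ b ℤ.+ (c ℤ.+ d) ≡ a ℤ.+ c ℤ.+ (b ℤ.+ d)
    shuffle = solve-∀

  ∑-*ˡ : ∀ (xs : List A) c f → ∑ xs (λ x → c ℤ.* f x) ≡ c ℤ.* ∑ xs f
  ∑-*ˡ []       c f = sym (ℤₚ.*-zeroʳ c)
  ∑-*ˡ (x ∷ xs) c f = trans (cong (λ t → c ℤ.* f x ℤ.+ t) (∑-*ˡ xs c f)) (sym (ℤₚ.*-distribˡ-+ c (f x) (∑ xs f)))

  ∑-*ʳ : ∀ (xs : List A) c f → ∑ xs (λ x → f x ℤ.* c) ≡ ∑ xs f ℤ.* c
  ∑-*ʳ xs c f = trans (∑-cong xs (λ {x} _ → ℤₚ.*-comm (f x) c)) (trans (∑-*ˡ xs c f) (ℤₚ.*-comm c _))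

  ∑-neg : ∀ (xs : List A) f → ∑ xs (λ x → ℤ.- f x) ≡ ℤ.- ∑ xs f
  ∑-neg []       f = refl
  ∑-neg (x ∷ xs) f = trans (cong (λ t → ℤ.- f x ℤ.+ t) (∑-neg xs f)) (sym (ℤₚ.neg-distrib-+ (f x) (∑ xs f)))

  ∑-++ : ∀ (xs ys : List A) f → ∑ (xs ++ ys) f ≡ ∑ xs f ℤ.+ ∑ ys f
  ∑-++ []       ys f = sym (ℤₚ.+-identityˡ _)
  ∑-++ (x ∷ xs) ys f = trans (cong (ℤ._+_ (f x)) (∑-++ xs ys f)) (sym (ℤₚ.+-assoc (f x) _ _))

  ∑-map : ∀ {B : Set} (g : B → A) (ys : List B) f → ∑ (map g ys) f ≡ ∑ ys (f ∘ g)
  ∑-map g []       f = refl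
  ∑-map g (y ∷ ys) f = cong (ℤ._+_ (f (g y))) (∑-map g ys f)

  ∑-filter : ∀ (p : A → Bool) xs f → ∑ (filterᵇ p xs) f ≡ ∑ xs (λ x → 𝟙 (p x) ℤ.* f x)
  ∑-filter p []       f = refl
  ∑-filter p (x ∷ xs) f rewrite filterᵇ-step p x xs with p x
  ... | true  = cong₂ ℤ._+_ (sym (ℤₚ.*-identityˡ (f x))) (∑-filter p xs f)
  ... | false = trans (∑-filter p xs f) (sym (ℤₚ.+-identityˡ _))

  ∑-const : ∀ (xs : List A) c → ∑ xs (λ _ → c) ≡ + length xs ℤ.* c
  ∑-const []       c = refl
  ∑-const (x ∷ xs) c = trans (cong (ℤ._+_ (c)) (∑-const xs c)) (sym (ℤₚ.suc-* (+ length xs) c))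

  length-filter : ∀ (p : A → Bool) xs → + length (filterᵇ p xs) ≡ ∑ xs (𝟙 ∘ p)
  length-filter p xs = begin
    + length (filterᵇ p xs)            ≡⟨ sym (ℤₚ.*-identityʳ _) ⟩
    + length (filterᵇ p xs) ℤ.* 1ℤ     ≡⟨ sym (∑-const (filterᵇ p xs) 1ℤ) ⟩
    ∑ (filterᵇ p xs) (λ _ → 1ℤ)        ≡⟨ ∑-filter p xs (λ _ → 1ℤ) ⟩
    ∑ xs (λ x → 𝟙 (p x) ℤ.* 1ℤ)        ≡⟨ ∑-cong xs (λ _ → ℤₚ.*-identityʳ _) ⟩
    ∑ xs (𝟙 ∘ p)                       ∎
    where open ≡-Reasoning

  +-sum : ∀ (xs : List A) (f : A → ℕ) → + sum (map f xs) ≡ ∑ xs (λ x → + f x)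
  +-sum []       f = refl
  +-sum (x ∷ xs) f = trans (ℤₚ.pos-+ (f x) _) (cong (ℤ._+_ (+ f x)) (+-sum xs f))

  ∑-nonneg : ∀ (xs : List A) {f} → (∀ {x} → x ∈ xs → 0ℤ ℤ.≤ f x) → 0ℤ ℤ.≤ ∑ xs f
  ∑-nonneg []       h = ℤₚ.≤-refl
  ∑-nonneg (x ∷ xs) h = ℤₚ.+-mono-≤ (h (here refl)) (∑-nonneg xs (h ∘ there))

  ∑-↭ : ∀ {xs ys : List A} f → xs ↭ ys → ∑ xs f ≡ ∑ ys f
  ∑-↭ f Perm.refl         = refl
  ∑-↭ f (Perm.prep x p)   = cong (ℤ._+_ (f x)) (∑-↭ f p)
  ∑-↭ f (Perm.swap {xs} {ys} x y p) = trans (cong (λ t → f x ℤ.+ (f y ℤ.+ t)) (∑-↭ f p)) (exchange (f x) (f y) (∑ ys f))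
    where
    exchange : ∀ a b c → a ℤ.+ (b ℤ.+ c) ≡ b ℤ.+ (a ℤ.+ c)
    exchange = solve-∀
  ∑-↭ f (Perm.trans p r)  = trans (∑-↭ f p) (∑-↭ f r)

  ∑-set : ∀ {xs ys : List A} f → Unique xs → Unique ys →
    (∀ {x} → x ∈ xs → x ∈ ys) → (∀ {x} → x ∈ ys → x ∈ xs) → ∑ xs f ≡ ∑ ys f
  ∑-set f ux uy h k = ∑-↭ f (∼bag⇒↭ (unique∧set⇒bag ux uy (mk⇔ h k)))

  ∑-single : ∀ {xs : List A} {x} f → Unique xs → x ∈ xs →
    (∀ {y} → y ∈ xs → y ≢ x → f y ≡ 0ℤ) → ∑ xs f ≡ f x
  ∑-single {x ∷ xs} f (x∉ ∷ u) (here refl) h = trans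
    (cong (ℤ._+_ (f x)) (∑-vanish xs (λ y∈ → h (there y∈) (λ y≡x → All.lookup x∉ y∈ (sym y≡x)))))
    (ℤₚ.+-identityʳ (f x))
  ∑-single {y ∷ xs} f (y∉ ∷ u) (there x∈) h = trans
    (cong₂ ℤ._+_ (h (here refl) (All.lookup y∉ x∈)) (∑-single f u x∈ (h ∘ there)))
    (ℤₚ.+-identityˡ _)

∑-comm : ∀ {A B : Set} (xs : List A) (ys : List B) (f : A → B → ℤ) →
  ∑ xs (λ x → ∑ ys (f x)) ≡ ∑ ys (λ y → ∑ xs (λ x → f x y))
∑-comm []       ys f = sym (∑-0 ys)
∑-comm (x ∷ xs) ys f = trans (cong (ℤ._+_ (∑ ys (f x))) (∑-comm xs ys f)) (sym (∑-+ ys (f x) _))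

∑-bijection : ∀ {A B : Set} {xs : List A} {ys : List B} (to : A → B) (from : B → A) →
  Unique xs → Unique ys →
  (∀ {x} → x ∈ xs → to x ∈ ys) → (∀ {y} → y ∈ ys → from y ∈ xs) →
  (∀ {x} → x ∈ xs → from (to x) ≡ x) → (∀ {y} → y ∈ ys → to (from y) ≡ y) →
  ∀ f → ∑ xs (f ∘ to) ≡ ∑ ys f
∑-bijection {xs = xs} {ys} to from ux uy to∈ from∈ from-to to-from f =
  trans (sym (∑-map to xs f)) (∑-set f (unique-map to to-inj ux) uy image⊆ ⊆image)
  where
  to-inj : ∀ {x y} → x ∈ xs → y ∈ xs → to x ≡ to y → x ≡ y
  to-inj x∈ y∈ eq = trans (sym (from-to x∈)) (trans (cong from eq) (from-to y∈))
  image⊆ : ∀ {z} → z ∈ map to xs → z ∈ ys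
  image⊆ z∈ with ∈-map⁻ to z∈
  ... | x , x∈ , refl = to∈ x∈
  ⊆image : ∀ {z} → z ∈ ys → z ∈ map to xs
  ⊆image z∈ = subst (_∈ map to xs) (to-from z∈) (∈-map⁺ to (from∈ z∈))

-- Each `x` is selected by exactly one `y`, so the factor Σ_y 𝟙(p x y) = 1 can be inserted and the
-- two sums exchanged.
∑-fibre : ∀ {A B : Set} (xs : List A) (ys : List B) (p : A → B → Bool) (g : A → ℤ) → Unique ys →
  (∀ {x} → x ∈ xs → ∃ λ y → y ∈ ys × T (p x y) × (∀ {z} → T (p x z) → z ≡ y)) →
  ∑ xs g ≡ ∑ ys (λ y → ∑ (filterᵇ (λ x → p x y) xs) g)
∑-fibre xs ys p g uy fibre = begin
  ∑ xs g
    ≡⟨ ∑-cong xs (λ x∈ → sym (pick (fibre x∈))) ⟩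
  ∑ xs (λ x → ∑ ys (λ y → 𝟙 (p x y) ℤ.* g x))
    ≡⟨ ∑-comm xs ys (λ x y → 𝟙 (p x y) ℤ.* g x) ⟩
  ∑ ys (λ y → ∑ xs (λ x → 𝟙 (p x y) ℤ.* g x))
    ≡⟨ ∑-cong ys (λ {y} _ → sym (∑-filter (λ x → p x y) xs g)) ⟩
  ∑ ys (λ y → ∑ (filterᵇ (λ x → p x y) xs) g) ∎
  where
  open ≡-Reasoning
  pick : ∀ {x} → (∃ λ y → y ∈ ys × T (p x y) × (∀ {z} → T (p x z) → z ≡ y)) → ∑ ys (λ y → 𝟙 (p x y) ℤ.* g x) ≡ g x
  pick {x} (y , y∈ , pxy , only) = trans
    (∑-single (λ y → 𝟙 (p x y) ℤ.* g x) uy y∈ (λ _ z≢y → cong (ℤ._* g x) (𝟙-false (λ pxz → z≢y (only pxz)))))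
    (trans (cong (ℤ._* g x) (𝟙-true pxy)) (ℤₚ.*-identityˡ (g x)))

-- Applied with `d` the dimension, this is how the counts `gauss l j` arise from sums over
-- subspaces.
∑-group : ∀ {A : Set} (xs : List A) (d : A → ℕ) (h : ℕ → ℤ) (js : List ℕ) → Unique js →
  (∀ {x} → x ∈ xs → d x ∈ js) →
  ∑ xs (h ∘ d) ≡ ∑ js (λ j → + length (filterᵇ (λ x → d x ℕ.≡ᵇ j) xs) ℤ.* h j)
∑-group xs d h js uj d∈ = trans
  (∑-fibre xs js (λ x j → d x ℕ.≡ᵇ j) (h ∘ d) uj
    (λ {x} x∈ → d x , d∈ x∈ , ℕₚ.≡⇒≡ᵇ (d x) (d x) refl , λ {j} eq → sym (ℕₚ.≡ᵇ⇒≡ (d x) j eq)))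
  (∑-cong js (λ {j} _ → trans
    (∑-cong (filterᵇ (λ x → d x ℕ.≡ᵇ j) xs) (λ {x} x∈ → cong h (ℕₚ.≡ᵇ⇒≡ (d x) j (proj₂ (filterᵇ⁻ (λ x → d x ℕ.≡ᵇ j) xs x∈)))))
    (∑-const (filterᵇ (λ x → d x ℕ.≡ᵇ j) xs) (h j))))

-- Ranges of naturals and enumeration of vectors over a list.

∈-range⁺ : ∀ {a b k} → a ≤ k → k ≤ b → k ∈ range a b
∈-range⁺ {a} {b} {k} a≤k k≤b = subst (_∈ range a b) (ℕₚ.m∸n+n≡m a≤k)
  (∈-map⁺ (ℕ._+ a) (∈-upTo⁺ (subst (k ∸ a <_) (sym (ℕₚ.+-∸-assoc 1 (ℕₚ.≤-trans a≤k k≤b))) (s≤s (ℕₚ.∸-monoˡ-≤ a k≤b)))))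

∈-range⁻ : ∀ {a b k} → k ∈ range a b → a ≤ k × k ≤ b
∈-range⁻ {a} {b} k∈ with ∈-map⁻ (ℕ._+ a) k∈
... | i , i∈ , refl = ℕₚ.m≤n+m a i , ℕₚ.≤-pred (subst (suc i ℕ.+ a ≤_) (ℕₚ.m∸n+n≡m a≤1+b) (ℕₚ.+-monoˡ-≤ a (∈-upTo⁻ i∈)))
  where
  -- Were `a` beyond `suc b`, the truncated length `suc b ∸ a` would be 0 and the range would have
  -- no member.
  a≤1+b : a ≤ suc b
  a≤1+b = ℕₚ.<⇒≤ (ℕₚ.m∸n≢0⇒n<m λ eq → ℕₚ.n≮0 (subst (i <_) eq (∈-upTo⁻ i∈)))

range-unique : ∀ a b → Unique (range a b)
range-unique a b = Uniqueₚ.map⁺ (λ {i} {j} → ℕₚ.+-cancelʳ-≡ a i j) (Uniqueₚ.upTo⁺ (suc b ∸ a))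

allVecsOf-complete : ∀ {A : Set} {xs : List A} → (∀ a → a ∈ xs) → ∀ k (v : Vec A k) → v ∈ allVecsOf xs k
allVecsOf-unique : ∀ {A : Set} {xs : List A} → Unique xs → ∀ k → Unique (allVecsOf xs k)

-- The heads and the entries of the tails are kept as separate lists, because the induction shortens
-- only the former.
allVecsOf-cartesian : ∀ {A : Set} (xs ys : List A) k →
  concatMap (λ a → map (a ∷_) (allVecsOf ys k)) xs ≡ cartesianProductWith _∷_ xs (allVecsOf ys k)
allVecsOf-cartesian []       ys k = refl
allVecsOf-cartesian (x ∷ xs) ys k = cong (map (x ∷_) (allVecsOf ys k) ++_) (allVecsOf-cartesian xs ys k)

allVecsOf-complete         h zero    []      = here refl
allVecsOf-complete {xs = xs} h (suc k) (a ∷ v) rewrite allVecsOf-cartesian xs xs k =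
  ∈-cartesianProductWith⁺ _∷_ (h a) (allVecsOf-complete h k v)

allVecsOf-unique         u zero    = [] ∷ []
allVecsOf-unique {xs = xs} u (suc k) rewrite allVecsOf-cartesian xs xs k =
  Uniqueₚ.cartesianProductWith⁺ _∷_ Vecₚ.∷-injective u (allVecsOf-unique u k)

length-allVecsOf : ∀ {A : Set} (xs : List A) k → length (allVecsOf xs k) ≡ length xs ^ k
length-allVecsOf xs zero    = refl
length-allVecsOf xs (suc k) = concat-length xs
  where
  vs = allVecsOf xs k
  concat-length : ∀ ys → length (concatMap (λ a → map (a ∷_) vs) ys) ≡ length ys ℕ.* length xs ^ k
  concat-length []       = refl
  concat-length (y ∷ ys) = trans (Listₚ.length-++ (map (y ∷_) vs))
    (cong₂ ℕ._+_ (trans (Listₚ.length-map (y ∷_) vs) (length-allVecsOf xs k)) (concat-length ys))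

-- Powers of -1.

open GroupProperties (AbelianGroup.group ℤₚ.+-0-abelianGroup) using () renaming (∙-cancelʳ to +ℤ-cancelʳ; inverseˡ-unique to +ℤ-inverseˡ-unique)

negOnePow-+ : ∀ m n → negOnePow (m ℕ.+ n) ≡ negOnePow m ℤ.* negOnePow n
negOnePow-+ zero    n = sym (ℤₚ.*-identityˡ _)
negOnePow-+ (suc m) n = trans (cong ℤ.-_ (negOnePow-+ m n)) (ℤₚ.neg-distribˡ-* (negOnePow m) (negOnePow n))

negOnePow-square : ∀ m → negOnePow m ℤ.* negOnePow m ≡ 1ℤ
negOnePow-square zero    = refl
negOnePow-square (suc m) = trans (neg*neg (negOnePow m)) (negOnePow-square m)
  where
  neg*neg : ∀ a → ℤ.- a ℤ.* ℤ.- a ≡ a ℤ.* a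
  neg*neg = solve-∀

-- The exponent is an integer: for `k` = 0 it is -1, whose absolute value 1 still gives the sign -1.
signPow-pred : ∀ k → signPow ((+ k) ℤ.- + 1) ≡ ℤ.- negOnePow k
signPow-pred zero    = refl
signPow-pred (suc k) = trans (cong signPow (ℤₚ.⊖-≥ {suc k} {1} (s≤s z≤n))) (sym (ℤₚ.neg-involutive (negOnePow k)))

-- Coordinate vectors, linear maps and linear functionals over F.

module Vectors {q : ℕ} (F : FiniteField q) where

  open FiniteField F renaming (_+_ to _+ᶠ_; _*_ to _*ᶠ_; -_ to -ᶠ_)
  open QMatroidTheory F hiding (f; s)
  open IsCommutativeRing isCommutativeRing using (*-comm; *-identityˡ; distribˡ; distribʳ; zeroˡ; zeroʳ)
    renaming (*-assoc to *ᶠ-assoc; +-assoc to +ᶠ-assoc; +-comm to +ᶠ-comm; +-identityˡ to +ᶠ-identityˡ; -‿inverseʳ to +ᶠ-inverseʳ)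

  fieldRing : CommutativeRing _ _
  fieldRing = record { isCommutativeRing = isCommutativeRing }

  open RingProperties (CommutativeRing.ring fieldRing) using (-1*x≈-x)

  -- Makes q^k strictly increasing in k, on which the invariance of dimension rests.
  2≤q : 2 ≤ q
  2≤q = two-distinct 0# 1# 0≢1
    where
    two-distinct : ∀ {m} (a b : Fin m) → a ≢ b → 2 ≤ m
    two-distinct {suc zero}    Fin.zero Fin.zero a≢b = contradiction refl a≢b
    two-distinct {suc (suc m)} _        _        _   = s≤s (s≤s z≤n)

  +v-assoc : ∀ {n} (u v w : Vect n) → (u +v v) +v w ≡ u +v (v +v w)
  +v-assoc = Vecₚ.zipWith-assoc +ᶠ-assoc

  +v-comm : ∀ {n} (u v : Vect n) → u +v v ≡ v +v u
  +v-comm = Vecₚ.zipWith-comm +ᶠ-comm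

  +v-identityˡ : ∀ {n} (u : Vect n) → zeroV +v u ≡ u
  +v-identityˡ = Vecₚ.zipWith-identityˡ +ᶠ-identityˡ

  +v-identityʳ : ∀ {n} (u : Vect n) → u +v zeroV ≡ u
  +v-identityʳ u = trans (+v-comm u zeroV) (+v-identityˡ u)

  ·v-distribˡ : ∀ {n} c (u v : Vect n) → c ·v (u +v v) ≡ (c ·v u) +v (c ·v v)
  ·v-distribˡ c []      []      = refl
  ·v-distribˡ c (a ∷ u) (b ∷ v) = cong₂ _∷_ (distribˡ c a b) (·v-distribˡ c u v)

  ·v-distribʳ : ∀ {n} c d (u : Vect n) → (c +ᶠ d) ·v u ≡ (c ·v u) +v (d ·v u)
  ·v-distribʳ c d []      = refl
  ·v-distribʳ c d (a ∷ u) = cong₂ _∷_ (distribʳ a c d) (·v-distribʳ c d u)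

  ·v-assoc : ∀ {n} c d (u : Vect n) → (c *ᶠ d) ·v u ≡ c ·v (d ·v u)
  ·v-assoc c d []      = refl
  ·v-assoc c d (a ∷ u) = cong₂ _∷_ (*ᶠ-assoc c d a) (·v-assoc c d u)

  1·v : ∀ {n} (u : Vect n) → 1# ·v u ≡ u
  1·v []      = refl
  1·v (a ∷ u) = cong₂ _∷_ (*-identityˡ a) (1·v u)

  0·v : ∀ {n} (u : Vect n) → 0# ·v u ≡ zeroV
  0·v []      = refl
  0·v (a ∷ u) = cong₂ _∷_ (zeroˡ a) (0·v u)

  ·v-zero : ∀ {n} c → c ·v zeroV {n} ≡ zeroV
  ·v-zero {zero}  c = refl
  ·v-zero {suc n} c = cong₂ _∷_ (zeroʳ c) (·v-zero c)

  -1# : Fin q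
  -1# = -ᶠ 1#

  neg-·v : ∀ {n} (u : Vect n) → Vec.map -ᶠ_ u ≡ -1# ·v u
  neg-·v []      = refl
  neg-·v (a ∷ u) = cong₂ _∷_ (sym (-1*x≈-x a)) (neg-·v u)

  -v-def : ∀ {n} (u v : Vect n) → u -v v ≡ u +v (-1# ·v v)
  -v-def u v = cong (u +v_) (neg-·v v)

  -v-self : ∀ {n} (u : Vect n) → u -v u ≡ zeroV
  -v-self []      = refl
  -v-self (a ∷ u) = cong₂ _∷_ (+ᶠ-inverseʳ a) (-v-self u)

  +v-cancel : ∀ {n} (u v : Vect n) → (u +v v) -v u ≡ v
  +v-cancel u v = begin
    (u +v v) -v u             ≡⟨ cong (_-v u) (+v-comm u v) ⟩
    (v +v u) -v u             ≡⟨ +v-assoc v u _ ⟩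
    v +v (u -v u)             ≡⟨ cong (v +v_) (-v-self u) ⟩
    v +v zeroV                ≡⟨ +v-identityʳ v ⟩
    v                         ∎
    where open ≡-Reasoning

  -v-restore : ∀ {n} (u v : Vect n) → v +v (u -v v) ≡ u
  -v-restore u v = trans (sym (+v-assoc v u _)) (+v-cancel v u)

  +v-interchange : ∀ {n} (a b c d : Vect n) → (a +v b) +v (c +v d) ≡ (a +v c) +v (b +v d)
  +v-interchange a b c d = begin
    (a +v b) +v (c +v d)   ≡⟨ +v-assoc a b _ ⟩
    a +v (b +v (c +v d))   ≡⟨ cong (a +v_) (sym (+v-assoc b c d)) ⟩
    a +v ((b +v c) +v d)   ≡⟨ cong (λ t → a +v (t +v d)) (+v-comm b c) ⟩
    a +v ((c +v b) +v d)   ≡⟨ cong (a +v_) (+v-assoc c b d) ⟩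
    a +v (c +v (b +v d))   ≡⟨ sym (+v-assoc a c _) ⟩
    (a +v c) +v (b +v d)   ∎
    where open ≡-Reasoning

  -v-zero⇒≡ : ∀ {n} (u v : Vect n) → u -v v ≡ zeroV → u ≡ v
  -v-zero⇒≡ u v eq = trans (sym (-v-restore u v)) (trans (cong (v +v_) eq) (+v-identityʳ v))

  ⁻¹-scale : ∀ {n} c (u : Vect n) → c ≢ 0# → (c ⁻¹) ·v (c ·v u) ≡ u
  ⁻¹-scale c u c≢0 = begin
    (c ⁻¹) ·v (c ·v u)    ≡⟨ sym (·v-assoc (c ⁻¹) c u) ⟩
    ((c ⁻¹) *ᶠ c) ·v u    ≡⟨ cong (_·v u) (trans (*-comm (c ⁻¹) c) (⁻¹-inverse c c≢0)) ⟩
    1# ·v u               ≡⟨ 1·v u ⟩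
    u                     ∎
    where open ≡-Reasoning

  dot-zeroʳ : ∀ {n} (u : Vect n) → dot u zeroV ≡ 0#
  dot-zeroʳ []      = refl
  dot-zeroʳ (a ∷ u) = trans (cong₂ _+ᶠ_ (zeroʳ a) (dot-zeroʳ u)) (+ᶠ-identityˡ 0#)

  dot-comm : ∀ {n} (u v : Vect n) → dot u v ≡ dot v u
  dot-comm []      []      = refl
  dot-comm (a ∷ u) (b ∷ v) = cong₂ _+ᶠ_ (*-comm a b) (dot-comm u v)

  +ᶠ-interchange : ∀ a b c d → (a +ᶠ b) +ᶠ (c +ᶠ d) ≡ (a +ᶠ c) +ᶠ (b +ᶠ d)
  +ᶠ-interchange a b c d = cong Vec.head (+v-interchange (a ∷ []) (b ∷ []) (c ∷ []) (d ∷ []))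

  dot-+ʳ : ∀ {n} (u v w : Vect n) → dot u (v +v w) ≡ dot u v +ᶠ dot u w
  dot-+ʳ []      []      []      = sym (+ᶠ-identityˡ 0#)
  dot-+ʳ (a ∷ u) (b ∷ v) (c ∷ w) =
    trans (cong₂ _+ᶠ_ (distribˡ a b c) (dot-+ʳ u v w)) (+ᶠ-interchange _ _ _ _)

  dot-·ʳ : ∀ {n} (u : Vect n) c v → dot u (c ·v v) ≡ c *ᶠ dot u v
  dot-·ʳ []      c []      = sym (zeroʳ c)
  dot-·ʳ (a ∷ u) c (b ∷ v) =
    trans (cong₂ _+ᶠ_ (swap-scalar) (dot-·ʳ u c v)) (sym (distribˡ c _ _))
    where
    swap-scalar : a *ᶠ (c *ᶠ b) ≡ c *ᶠ (a *ᶠ b)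
    swap-scalar = trans (sym (*ᶠ-assoc a c b)) (trans (cong (_*ᶠ b) (*-comm a c)) (*ᶠ-assoc c a b))

  dot-+ˡ : ∀ {n} (u v w : Vect n) → dot (u +v v) w ≡ dot u w +ᶠ dot v w
  dot-+ˡ u v w = trans (dot-comm (u +v v) w) (trans (dot-+ʳ w u v) (cong₂ _+ᶠ_ (dot-comm w u) (dot-comm w v)))

  dot-·ˡ : ∀ {n} c (u v : Vect n) → dot (c ·v u) v ≡ c *ᶠ dot u v
  dot-·ˡ c u v = trans (dot-comm (c ·v u) v) (trans (dot-·ʳ v c u) (cong (c *ᶠ_) (dot-comm v u)))

  dot-head : ∀ {n} a (u : Vect n) → dot (a ∷ u) (1# ∷ zeroV) ≡ a
  dot-head a u = begin
    (a *ᶠ 1#) +ᶠ dot u zeroV   ≡⟨ cong₂ _+ᶠ_ (trans (*-comm a 1#) (*-identityˡ a)) (dot-zeroʳ u) ⟩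
    a +ᶠ 0#                    ≡⟨ trans (+ᶠ-comm a 0#) (+ᶠ-identityˡ a) ⟩
    a                          ∎
    where open ≡-Reasoning

  dot-tail : ∀ {n} a (u v : Vect n) → dot (a ∷ u) (0# ∷ v) ≡ dot u v
  dot-tail a u v = trans (cong (_+ᶠ dot u v) (zeroʳ a)) (+ᶠ-identityˡ _)

  -- Pairing with the standard basis vectors reads off the coordinates.
  dot-nondegenerate : ∀ {n} (a b : Vect n) → (∀ x → dot a x ≡ dot b x) → a ≡ b
  dot-nondegenerate []      []      h = refl
  dot-nondegenerate (a ∷ u) (b ∷ v) h = cong₂ _∷_
    (trans (sym (dot-head a u)) (trans (h (1# ∷ zeroV)) (dot-head b v)))
    (dot-nondegenerate u v (λ x → trans (sym (dot-tail a u x)) (trans (h (0# ∷ x)) (dot-tail b v x))))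

  ∷-split : ∀ {n} a (u : Vect n) → a ∷ u ≡ (a ·v (1# ∷ zeroV)) +v (0# ∷ u)
  ∷-split a u = cong₂ _∷_
    (sym (trans (+ᶠ-comm _ 0#) (trans (+ᶠ-identityˡ _) (trans (*-comm a 1#) (*-identityˡ a)))))
    (sym (trans (cong (_+v u) (·v-zero a)) (+v-identityˡ u)))

  0∷-+ : ∀ {n} (u v : Vect n) → 0# ∷ (u +v v) ≡ (0# ∷ u) +v (0# ∷ v)
  0∷-+ u v = cong (_∷ (u +v v)) (sym (+ᶠ-identityˡ 0#))

  0∷-· : ∀ {n} c (u : Vect n) → 0# ∷ (c ·v u) ≡ c ·v (0# ∷ u)
  0∷-· c u = cong (_∷ (c ·v u)) (sym (zeroʳ c))

  isZeroV⁺ : ∀ {n} (u : Vect n) → u ≡ zeroV → T (isZeroV u)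
  isZeroV⁺ []      _  = _
  isZeroV⁺ (a ∷ u) eq = ∧⁺ (does⁺ (a Finₚ.≟ 0#) (Vecₚ.∷-injectiveˡ eq)) (isZeroV⁺ u (Vecₚ.∷-injectiveʳ eq))

  isZeroV⁻ : ∀ {n} (u : Vect n) → T (isZeroV u) → u ≡ zeroV
  isZeroV⁻ []      _ = refl
  isZeroV⁻ (a ∷ u) h = let p , r = ∧⁻ {does (a Finₚ.≟ 0#)} h in cong₂ _∷_ (does⁻ (a Finₚ.≟ 0#) p) (isZeroV⁻ u r)

  record Linear {m n} (φ : Vect m → Vect n) : Set where
    field
      +-hom : ∀ x y → φ (x +v y) ≡ φ x +v φ y
      ·-hom : ∀ c x → φ (c ·v x) ≡ c ·v φ x

    0-hom : φ zeroV ≡ zeroV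
    0-hom = trans (cong φ (sym (0·v zeroV))) (trans (·-hom 0# zeroV) (0·v _))

    sub-hom : ∀ x y → φ (x -v y) ≡ φ x -v φ y
    sub-hom x y = begin
      φ (x -v y)               ≡⟨ cong φ (-v-def x y) ⟩
      φ (x +v (-1# ·v y))      ≡⟨ +-hom x _ ⟩
      φ x +v φ (-1# ·v y)      ≡⟨ cong (φ x +v_) (·-hom -1# y) ⟩
      φ x +v (-1# ·v φ y)      ≡⟨ sym (-v-def (φ x) (φ y)) ⟩
      φ x -v φ y               ∎
      where open ≡-Reasoning

    trivialKernel⇒injective : (∀ x → φ x ≡ zeroV → x ≡ zeroV) → ∀ {x y} → φ x ≡ φ y → x ≡ y
    trivialKernel⇒injective k {x} {y} eq =
      -v-zero⇒≡ x y (k _ (trans (sub-hom x y) (trans (cong (_-v φ y) eq) (-v-self (φ y)))))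

  open Linear public

  linear-∘ : ∀ {l m n} {φ : Vect m → Vect n} {ψ : Vect l → Vect m} → Linear φ → Linear ψ → Linear (φ ∘ ψ)
  linear-∘ {φ = φ} Lφ Lψ = record
    { +-hom = λ x y → trans (cong φ (+-hom Lψ x y)) (+-hom Lφ _ _)
    ; ·-hom = λ c x → trans (cong φ (·-hom Lψ c x)) (·-hom Lφ c _)
    }

  linear-0∷ : ∀ {n} → Linear {n} (0# ∷_)
  linear-0∷ = record { +-hom = 0∷-+ ; ·-hom = 0∷-· }

  -- The common form of three constructions: linear combinations, the pivot vector in elimination,
  -- and a vector adjoined to a subspace.
  linear-extend : ∀ {m n} {φ : Vect m → Vect n} (v : Vect n) → Linear φ →
    Linear {suc m} (λ x → (Vec.head x ·v v) +v φ (Vec.tail x))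
  linear-extend {φ = φ} v L = record
    { +-hom = λ { (a ∷ x) (b ∷ y) → trans (cong₂ _+v_ (·v-distribʳ a b v) (+-hom L x y)) (+v-interchange _ _ _ _) }
    ; ·-hom = λ { c (a ∷ x) → trans (cong₂ _+v_ (·v-assoc c a v) (·-hom L c x)) (sym (·v-distribˡ c _ _)) }
    }

  lincomb-linear : ∀ {n k} (w : Vec (Vect n) k) → Linear (λ c → lincomb c w)
  lincomb-linear [] = record
    { +-hom = λ { [] [] → sym (+v-identityˡ zeroV) }
    ; ·-hom = λ { c [] → sym (·v-zero c) }
    }
  lincomb-linear (u ∷ w) = record
    { +-hom = λ { (a ∷ x) (b ∷ y) → +-hom (linear-extend u (lincomb-linear w)) (a ∷ x) (b ∷ y) }
    ; ·-hom = λ { c (a ∷ x) → ·-hom (linear-extend u (lincomb-linear w)) c (a ∷ x) }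
    }

  -- The vectors of `w` are the columns of `φ`. This links `dim`, defined through linearly
  -- independent tuples, to the injective linear maps used in the proof; the last component puts the
  -- columns into any subspace that contains the image.
  linear⇒lincomb : ∀ {n k} {φ : Vect k → Vect n} → Linear φ →
    ∃ λ (w : Vec (Vect n) k) → (∀ c → lincomb c w ≡ φ c) × (∀ {u} → u ∈ Vec.toList w → ∃ λ x → u ≡ φ x)
  linear⇒lincomb {k = zero} L = [] , (λ { [] → sym (0-hom L) }) , λ ()
  linear⇒lincomb {k = suc k} {φ} L with linear⇒lincomb (linear-∘ L linear-0∷)
  ... | w , rep , im = φ (1# ∷ zeroV) ∷ w , rep′ , im′
    where
    rep′ : ∀ c → lincomb c (φ (1# ∷ zeroV) ∷ w) ≡ φ c
    rep′ (a ∷ c) = begin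
      (a ·v φ (1# ∷ zeroV)) +v lincomb c w         ≡⟨ cong₂ _+v_ (sym (·-hom L a _)) (rep c) ⟩
      φ (a ·v (1# ∷ zeroV)) +v φ (0# ∷ c)          ≡⟨ sym (+-hom L _ _) ⟩
      φ ((a ·v (1# ∷ zeroV)) +v (0# ∷ c))          ≡⟨ cong φ (sym (∷-split a c)) ⟩
      φ (a ∷ c)                                    ∎
      where open ≡-Reasoning
    im′ : ∀ {u} → u ∈ φ (1# ∷ zeroV) ∷ Vec.toList w → ∃ λ x → u ≡ φ x
    im′ (here refl) = _ , refl
    im′ (there u∈)  = let x , eq = im u∈ in 0# ∷ x , eq

  -- The coefficients are the values of `g` on the standard basis. Functionals on F^m are thus
  -- indexed by vectors, so that there are q^m of them.
  functional⇒dot : ∀ {m} (g : Vect m → Fin q) → Linear (λ x → g x ∷ []) → ∃ λ a → ∀ x → dot a x ≡ g x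
  functional⇒dot {zero} g L = [] , λ { [] → sym (Vecₚ.∷-injectiveˡ (0-hom L)) }
  functional⇒dot {suc m} g L with functional⇒dot (λ x → g (0# ∷ x)) (linear-∘ L linear-0∷)
  ... | a , rep = g e ∷ a , λ { (b ∷ x) → begin
      (g e *ᶠ b) +ᶠ dot a x                ≡⟨ cong₂ _+ᶠ_ (*-comm (g e) b) (rep x) ⟩
      (b *ᶠ g e) +ᶠ g (0# ∷ x)             ≡⟨ cong (_+ᶠ g (0# ∷ x)) (sym (Vecₚ.∷-injectiveˡ (·-hom L b e))) ⟩
      g (b ·v e) +ᶠ g (0# ∷ x)             ≡⟨ sym (Vecₚ.∷-injectiveˡ (+-hom L _ _)) ⟩
      g ((b ·v e) +v (0# ∷ x))             ≡⟨ cong g (sym (∷-split b x)) ⟩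
      g (b ∷ x)                            ∎ }
    where
    open ≡-Reasoning
    e = 1# ∷ zeroV

  encode : ∀ {k} → Vect k → Fin (q ^ k)
  encode v = Fin.funToFin (Vec.lookup v)

  decode : ∀ {k} → Fin (q ^ k) → Vect k
  decode i = Vec.tabulate (Fin.finToFun i)

  decode-encode : ∀ {k} (v : Vect k) → decode (encode v) ≡ v
  decode-encode v = trans (Vecₚ.tabulate-cong (Finₚ.finToFun-funToFin (Vec.lookup v))) (Vecₚ.tabulate∘lookup v)

  funToFin-cong : ∀ {k} {g h : Fin k → Fin q} → (∀ i → g i ≡ h i) → Fin.funToFin g ≡ Fin.funToFin h
  funToFin-cong {zero}  eq = refl
  funToFin-cong {suc k} eq = cong₂ Fin.combine (eq Fin.zero) (funToFin-cong (eq ∘ Fin.suc))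

  encode-decode : ∀ {k} (i : Fin (q ^ k)) → encode {k} (decode {k} i) ≡ i
  encode-decode {k} i = trans (funToFin-cong (Vecₚ.lookup∘tabulate (Fin.finToFun {q} {k} i))) (Finₚ.funToFin-finToFin {k} {q} i)

  -- Takes the place of the exchange lemma: comparing the cardinalities q^k and q^d bounds the
  -- dimensions.
  vect-pigeonhole : ∀ {k d} (g : Vect k → Vect d) → (∀ {x y} → g x ≡ g y → x ≡ y) → k ≤ d
  vect-pigeonhole {k} {d} g inj = ℕₚ.≮⇒≥ λ d<k → ℕₚ.<⇒≱ (ℕₚ.^-monoʳ-< q 2≤q d<k) (Finₚ.injective⇒≤ {f = h} h-inj)
    where
    h : Fin (q ^ k) → Fin (q ^ d)
    h i = encode {d} (g (decode {k} i))
    h-inj : ∀ {i j} → h i ≡ h j → i ≡ j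
    h-inj {i} {j} eq = trans (sym (encode-decode {k} i)) (trans (cong encode (inj
      (trans (sym (decode-encode _)) (trans (cong (decode {d}) eq) (decode-encode _))))) (encode-decode {k} j))

  allVecs-complete : ∀ {n} (v : Vect n) → v ∈ allVecs n
  allVecs-complete {n} = allVecsOf-complete ∈-allFin n

  allVecs-unique : ∀ n → Unique (allVecs n)
  allVecs-unique = allVecsOf-unique (Uniqueₚ.allFin⁺ q)

  length-allVecs : ∀ n → length (allVecs n) ≡ q ^ n
  length-allVecs n = trans (length-allVecsOf allF n) (cong (_^ n) (Listₚ.length-tabulate id))

  allVSets-complete : ∀ {n} (X : VSet n) → X ∈ allVSets n
  allVSets-complete {zero}  true  = here refl
  allVSets-complete {zero}  false = there (here refl)
  allVSets-complete {suc n} X     = allVecsOf-complete allVSets-complete q X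

  allVSets-unique : ∀ n → Unique (allVSets n)
  allVSets-unique zero    = ((λ ()) ∷ []) ∷ [] ∷ []
  allVSets-unique (suc n) = allVecsOf-unique (allVSets-unique n) q

  member-fromPred : ∀ {n} (P : Vect n → Bool) v → member (fromPred P) v ≡ P v
  member-fromPred P []      = refl
  member-fromPred P (a ∷ v) = trans
    (cong (λ t → member t v) (Vecₚ.lookup∘tabulate (λ b → fromPred (λ w → P (b ∷ w))) a))
    (member-fromPred (λ w → P (a ∷ w)) v)

  VSet-ext : ∀ {n} {X Y : VSet n} → (∀ v → member X v ≡ member Y v) → X ≡ Y
  VSet-ext {zero}          h = h []
  VSet-ext {suc n} {X} {Y} h = trans (sym (Vecₚ.tabulate∘lookup X))
    (trans (Vecₚ.tabulate-cong (λ a → VSet-ext (λ v → h (a ∷ v)))) (Vecₚ.tabulate∘lookup Y))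

  search : ∀ {n} (P : Vect n → Bool) → (∃ λ v → T (P v)) ⊎ (∀ v → ¬ T (P v))
  search {n} P with T? (any P (allVecs n))
  ... | yes h = let v , _ , Pv = any-T⁻ P (allVecs n) h in inj₁ (v , Pv)
  ... | no ¬h = inj₂ λ v Pv → ¬h (any-T⁺ P (allVecs n) (allVecs-complete v) Pv)

-- Subspaces, orthogonal complements, dimension and hyperplanes.

module Subspaces {q : ℕ} (F : FiniteField q) where

  open FiniteField F renaming (_+_ to _+ᶠ_; _*_ to _*ᶠ_; -_ to -ᶠ_)
  open QMatroidTheory F hiding (f; s)
  open Vectors F
  open IsCommutativeRing isCommutativeRing using (*-comm; *-identityˡ; zeroˡ; zeroʳ)
    renaming (+-identityˡ to +ᶠ-identityˡ; +-identityʳ to +ᶠ-identityʳ; -‿inverseˡ to +ᶠ-inverseˡ; -‿inverseʳ to +ᶠ-inverseʳ)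
  open RingProperties (CommutativeRing.ring fieldRing) using (-1*x≈-x; +-inverseˡ-unique)

  infix 4 _∈ˢ_ _⊆_

  -- A record around the Boolean test, so that the vector and the set stay visible to unification
  -- instead of disappearing when `member` computes.
  record _∈ˢ_ {n : ℕ} (v : Vect n) (X : VSet n) : Set where
    constructor mem
    field unmem : T (member X v)
  open _∈ˢ_ public

  _⊆_ : ∀ {n} → VSet n → VSet n → Set
  X ⊆ Y = ∀ {v} → v ∈ˢ X → v ∈ˢ Y

  _∈ˢ?_ : ∀ {n} (v : Vect n) X → Dec (v ∈ˢ X)
  v ∈ˢ? X with T? (member X v)
  ... | yes h = yes (mem h)
  ... | no ¬h = no (¬h ∘ unmem)

  _≟ᵛ_ : ∀ {n} (u v : Vect n) → Dec (u ≡ v)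
  _≟ᵛ_ = Vecₚ.≡-dec Finₚ._≟_

  ∈-fromPred⁺ : ∀ {n} (P : Vect n → Bool) {v} → T (P v) → v ∈ˢ fromPred P
  ∈-fromPred⁺ P {v} h = mem (subst T (sym (member-fromPred P v)) h)

  ∈-fromPred⁻ : ∀ {n} (P : Vect n → Bool) {v} → v ∈ˢ fromPred P → T (P v)
  ∈-fromPred⁻ P {v} (mem h) = subst T (member-fromPred P v) h

  ⊆-antisym : ∀ {n} {X Y : VSet n} → X ⊆ Y → Y ⊆ X → X ≡ Y
  ⊆-antisym h k = VSet-ext λ v → T-ext (unmem ∘ h ∘ mem) (unmem ∘ k ∘ mem)

  ⊆ᵇ⁺ : ∀ {n} (X Y : VSet n) → X ⊆ Y → T (X ⊆ᵇ Y)
  ⊆ᵇ⁺ {n} X Y h = all-T⁺ (λ v → not (member X v) ∨ member Y v) (allVecs n) λ {v} _ → implies⁺ {member X v} (unmem ∘ h ∘ mem)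

  ⊆ᵇ⁻ : ∀ {n} (X Y : VSet n) → T (X ⊆ᵇ Y) → X ⊆ Y
  ⊆ᵇ⁻ {n} X Y h {v} (mem v∈) =
    mem (implies⁻ {member X v} (all-T⁻ (λ v → not (member X v) ∨ member Y v) (allVecs n) h (allVecs-complete v)) v∈)

  _⊆?_ : ∀ {n} (X Y : VSet n) → Dec (X ⊆ Y)
  X ⊆? Y with T? (X ⊆ᵇ Y)
  ... | yes h = yes (⊆ᵇ⁻ X Y h)
  ... | no ¬h = no λ k → ¬h (⊆ᵇ⁺ X Y k)

  ⊈-witness : ∀ {n} {X Y : VSet n} → ¬ (X ⊆ Y) → ∃ λ v → v ∈ˢ X × ¬ (v ∈ˢ Y)
  ⊈-witness {n} {X} {Y} X⊈Y with search (λ v → member X v ∧ not (member Y v))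
  ... | inj₁ (v , p) = let v∈X , v∉Y = ∧⁻ {member X v} p in v , mem v∈X , λ v∈Y → not⁻ v∉Y (unmem v∈Y)
  ... | inj₂ none    = ⊥-elim (X⊈Y λ {v} v∈X → escape v v∈X (v ∈ˢ? Y))
    where
    escape : ∀ v → v ∈ˢ X → Dec (v ∈ˢ Y) → v ∈ˢ Y
    escape v v∈X (yes v∈Y) = v∈Y
    escape v v∈X (no v∉Y)  = ⊥-elim (none v (∧⁺ (unmem v∈X) (not⁺ (v∉Y ∘ mem))))

  ⊂ᵇ⁺ : ∀ {n} (X Y : VSet n) → X ⊆ Y → ¬ (Y ⊆ X) → T (X ⊂ᵇ Y)
  ⊂ᵇ⁺ X Y h k = ∧⁺ {X ⊆ᵇ Y} (⊆ᵇ⁺ X Y h) (not⁺ λ t → k (⊆ᵇ⁻ Y X t))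

  ⊂ᵇ⁻ : ∀ {n} (X Y : VSet n) → T (X ⊂ᵇ Y) → (X ⊆ Y) × ¬ (Y ⊆ X)
  ⊂ᵇ⁻ X Y h = let p , r = ∧⁻ {X ⊆ᵇ Y} {not (Y ⊆ᵇ X)} h in (λ {v} → ⊆ᵇ⁻ X Y p {v}) , λ k → not⁻ {Y ⊆ᵇ X} r (⊆ᵇ⁺ Y X k)

  ≡ˢ⁺ : ∀ {n} (X Y : VSet n) → X ≡ Y → T (X ≡ˢ Y)
  ≡ˢ⁺ X X refl = ∧⁺ {X ⊆ᵇ X} {X ⊆ᵇ X} (⊆ᵇ⁺ X X id) (⊆ᵇ⁺ X X id)

  ≡ˢ⁻ : ∀ {n} (X Y : VSet n) → T (X ≡ˢ Y) → X ≡ Y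
  ≡ˢ⁻ X Y h = let p , r = ∧⁻ {X ⊆ᵇ Y} {Y ⊆ᵇ X} h in ⊆-antisym (⊆ᵇ⁻ X Y p) (⊆ᵇ⁻ Y X r)

  record Sub {n : ℕ} (X : VSet n) : Set where
    field
      zero-closed : zeroV ∈ˢ X
      +-closed    : ∀ {u v} → u ∈ˢ X → v ∈ˢ X → u +v v ∈ˢ X
      ·-closed    : ∀ c {u} → u ∈ˢ X → c ·v u ∈ˢ X

    -closed : ∀ {u v} → u ∈ˢ X → v ∈ˢ X → u -v v ∈ˢ X
    -closed {u} {v} u∈ v∈ = subst (_∈ˢ X) (sym (-v-def u v)) (+-closed u∈ (·-closed -1# v∈))

  open Sub public

  isSubspace⁺ : ∀ {n} {X : VSet n} → Sub X → T (isSubspace X)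
  isSubspace⁺ {n} {X} S = ∧⁺ (unmem (zero-closed S)) (∧⁺
    (all-T⁺ (λ u → all (sum? u) (allVecs n)) (allVecs n) λ {u} _ → all-T⁺ (sum? u) (allVecs n) λ {v} _ →
      implies⁺ {member X u ∧ member X v} λ h → let p , r = ∧⁻ {member X u} h in unmem (+-closed S (mem p) (mem r)))
    (all-T⁺ (λ c → all (scaled? c) (allVecs n)) allF λ {c} _ → all-T⁺ (scaled? c) (allVecs n) λ {u} _ →
      implies⁺ {member X u} λ h → unmem (·-closed S c (mem h))))
    where
    sum? : Vect n → Vect n → Bool
    sum? u v = not (member X u ∧ member X v) ∨ member X (u +v v)
    scaled? : Fin q → Vect n → Bool
    scaled? c u = not (member X u) ∨ member X (c ·v u)

  isSubspace⁻ : ∀ {n} (X : VSet n) → T (isSubspace X) → Sub X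
  isSubspace⁻ {n} X h = record
    { zero-closed = mem (proj₁ h₀)
    ; +-closed = λ {u} {v} u∈ v∈ → mem (implies⁻ {member X u ∧ member X v}
        (all-T⁻ (sum? u) (allVecs n) (all-T⁻ (λ u → all (sum? u) (allVecs n)) (allVecs n) (proj₁ h₁) (allVecs-complete u)) (allVecs-complete v))
        (∧⁺ (unmem u∈) (unmem v∈)))
    ; ·-closed = λ c {u} u∈ → mem (implies⁻ {member X u}
        (all-T⁻ (scaled? c) (allVecs n) (all-T⁻ (λ c → all (scaled? c) (allVecs n)) allF (proj₂ h₁) (∈-allFin c)) (allVecs-complete u))
        (unmem u∈))
    }
    where
    sum? : Vect n → Vect n → Bool
    sum? u v = not (member X u ∧ member X v) ∨ member X (u +v v)
    scaled? : Fin q → Vect n → Bool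
    scaled? c u = not (member X u) ∨ member X (c ·v u)
    h₀ = ∧⁻ {member X zeroV} h
    h₁ = ∧⁻ {all (λ u → all (sum? u) (allVecs n)) (allVecs n)} (proj₂ h₀)

  ∈-subspaces⁺ : ∀ {n} {X : VSet n} → Sub X → X ∈ allSubspaces n
  ∈-subspaces⁺ {X = X} S = filterᵇ⁺ isSubspace (allVSets _) (allVSets-complete X) (isSubspace⁺ S)

  ∈-subspaces⁻ : ∀ {n} {X : VSet n} → X ∈ allSubspaces n → Sub X
  ∈-subspaces⁻ {n} {X} X∈ = isSubspace⁻ X (proj₂ (filterᵇ⁻ isSubspace (allVSets n) X∈))

  subspaces-unique : ∀ n → Unique (allSubspaces n)
  subspaces-unique n = filterᵇ-unique isSubspace (allVSets n) (allVSets-unique n)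

  ∈-zeroSub⁺ : ∀ {n} {v : Vect n} → v ≡ zeroV → v ∈ˢ zeroSub
  ∈-zeroSub⁺ {v = v} eq = ∈-fromPred⁺ isZeroV (isZeroV⁺ v eq)

  ∈-zeroSub⁻ : ∀ {n} {v : Vect n} → v ∈ˢ zeroSub → v ≡ zeroV
  ∈-zeroSub⁻ {v = v} v∈ = isZeroV⁻ v (∈-fromPred⁻ isZeroV v∈)

  zeroSub-sub : ∀ {n} → Sub (zeroSub {n})
  zeroSub-sub = record
    { zero-closed = ∈-zeroSub⁺ refl
    ; +-closed = λ u∈ v∈ → ∈-zeroSub⁺ (trans (cong₂ _+v_ (∈-zeroSub⁻ u∈) (∈-zeroSub⁻ v∈)) (+v-identityˡ zeroV))
    ; ·-closed = λ c u∈ → ∈-zeroSub⁺ (trans (cong (c ·v_) (∈-zeroSub⁻ u∈)) (·v-zero c))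
    }

  zeroSub-⊆ : ∀ {n} {X : VSet n} → Sub X → zeroSub ⊆ X
  zeroSub-⊆ {X = X} S v∈ = subst (_∈ˢ X) (sym (∈-zeroSub⁻ v∈)) (zero-closed S)

  ∈-full : ∀ {n} (v : Vect n) → v ∈ˢ fullSpace
  ∈-full v = ∈-fromPred⁺ (λ _ → true) _

  full-sub : ∀ {n} → Sub (fullSpace {n})
  full-sub = record { zero-closed = ∈-full _ ; +-closed = λ _ _ → ∈-full _ ; ·-closed = λ _ _ → ∈-full _ }

  module _ {n : ℕ} {X Y : VSet n} where

    ∈-⊕⁺ : ∀ {u v} → u ∈ˢ X → v ∈ˢ Y → u +v v ∈ˢ X ⊕ Y
    ∈-⊕⁺ {u} {v} u∈ v∈ = ∈-fromPred⁺ (λ w → any (λ x → member X x ∧ member Y (w -v x)) (allVecs n))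
      (any-T⁺ (λ x → member X x ∧ member Y ((u +v v) -v x)) (allVecs n) (allVecs-complete u)
        (∧⁺ (unmem u∈) (subst (λ w → T (member Y w)) (sym (+v-cancel u v)) (unmem v∈))))

    ∈-⊕⁻ : ∀ {w} → w ∈ˢ X ⊕ Y → ∃ λ u → ∃ λ v → u ∈ˢ X × v ∈ˢ Y × w ≡ u +v v
    ∈-⊕⁻ {w} w∈ =
      let u , _ , h = any-T⁻ (λ x → member X x ∧ member Y (w -v x)) (allVecs n)
                        (∈-fromPred⁻ (λ w → any (λ x → member X x ∧ member Y (w -v x)) (allVecs n)) w∈)
          p , r = ∧⁻ {member X u} h
      in u , w -v u , mem p , mem r , sym (-v-restore w u)

    ⊕-sub : Sub X → Sub Y → Sub (X ⊕ Y)
    ⊕-sub SX SY = record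
      { zero-closed = subst (_∈ˢ X ⊕ Y) (+v-identityˡ zeroV) (∈-⊕⁺ (zero-closed SX) (zero-closed SY))
      ; +-closed = λ h k → add (∈-⊕⁻ h) (∈-⊕⁻ k)
      ; ·-closed = λ c h → scale c (∈-⊕⁻ h)
      }
      where
      Split : Vect n → Set
      Split w = ∃ λ u → ∃ λ v → u ∈ˢ X × v ∈ˢ Y × w ≡ u +v v
      add : ∀ {w z} → Split w → Split z → w +v z ∈ˢ X ⊕ Y
      add (u , v , u∈ , v∈ , refl) (u′ , v′ , u′∈ , v′∈ , refl) =
        subst (_∈ˢ X ⊕ Y) (+v-interchange u u′ v v′) (∈-⊕⁺ (+-closed SX u∈ u′∈) (+-closed SY v∈ v′∈))
      scale : ∀ c {w} → Split w → c ·v w ∈ˢ X ⊕ Y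
      scale c (u , v , u∈ , v∈ , refl) =
        subst (_∈ˢ X ⊕ Y) (sym (·v-distribˡ c u v)) (∈-⊕⁺ (·-closed SX c u∈) (·-closed SY c v∈))

    ⊆-⊕ˡ : Sub Y → X ⊆ X ⊕ Y
    ⊆-⊕ˡ SY {v} v∈ = subst (_∈ˢ X ⊕ Y) (+v-identityʳ v) (∈-⊕⁺ v∈ (zero-closed SY))

    ⊆-⊕ʳ : Sub X → Y ⊆ X ⊕ Y
    ⊆-⊕ʳ SX {v} v∈ = subst (_∈ˢ X ⊕ Y) (+v-identityˡ v) (∈-⊕⁺ (zero-closed SX) v∈)

    ⊕-least : ∀ {Z} → Sub Z → X ⊆ Z → Y ⊆ Z → X ⊕ Y ⊆ Z
    ⊕-least {Z} SZ h k w∈ with ∈-⊕⁻ w∈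
    ... | u , v , u∈ , v∈ , refl = +-closed SZ (h u∈) (k v∈)

    ∈-∩⁺ : ∀ {v} → v ∈ˢ X → v ∈ˢ Y → v ∈ˢ X ∩ˢ Y
    ∈-∩⁺ h k = ∈-fromPred⁺ (λ v → member X v ∧ member Y v) (∧⁺ (unmem h) (unmem k))

    ∩-⊆ˡ : X ∩ˢ Y ⊆ X
    ∩-⊆ˡ {v} h = mem (proj₁ (∧⁻ {member X v} (∈-fromPred⁻ (λ v → member X v ∧ member Y v) h)))

    ∩-⊆ʳ : X ∩ˢ Y ⊆ Y
    ∩-⊆ʳ {v} h = mem (proj₂ (∧⁻ {member X v} (∈-fromPred⁻ (λ v → member X v ∧ member Y v) h)))

  ∩-sub : ∀ {n} {X Y : VSet n} → Sub X → Sub Y → Sub (X ∩ˢ Y)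
  ∩-sub SX SY = record
    { zero-closed = ∈-∩⁺ (zero-closed SX) (zero-closed SY)
    ; +-closed = λ u∈ v∈ → ∈-∩⁺ (+-closed SX (∩-⊆ˡ u∈) (∩-⊆ˡ v∈)) (+-closed SY (∩-⊆ʳ u∈) (∩-⊆ʳ v∈))
    ; ·-closed = λ c u∈ → ∈-∩⁺ (·-closed SX c (∩-⊆ˡ u∈)) (·-closed SY c (∩-⊆ʳ u∈))
    }

  module _ {n : ℕ} {X : VSet n} where

    private
      orth : Vect n → Vect n → Bool
      orth v u = not (member X u) ∨ does (dot u v Finₚ.≟ 0#)

    ∈-perp⁺ : ∀ {v} → (∀ {u} → u ∈ˢ X → dot u v ≡ 0#) → v ∈ˢ perp X
    ∈-perp⁺ {v} h = ∈-fromPred⁺ (λ v → all (orth v) (allVecs n)) (all-T⁺ (orth v) (allVecs n) λ {u} _ →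
      implies⁺ {member X u} λ u∈ → does⁺ (dot u v Finₚ.≟ 0#) (h (mem u∈)))

    ∈-perp⁻ : ∀ {v} → v ∈ˢ perp X → ∀ {u} → u ∈ˢ X → dot u v ≡ 0#
    ∈-perp⁻ {v} v∈ {u} u∈ = does⁻ (dot u v Finₚ.≟ 0#) (implies⁻ {member X u}
      (all-T⁻ (orth v) (allVecs n) (∈-fromPred⁻ (λ v → all (orth v) (allVecs n)) v∈) (allVecs-complete u)) (unmem u∈))

    perp-sub : Sub (perp X)
    perp-sub = record
      { zero-closed = ∈-perp⁺ λ {u} _ → dot-zeroʳ u
      ; +-closed = λ {v} {w} v∈ w∈ → ∈-perp⁺ λ {u} u∈ →
          trans (dot-+ʳ u v w) (trans (cong₂ _+ᶠ_ (∈-perp⁻ v∈ u∈) (∈-perp⁻ w∈ u∈)) (+ᶠ-identityˡ 0#))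
      ; ·-closed = λ c {v} v∈ → ∈-perp⁺ λ {u} u∈ →
          trans (dot-·ʳ u c v) (trans (cong (c *ᶠ_) (∈-perp⁻ v∈ u∈)) (zeroʳ c))
      }

  perp-antitone : ∀ {n} {X Y : VSet n} → X ⊆ Y → perp Y ⊆ perp X
  perp-antitone h v∈ = ∈-perp⁺ λ u∈ → ∈-perp⁻ v∈ (h u∈)

  ⊆-perp-perp : ∀ {n} {X : VSet n} → X ⊆ perp (perp X)
  ⊆-perp-perp {v = v} v∈ = ∈-perp⁺ λ {u} u∈ → trans (dot-comm u v) (∈-perp⁻ u∈ v∈)

  line : ∀ {n} → Vect n → VSet n
  line v = fromPred (λ u → any (λ c → does (u ≟ᵛ (c ·v v))) allF)

  ∈-line⁺ : ∀ {n} {v : Vect n} c → c ·v v ∈ˢ line v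
  ∈-line⁺ {v = v} c = ∈-fromPred⁺ (λ u → any (λ c → does (u ≟ᵛ (c ·v v))) allF)
    (any-T⁺ (λ d → does ((c ·v v) ≟ᵛ (d ·v v))) allF (∈-allFin c) (does⁺ ((c ·v v) ≟ᵛ (c ·v v)) refl))

  ∈-line⁻ : ∀ {n} {v u : Vect n} → u ∈ˢ line v → ∃ λ c → u ≡ c ·v v
  ∈-line⁻ {v = v} {u} u∈ =
    let c , _ , h = any-T⁻ (λ c → does (u ≟ᵛ (c ·v v))) allF (∈-fromPred⁻ (λ u → any (λ c → does (u ≟ᵛ (c ·v v))) allF) u∈)
    in c , does⁻ (u ≟ᵛ (c ·v v)) h

  line-sub : ∀ {n} (v : Vect n) → Sub (line v)
  line-sub v = record
    { zero-closed = subst (_∈ˢ line v) (0·v v) (∈-line⁺ 0#)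
    ; +-closed = λ h k → add (∈-line⁻ h) (∈-line⁻ k)
    ; ·-closed = λ c h → scale c (∈-line⁻ h)
    }
    where
    add : ∀ {u w} → (∃ λ c → u ≡ c ·v v) → (∃ λ c → w ≡ c ·v v) → u +v w ∈ˢ line v
    add (c , refl) (d , refl) = subst (_∈ˢ line v) (·v-distribʳ c d v) (∈-line⁺ (c +ᶠ d))
    scale : ∀ c {u} → (∃ λ d → u ≡ d ·v v) → c ·v u ∈ˢ line v
    scale c (d , refl) = subst (_∈ˢ line v) (·v-assoc c d v) (∈-line⁺ (c *ᶠ d))

  line-⊆ : ∀ {n} {v : Vect n} {X} → Sub X → v ∈ˢ X → line v ⊆ X
  line-⊆ S v∈ u∈ with ∈-line⁻ u∈
  ... | c , refl = ·-closed S c v∈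

  -- A basis of `X`, packaged as a linear bijection from F^d onto `X`. Dimensions are computed by
  -- exhibiting one.
  record Param {n : ℕ} (X : VSet n) (d : ℕ) : Set where
    field
      φ         : Vect d → Vect n
      linear    : Linear φ
      injective : ∀ {x y} → φ x ≡ φ y → x ≡ y
      into      : ∀ x → φ x ∈ˢ X
      coord     : ∀ {v} → v ∈ˢ X → ∃ λ x → φ x ≡ v

  open Param public

  param-≤ : ∀ {n} {X Y : VSet n} {d e} → X ⊆ Y → Param X d → Param Y e → d ≤ e
  param-≤ X⊆Y P Q = vect-pigeonhole (λ x → proj₁ (c x)) λ {x} {y} eq →
    injective P (trans (sym (proj₂ (c x))) (trans (cong (φ Q) eq) (proj₂ (c y))))
    where
    c : ∀ x → ∃ λ y → φ Q y ≡ φ P x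
    c x = coord Q (X⊆Y (into P x))

  fullSpace-param : ∀ {n} → Param (fullSpace {n}) n
  fullSpace-param = record
    { φ = id
    ; linear = record { +-hom = λ _ _ → refl ; ·-hom = λ _ _ → refl }
    ; injective = id
    ; into = ∈-full
    ; coord = λ {v} _ → v , refl
    }

  hasIndep⁺ : ∀ {n} {X : VSet n} {k} {ψ : Vect k → Vect n} → Linear ψ → (∀ {x y} → ψ x ≡ ψ y → x ≡ y) →
    (∀ x → ψ x ∈ˢ X) → T (hasIndep X k)
  hasIndep⁺ {n} {X} {k} {ψ} L inj into with linear⇒lincomb L
  ... | w , rep , im = any-T⁺ (λ w → all (member X) (Vec.toList w) ∧ linIndep w) (allVecsOf (allVecs n) k)
    (allVecsOf-complete allVecs-complete k w) (∧⁺ members independent)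
    where
    members : T (all (member X) (Vec.toList w))
    members = all-T⁺ (member X) (Vec.toList w) λ u∈ → let x , eq = im u∈ in subst (T ∘ member X) (sym eq) (unmem (into x))
    independent : T (linIndep w)
    independent = all-T⁺ (λ c → not (isZeroV (lincomb c w)) ∨ isZeroV c) (allVecsOf allF k) λ {c} _ →
      implies⁺ {isZeroV (lincomb c w)} λ h →
        isZeroV⁺ c (inj (trans (sym (rep c)) (trans (isZeroV⁻ (lincomb c w) h) (sym (0-hom L)))))

  hasIndep⁻ : ∀ {n} {X : VSet n} {k} → Sub X → T (hasIndep X k) →
    ∃ λ (ψ : Vect k → Vect n) → (∀ {x y} → ψ x ≡ ψ y → x ≡ y) × (∀ x → ψ x ∈ˢ X)
  hasIndep⁻ {n} {X} {k} S h with any-T⁻ (λ w → all (member X) (Vec.toList w) ∧ linIndep w) (allVecsOf (allVecs n) k) h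
  ... | w , _ , p = (λ c → lincomb c w)
    , trivialKernel⇒injective (lincomb-linear w) kernel
    , lincomb-∈ w (proj₁ (∧⁻ {all (member X) (Vec.toList w)} p))
    where
    kernel : ∀ c → lincomb c w ≡ zeroV → c ≡ zeroV
    kernel c eq = isZeroV⁻ c (implies⁻ {isZeroV (lincomb c w)}
      (all-T⁻ (λ c → not (isZeroV (lincomb c w)) ∨ isZeroV c) (allVecsOf allF k) (proj₂ (∧⁻ {all (member X) (Vec.toList w)} p))
        (allVecsOf-complete ∈-allFin k c))
      (isZeroV⁺ (lincomb c w) eq))
    lincomb-∈ : ∀ {k} (w : Vec (Vect n) k) → T (all (member X) (Vec.toList w)) → ∀ c → lincomb c w ∈ˢ X
    lincomb-∈ []      _ []      = zero-closed S
    lincomb-∈ (u ∷ w) h (a ∷ c) = let u∈ , w∈ = ∧⁻ {member X u} h in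
      +-closed S (·-closed S a (mem u∈)) (lincomb-∈ w w∈ c)

  -- The search descends from `m` and stops at the first success: it passes over everything above
  -- `d` and, since `d ≤ m`, does meet `d`.
  dimUpTo-max : ∀ {n} (X : VSet n) d m → d ≤ m → T (hasIndep X d) → (∀ k → d < k → ¬ T (hasIndep X k)) →
    dimUpTo X m ≡ d
  dimUpTo-max X d zero    z≤n _ _ = refl
  dimUpTo-max X d (suc m) d≤1+m h max with hasIndep X (suc m) in eq
  ... | true  = ℕₚ.≤-antisym (ℕₚ.≮⇒≥ λ d<1+m → max (suc m) d<1+m (subst T (sym eq) _)) d≤1+m
  ... | false = dimUpTo-max X d m (ℕₚ.≤-pred (ℕₚ.≤∧≢⇒< d≤1+m λ { refl → subst T eq h })) h max

  module _ {n : ℕ} {X : VSet n} where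

    -- The basis itself is an independent `d`-tuple. Conversely an independent `k`-tuple in `X`,
    -- read in the coordinates of `P`, injects F^k into F^d.
    param-dim : ∀ {d} → Sub X → Param X d → dim X ≡ d
    param-dim {d} S P = dimUpTo-max X d n (vect-pigeonhole (φ P) (injective P))
      (hasIndep⁺ (linear P) (injective P) (into P))
      λ k d<k h → let ψ , inj , ψ∈ = hasIndep⁻ S h
                      c = λ x → coord P (ψ∈ x)
                  in ℕₚ.<⇒≱ d<k (vect-pigeonhole (λ x → proj₁ (c x)) λ {x} {y} eq →
                       inj (trans (sym (proj₂ (c x))) (trans (cong (φ P) eq) (proj₂ (c y)))))

  -- Both bases are built in one recursion on `n`, so the dimension formula for `X` and `perp X` is
  -- maintained as an invariant.
  record PerpParams {n : ℕ} (X : VSet n) : Set where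
    field
      {d e}    : ℕ
      d+e≡n    : d ℕ.+ e ≡ n
      params   : Param X d
      params⊥  : Param (perp X) e

  -- Gaussian elimination on the first coordinate: X is either 0 × X₀, with perp X = F × perp X₀, or
  -- it is spanned by 0 × X₀ and a vector u with first entry 1, and then perp X is a graph over perp X₀.
  module Elimination {n : ℕ} {X : VSet (suc n)} (S : Sub X) where

    X₀ : VSet n
    X₀ = fromPred (λ v → member X (0# ∷ v))
    X₀⁺ : ∀ {v} → 0# ∷ v ∈ˢ X → v ∈ˢ X₀
    X₀⁺ v∈ = ∈-fromPred⁺ (λ v → member X (0# ∷ v)) (unmem v∈)
    X₀⁻ : ∀ {v} → v ∈ˢ X₀ → 0# ∷ v ∈ˢ X
    X₀⁻ v∈ = mem (∈-fromPred⁻ (λ v → member X (0# ∷ v)) v∈)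
    S₀ : Sub X₀
    S₀ = record
      { zero-closed = X₀⁺ (zero-closed S)
      ; +-closed = λ {u} {v} u∈ v∈ → X₀⁺ (subst (_∈ˢ X) (sym (0∷-+ u v)) (+-closed S (X₀⁻ u∈) (X₀⁻ v∈)))
      ; ·-closed = λ c {u} u∈ → X₀⁺ (subst (_∈ˢ X) (sym (0∷-· c u)) (·-closed S c (X₀⁻ u∈)))
      }

  module EliminationStep {n : ℕ} {X : VSet (suc n)} (S : Sub X) (ih : PerpParams (Elimination.X₀ S)) where

    open Elimination S
    open PerpParams ih
    φ₀ = φ params
    ψ₀ = φ params⊥
    tail⊥ : ∀ {b w} → b ∷ w ∈ˢ perp X → w ∈ˢ perp X₀
    tail⊥ {b} {w} h = ∈-perp⁺ λ {z} z∈ → trans (sym (trans (cong (_+ᶠ dot z w) (zeroˡ b)) (+ᶠ-identityˡ _))) (∈-perp⁻ h (X₀⁻ z∈))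
    dot-0∷ : ∀ {k} (z : Vect k) b w → dot (0# ∷ z) (b ∷ w) ≡ dot z w
    dot-0∷ z b w = trans (cong (_+ᶠ dot z w) (zeroˡ b)) (+ᶠ-identityˡ _)
    pivot? : Vect (suc n) → Bool
    pivot? (a ∷ v) = member X (a ∷ v) ∧ not (does (a Finₚ.≟ 0#))

    module Pivot (v′ : Vect n) (u∈X : 1# ∷ v′ ∈ˢ X) where
      u = 1# ∷ v′
      φ₁ : Vect (suc d) → Vect (suc n)
      φ₁ x = (Vec.head x ·v u) +v (0# ∷ φ₀ (Vec.tail x))
      L₁ : Linear φ₁
      L₁ = linear-extend u (linear-∘ linear-0∷ (linear params))
      head-φ₁ : ∀ a x → Vec.head (φ₁ (a ∷ x)) ≡ a
      head-φ₁ a x = trans (+ᶠ-identityʳ _) (trans (*-comm a 1#) (*-identityˡ a))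
      kernel₁ : ∀ x → φ₁ x ≡ zeroV → x ≡ zeroV
      kernel₁ (a ∷ x) eq with trans (sym (head-φ₁ a x)) (cong Vec.head eq)
      ... | refl = cong (0# ∷_) (injective params (trans φ₀x≡0 (sym (0-hom (linear params)))))
        where
        φ₀x≡0 : φ₀ x ≡ zeroV
        φ₀x≡0 = Vecₚ.∷-injectiveʳ (trans (sym (+v-identityˡ (0# ∷ φ₀ x)))
          (trans (cong (_+v (0# ∷ φ₀ x)) (sym (0·v u))) eq))
      coord₁ : ∀ {v} → v ∈ˢ X → ∃ λ x → φ₁ x ≡ v
      coord₁ {a ∷ v} v∈ = a ∷ proj₁ c , trans (cong (λ t → (a ·v u) +v (0# ∷ t)) (proj₂ c))
        (trans (cong ((a ·v u) +v_) (sym y≡)) (-v-restore (a ∷ v) (a ·v u)))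
        where
        -- Subtracting `a` times the pivot vector clears the first entry, which leaves a vector
        -- coming from `X₀`.
        y = (a ∷ v) -v (a ·v u)
        y≡ : y ≡ 0# ∷ Vec.tail y
        y≡ = cong (_∷ Vec.tail y) (trans (cong (λ t → a +ᶠ (-ᶠ t)) (trans (*-comm a 1#) (*-identityˡ a))) (+ᶠ-inverseʳ a))
        c = coord params (X₀⁺ (subst (_∈ˢ X) y≡ (-closed S v∈ (·-closed S a u∈X))))
      P₁ : Param X (suc d)
      P₁ = record
        { φ = φ₁
        ; linear = L₁
        ; injective = trivialKernel⇒injective L₁ kernel₁
        ; into = λ { (a ∷ x) → +-closed S (·-closed S a u∈X) (X₀⁻ (into params x)) }
        ; coord = coord₁
        }
      -- Orthogonality of b ∷ w to the pivot vector 1 ∷ v′ says b + ⟨v′, w⟩ = 0, so `w` determines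
      -- the first entry.
      h : Vect n → Fin q
      h w = dot (-1# ·v v′) w
      h-def : ∀ w → h w ≡ -ᶠ dot v′ w
      h-def w = trans (dot-·ˡ -1# v′ w) (-1*x≈-x _)
      ψ₁ : Vect e → Vect (suc n)
      ψ₁ x = h (ψ₀ x) ∷ ψ₀ x
      u⊥ : ∀ x → dot u (ψ₁ x) ≡ 0#
      u⊥ x = trans (cong (_+ᶠ dot v′ (ψ₀ x)) (trans (*-identityˡ _) (h-def (ψ₀ x)))) (+ᶠ-inverseˡ _)
      P⊥ : Param (perp X) e
      P⊥ = record
        { φ = ψ₁
        ; linear = record
          { +-hom = λ x y → cong₂ _∷_ (trans (cong h (+-hom (linear params⊥) x y)) (dot-+ʳ (-1# ·v v′) _ _)) (+-hom (linear params⊥) x y)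
          ; ·-hom = λ c x → cong₂ _∷_ (trans (cong h (·-hom (linear params⊥) c x)) (dot-·ʳ (-1# ·v v′) c _)) (·-hom (linear params⊥) c x)
          }
        ; injective = λ eq → injective params⊥ (Vecₚ.∷-injectiveʳ eq)
        ; into = λ x → ∈-perp⁺ (orthogonal x)
        ; coord = coord⊥
        }
        where
        orthogonal : ∀ x {w} → w ∈ˢ X → dot w (ψ₁ x) ≡ 0#
        orthogonal x w∈ with coord₁ w∈
        ... | a ∷ y , refl = begin
          dot ((a ·v u) +v (0# ∷ φ₀ y)) (ψ₁ x)              ≡⟨ dot-+ˡ (a ·v u) (0# ∷ φ₀ y) (ψ₁ x) ⟩
          dot (a ·v u) (ψ₁ x) +ᶠ dot (0# ∷ φ₀ y) (ψ₁ x)     ≡⟨ cong₂ _+ᶠ_ (trans (dot-·ˡ a u (ψ₁ x)) (trans (cong (a *ᶠ_) (u⊥ x)) (zeroʳ a)))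
                                                                (trans (dot-0∷ (φ₀ y) _ (ψ₀ x)) (∈-perp⁻ (into params⊥ x) (into params y))) ⟩
          0# +ᶠ 0#                                          ≡⟨ +ᶠ-identityˡ 0# ⟩
          0#                                                ∎
          where open ≡-Reasoning
        coord⊥ : ∀ {v} → v ∈ˢ perp X → ∃ λ x → ψ₁ x ≡ v
        coord⊥ {b ∷ w} v∈ with coord params⊥ (tail⊥ v∈)
        ... | x , refl = x , cong (_∷ ψ₀ x) (trans (h-def (ψ₀ x))
          (sym (+-inverseˡ-unique b _ (trans (cong (_+ᶠ dot v′ (ψ₀ x)) (sym (*-identityˡ b))) (∈-perp⁻ v∈ u∈X)))))

    cases : (∃ λ v → T (pivot? v)) ⊎ (∀ v → ¬ T (pivot? v)) → PerpParams X
    cases (inj₁ (a ∷ v , p)) = record { d+e≡n = cong suc d+e≡n ; params = Pivot.P₁ _ u∈X ; params⊥ = Pivot.P⊥ _ u∈X }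
      where
      a≢0 : a ≢ 0#
      a≢0 a≡0 = not⁻ (proj₂ (∧⁻ {member X (a ∷ v)} p)) (does⁺ (a Finₚ.≟ 0#) a≡0)
      u∈X : 1# ∷ ((a ⁻¹) ·v v) ∈ˢ X
      u∈X = subst (λ t → t ∷ ((a ⁻¹) ·v v) ∈ˢ X) (trans (*-comm (a ⁻¹) a) (⁻¹-inverse a a≢0))
        (·-closed S (a ⁻¹) (mem (proj₁ (∧⁻ {member X (a ∷ v)} p))))
    cases (inj₂ none) = record
      { d+e≡n = trans (ℕₚ.+-suc d e) (cong suc d+e≡n)
      ; params = record
        { φ = (0# ∷_) ∘ φ₀
        ; linear = linear-∘ linear-0∷ (linear params)
        ; injective = λ eq → injective params (Vecₚ.∷-injectiveʳ eq)
        ; into = λ x → X₀⁻ (into params x)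
        ; coord = coord₀
        }
      ; params⊥ = record
        { φ = ψ₂
        ; linear = record
          { +-hom = λ { (a ∷ x) (b ∷ y) → cong ((a +ᶠ b) ∷_) (+-hom (linear params⊥) x y) }
          ; ·-hom = λ { c (a ∷ x) → cong ((c *ᶠ a) ∷_) (·-hom (linear params⊥) c x) }
          }
        ; injective = λ { {a ∷ x} {b ∷ y} eq → cong₂ _∷_ (Vecₚ.∷-injectiveˡ eq) (injective params⊥ (Vecₚ.∷-injectiveʳ eq)) }
        ; into = λ { (b ∷ x) → ∈-perp⁺ (orthogonal b x) }
        ; coord = λ { {b ∷ w} v∈ → let x , eq = coord params⊥ (tail⊥ v∈) in b ∷ x , cong (b ∷_) eq }
        }
      }
      where
      head≡0 : ∀ {a v} → a ∷ v ∈ˢ X → a ≡ 0#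
      head≡0 {a} {v} v∈ with a Finₚ.≟ 0#
      ... | yes a≡0 = a≡0
      ... | no a≢0  = ⊥-elim (none (a ∷ v) (∧⁺ (unmem v∈) (not⁺ λ t → a≢0 (does⁻ (a Finₚ.≟ 0#) t))))
      coord₀ : ∀ {v} → v ∈ˢ X → ∃ λ x → 0# ∷ φ₀ x ≡ v
      coord₀ {a ∷ v} v∈ with head≡0 v∈
      ... | refl = let x , eq = coord params (X₀⁺ v∈) in x , cong (0# ∷_) eq
      -- All vectors of `X` start with 0 in this case, so the first entry of an orthogonal vector is
      -- free.
      ψ₂ : Vect (suc e) → Vect (suc n)
      ψ₂ x = Vec.head x ∷ ψ₀ (Vec.tail x)
      orthogonal : ∀ b x {w} → w ∈ˢ X → dot w (b ∷ ψ₀ x) ≡ 0#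
      orthogonal b x {a ∷ w} w∈ with head≡0 w∈
      ... | refl = trans (dot-0∷ w b (ψ₀ x)) (∈-perp⁻ (into params⊥ x) (X₀⁺ w∈))
    result : PerpParams X
    result = cases (search pivot?)

  perpParams : ∀ {n} {X : VSet n} → Sub X → PerpParams X
  perpParams {zero} {X} S = record { d+e≡n = refl ; params = trivial S ; params⊥ = trivial perp-sub }
    where
    trivial : ∀ {Y : VSet 0} → Sub Y → Param Y 0
    trivial SY = record
      { φ = id
      ; linear = record { +-hom = λ _ _ → refl ; ·-hom = λ _ _ → refl }
      ; injective = id
      ; into = λ { [] → zero-closed SY }
      ; coord = λ { {[]} _ → [] , refl }
      }
  perpParams {suc n} S = EliminationStep.result S (perpParams (Elimination.S₀ S))

  param-adjoin : ∀ {n d} {X : VSet n} → Sub X → Param X d → ∀ {v} → ¬ (v ∈ˢ X) → Param (X ⊕ line v) (suc d)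
  param-adjoin {n} {d} {X} S P {v} v∉X = record
    { φ = φ₁
    ; linear = L₁
    ; injective = trivialKernel⇒injective L₁ kernel
    ; into = λ { (a ∷ x) → subst (_∈ˢ X ⊕ line v) (+v-comm (φ₀ x) (a ·v v)) (∈-⊕⁺ (into P x) (∈-line⁺ a)) }
    ; coord = coord₁
    }
    where
    φ₀ = φ P
    φ₁ : Vect (suc d) → Vect n
    φ₁ x = (Vec.head x ·v v) +v φ₀ (Vec.tail x)
    L₁ : Linear φ₁
    L₁ = linear-extend v (linear P)
    coord₁ : ∀ {w} → w ∈ˢ X ⊕ line v → ∃ λ x → φ₁ x ≡ w
    coord₁ w∈ with ∈-⊕⁻ w∈
    ... | u , l , u∈ , l∈ , refl with ∈-line⁻ l∈ | coord P u∈
    ...   | c , refl | x , refl = c ∷ x , +v-comm (c ·v v) (φ₀ x)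
    kernel : ∀ x → φ₁ x ≡ zeroV → x ≡ zeroV
    kernel (a ∷ x) eq with a Finₚ.≟ 0#
    ... | yes refl = cong (0# ∷_) (injective P (trans
      (trans (sym (+v-identityˡ (φ₀ x))) (trans (cong (_+v φ₀ x) (sym (0·v v))) eq)) (sym (0-hom (linear P)))))
    ... | no a≢0 = ⊥-elim (v∉X (subst (_∈ˢ X) (⁻¹-scale a v a≢0) (·-closed S (a ⁻¹) av∈)))
      where
      -- The kernel equation reads a v = 0 - φ₀ x, and the right side lies in `X`; dividing by `a`
      -- would then put `v` into `X`.
      av∈ : a ·v v ∈ˢ X
      av∈ = subst (_∈ˢ X) (trans (cong (_-v φ₀ x) (trans (sym eq) (+v-comm (a ·v v) (φ₀ x)))) (+v-cancel (φ₀ x) (a ·v v)))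
        (-closed S (zero-closed S) (into P x))

  module _ {n : ℕ} {X : VSet n} (S : Sub X) where

    params : Param X (dim X)
    params = subst (Param X) (sym (param-dim S (PerpParams.params (perpParams S)))) (PerpParams.params (perpParams S))

    dim-perp : dim X ℕ.+ dim (perp X) ≡ n
    dim-perp = trans
      (cong₂ ℕ._+_ (param-dim S (PerpParams.params (perpParams S))) (param-dim perp-sub (PerpParams.params⊥ (perpParams S))))
      (PerpParams.d+e≡n (perpParams S))

    dim-≤ : dim X ≤ n
    dim-≤ = subst (dim X ≤_) dim-perp (ℕₚ.m≤m+n _ _)

    dim-adjoin : ∀ {v} → ¬ (v ∈ˢ X) → dim (X ⊕ line v) ≡ suc (dim X)
    dim-adjoin {v} v∉X = param-dim (⊕-sub S (line-sub v)) (param-adjoin S params v∉X)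

  module _ {n : ℕ} {X Y : VSet n} (SX : Sub X) (SY : Sub Y) (X⊆Y : X ⊆ Y) where

    dim-mono : dim X ≤ dim Y
    dim-mono = param-≤ X⊆Y (params SX) (params SY)

    dim-adjoin-≤ : ∀ {v} → v ∈ˢ Y → ¬ (v ∈ˢ X) → dim X < dim Y
    dim-adjoin-≤ {v} v∈Y v∉X = subst (_≤ dim Y) (dim-adjoin SX v∉X)
      (param-≤ (⊕-least SY X⊆Y (line-⊆ SY v∈Y)) (params (⊕-sub SX (line-sub v))) (params SY))

    dim-strict : ¬ (Y ⊆ X) → dim X < dim Y
    dim-strict Y⊈X = let v , v∈Y , v∉X = ⊈-witness Y⊈X in dim-adjoin-≤ v∈Y v∉X

    dim-≥⇒⊇ : dim Y ≤ dim X → Y ⊆ X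
    dim-≥⇒⊇ dY≤dX {v} v∈Y with v ∈ˢ? X
    ... | yes v∈X = v∈X
    ... | no v∉X  = ⊥-elim (ℕₚ.<⇒≱ (dim-adjoin-≤ v∈Y v∉X) dY≤dX)

    ≡-by-dim : dim Y ≤ dim X → X ≡ Y
    ≡-by-dim h = ⊆-antisym X⊆Y (dim-≥⇒⊇ h)

  dim-full : ∀ n → dim (fullSpace {n}) ≡ n
  dim-full n = param-dim full-sub fullSpace-param

  dim-zero : ∀ n → dim (zeroSub {n}) ≡ 0
  dim-zero n = param-dim (zeroSub-sub {n}) record
    { φ = λ _ → zeroV
    ; linear = record { +-hom = λ _ _ → sym (+v-identityˡ zeroV) ; ·-hom = λ c _ → sym (·v-zero c) }
    ; injective = λ { {[]} {[]} _ → refl }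
    ; into = λ _ → zero-closed zeroSub-sub
    ; coord = λ v∈ → [] , sym (∈-zeroSub⁻ v∈)
    }

  dim-line-≤ : ∀ {n} (v : Vect n) → dim (line v) ≤ 1
  dim-line-≤ {n} v with v ∈ˢ? zeroSub
  ... | yes v∈ = ℕₚ.≤-trans (dim-mono (line-sub v) zeroSub-sub (line-⊆ zeroSub-sub v∈)) (ℕₚ.≤-trans (ℕₚ.≤-reflexive (dim-zero n)) z≤n)
  ... | no v∉  = ℕₚ.≤-trans (dim-mono (line-sub v) (⊕-sub zeroSub-sub (line-sub v)) (⊆-⊕ʳ zeroSub-sub))
    (ℕₚ.≤-reflexive (trans (dim-adjoin zeroSub-sub v∉) (cong suc (dim-zero n))))

  -- `X` and `perp X` may intersect nontrivially, so the argument goes through dimensions: the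
  -- dimension formula applied twice turns the inclusion into an equality.
  perp-perp : ∀ {n} {X : VSet n} → Sub X → perp (perp X) ≡ X
  perp-perp {n} {X} S = sym (≡-by-dim S perp-sub ⊆-perp-perp (ℕₚ.≤-reflexive (sym dims)))
    where
    dims : dim X ≡ dim (perp (perp X))
    dims = ℕₚ.+-cancelʳ-≡ (dim (perp X)) (dim X) (dim (perp (perp X)))
      (trans (dim-perp S) (trans (sym (dim-perp (perp-sub {X = X}))) (ℕₚ.+-comm (dim (perp X)) (dim (perp (perp X))))))

  -- The intermediate space is grown from X one vector at a time; k counts the remaining steps.
  hyperplane-above : ∀ {n} {X W : VSet n} → Sub X → Sub W → X ⊆ W → ¬ (W ⊆ X) →
    ∃ λ H → Sub H × X ⊆ H × H ⊆ W × dim W ≡ suc (dim H)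
  hyperplane-above {n} {X₀} {W} SX₀ SW X₀⊆W W⊈X₀ = grow (dim W) X₀ SX₀ id X₀⊆W W⊈X₀ (ℕₚ.m≤n+m (dim W) (dim X₀))
    where
    grow : ∀ k X → Sub X → X₀ ⊆ X → X ⊆ W → ¬ (W ⊆ X) → dim W ≤ dim X ℕ.+ k →
      ∃ λ H → Sub H × X₀ ⊆ H × H ⊆ W × dim W ≡ suc (dim H)
    grow zero X SX X₀⊆X X⊆W W⊈X bound =
      ⊥-elim (W⊈X (dim-≥⇒⊇ SX SW X⊆W (subst (dim W ≤_) (ℕₚ.+-identityʳ _) bound)))
    grow (suc k) X SX X₀⊆X X⊆W W⊈X bound with ⊈-witness W⊈X
    ... | v , v∈W , v∉X with W ⊆? (X ⊕ line v)
    ...   | yes W⊆ = X , SX , X₀⊆X , X⊆W ,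
            trans (cong dim (⊆-antisym W⊆ (⊕-least SW X⊆W (line-⊆ SW v∈W)))) (dim-adjoin SX v∉X)
    ...   | no W⊈ = grow k (X ⊕ line v) (⊕-sub SX (line-sub v)) (λ h → ⊆-⊕ˡ (line-sub v) (X₀⊆X h))
            (⊕-least SW X⊆W (line-⊆ SW v∈W)) W⊈
            (subst (λ t → dim W ≤ t ℕ.+ k) (sym (dim-adjoin SX v∉X)) (subst (dim W ≤_) (ℕₚ.+-suc (dim X) k) bound))

  hyperplane-⊕ : ∀ {n} {H W : VSet n} → Sub H → Sub W → H ⊆ W → dim W ≡ suc (dim H) →
    ∀ {v} → v ∈ˢ W → ¬ (v ∈ˢ H) → H ⊕ line v ≡ W
  hyperplane-⊕ {H = H} {W} SH SW H⊆W d {v} v∈W v∉H =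
    ≡-by-dim (⊕-sub SH (line-sub v)) SW (⊕-least SW H⊆W (line-⊆ SW v∈W)) dims
    where
    dims : dim W ≤ dim (H ⊕ line v)
    dims = subst (dim W ≤_) (sym (dim-adjoin SH v∉H)) (ℕₚ.≤-reflexive d)

  -- An instance of the modular law: if x = h + l with x and l in `C`, then h = x - l is in `C` too.
  ∩-⊕-line : ∀ {n} {H C : VSet n} → Sub H → Sub C → ∀ {v} → v ∈ˢ C → C ⊆ H ⊕ line v → C ≡ (C ∩ˢ H) ⊕ line v
  ∩-⊕-line {H = H} {C} SH SC {v} v∈C C⊆H⊕v =
    ⊆-antisym (λ x∈C → split x∈C (∈-⊕⁻ (C⊆H⊕v x∈C))) (⊕-least SC ∩-⊆ˡ (line-⊆ SC v∈C))
    where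
    split : ∀ {x} → x ∈ˢ C → (∃ λ h → ∃ λ l → h ∈ˢ H × l ∈ˢ line v × x ≡ h +v l) → x ∈ˢ (C ∩ˢ H) ⊕ line v
    split x∈C (h , l , h∈ , l∈ , refl) = ∈-⊕⁺ (∈-∩⁺ h∈C h∈) l∈
      where
      h∈C : h ∈ˢ C
      h∈C = subst (_∈ˢ C) (trans (cong (_-v l) (+v-comm h l)) (+v-cancel l h)) (-closed SC x∈C (line-⊆ SC v∈C l∈))

  -- Any `v` in `C` outside `H` generates `W` together with `H`, hence by the modular law generates
  -- `C` together with `C ∩ˢ H`.
  dim-hyperplane-section : ∀ {n} {H W C : VSet n} → Sub H → Sub W → Sub C → H ⊆ W → dim W ≡ suc (dim H) →
    C ⊆ W → ¬ (C ⊆ H) → dim C ≡ suc (dim (C ∩ˢ H))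
  dim-hyperplane-section {n} {H} {W} {C} SH SW SC H⊆W d C⊆W C⊈H = section (⊈-witness C⊈H)
    where
    section : (∃ λ v → v ∈ˢ C × ¬ (v ∈ˢ H)) → dim C ≡ suc (dim (C ∩ˢ H))
    section (v , v∈C , v∉H) = trans (cong dim C≡) (dim-adjoin (∩-sub SC SH) (λ v∈ → v∉H (∩-⊆ʳ v∈)))
      where
      C≡ : C ≡ (C ∩ˢ H) ⊕ line v
      C≡ = ∩-⊕-line SH SC v∈C (λ {x} x∈C → subst (x ∈ˢ_) (sym (hyperplane-⊕ SH SW H⊆W d (C⊆W v∈C) v∉H)) (C⊆W x∈C))

-- Counting subspaces by dimension and the vanishing of weight sums.

module Counting {q : ℕ} (F : FiniteField q) where

  open FiniteField F renaming (_+_ to _+ᶠ_; _*_ to _*ᶠ_; -_ to -ᶠ_)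
  open QMatroidTheory F hiding (f; s)
  open Vectors F
  open Subspaces F
  open IsCommutativeRing isCommutativeRing using (*-comm; *-identityˡ)

  subspacesOf : ∀ {n} → VSet n → List (VSet n)
  subspacesOf {n} W = filterᵇ (λ V → V ⊆ᵇ W) (allSubspaces n)

  ∈-subspacesOf⁺ : ∀ {n} {V W : VSet n} → Sub V → V ⊆ W → V ∈ subspacesOf W
  ∈-subspacesOf⁺ {n} {V} {W} S V⊆W = filterᵇ⁺ (λ V → V ⊆ᵇ W) (allSubspaces n) (∈-subspaces⁺ S) (⊆ᵇ⁺ V W V⊆W)

  ∈-subspacesOf⁻ : ∀ {n} {V : VSet n} W → V ∈ subspacesOf W → Sub V × V ⊆ W
  ∈-subspacesOf⁻ {n} {V} W V∈ = let p , r = filterᵇ⁻ (λ V → V ⊆ᵇ W) (allSubspaces n) V∈ in ∈-subspaces⁻ p , (λ {v} → ⊆ᵇ⁻ V W r {v})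

  subspacesOf-unique : ∀ {n} (W : VSet n) → Unique (subspacesOf W)
  subspacesOf-unique {n} W = filterᵇ-unique (λ V → V ⊆ᵇ W) (allSubspaces n) (subspaces-unique n)

  module _ {d n : ℕ} (ψ : Vect d → Vect n) where

    private
      hits : VSet d → Vect n → Vect d → Bool
      hits Y v x = member Y x ∧ does (ψ x ≟ᵛ v)

    image : VSet d → VSet n
    image Y = fromPred (λ v → any (hits Y v) (allVecs d))

    preimage : VSet n → VSet d
    preimage V = fromPred (λ x → member V (ψ x))

    ∈-image⁺ : ∀ {Y x} → x ∈ˢ Y → ψ x ∈ˢ image Y
    ∈-image⁺ {Y} {x} x∈ = ∈-fromPred⁺ (λ v → any (hits Y v) (allVecs d))
      (any-T⁺ (hits Y (ψ x)) (allVecs d) (allVecs-complete x) (∧⁺ (unmem x∈) (does⁺ (ψ x ≟ᵛ ψ x) refl)))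

    ∈-image⁻ : ∀ {Y v} → v ∈ˢ image Y → ∃ λ x → x ∈ˢ Y × ψ x ≡ v
    ∈-image⁻ {Y} {v} v∈ =
      let x , _ , h = any-T⁻ (hits Y v) (allVecs d) (∈-fromPred⁻ (λ v → any (hits Y v) (allVecs d)) v∈)
          p , r = ∧⁻ {member Y x} h
      in x , mem p , does⁻ (ψ x ≟ᵛ v) r

    ∈-preimage⁺ : ∀ {V x} → ψ x ∈ˢ V → x ∈ˢ preimage V
    ∈-preimage⁺ {V} h = ∈-fromPred⁺ (λ x → member V (ψ x)) (unmem h)

    ∈-preimage⁻ : ∀ {V x} → x ∈ˢ preimage V → ψ x ∈ˢ V
    ∈-preimage⁻ {V} h = mem (∈-fromPred⁻ (λ x → member V (ψ x)) h)

    module _ (L : Linear ψ) where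

      image-sub : ∀ {Y} → Sub Y → Sub (image Y)
      image-sub {Y} S = record
        { zero-closed = subst (_∈ˢ image Y) (0-hom L) (∈-image⁺ (zero-closed S))
        ; +-closed = λ u∈ v∈ → add (∈-image⁻ u∈) (∈-image⁻ v∈)
        ; ·-closed = λ c u∈ → scale c (∈-image⁻ u∈)
        }
        where
        Hit : Vect n → Set
        Hit v = ∃ λ x → x ∈ˢ Y × ψ x ≡ v
        add : ∀ {u v} → Hit u → Hit v → u +v v ∈ˢ image Y
        add (x , x∈ , refl) (y , y∈ , refl) = subst (_∈ˢ image Y) (+-hom L x y) (∈-image⁺ (+-closed S x∈ y∈))
        scale : ∀ c {u} → Hit u → c ·v u ∈ˢ image Y
        scale c (x , x∈ , refl) = subst (_∈ˢ image Y) (·-hom L c x) (∈-image⁺ (·-closed S c x∈))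

      preimage-sub : ∀ {V} → Sub V → Sub (preimage V)
      preimage-sub {V} S = record
        { zero-closed = ∈-preimage⁺ (subst (_∈ˢ V) (sym (0-hom L)) (zero-closed S))
        ; +-closed = λ {u} {v} u∈ v∈ → ∈-preimage⁺ (subst (_∈ˢ V) (sym (+-hom L u v)) (+-closed S (∈-preimage⁻ u∈) (∈-preimage⁻ v∈)))
        ; ·-closed = λ c {u} u∈ → ∈-preimage⁺ (subst (_∈ˢ V) (sym (·-hom L c u)) (·-closed S c (∈-preimage⁻ u∈)))
        }

      image-param : (∀ {x y} → ψ x ≡ ψ y → x ≡ y) → ∀ {Y e} → Param Y e → Param (image Y) e
      image-param inj {Y} P = record
        { φ = ψ ∘ φ P
        ; linear = linear-∘ L (linear P)
        ; injective = λ eq → injective P (inj eq)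
        ; into = λ x → ∈-image⁺ (into P x)
        ; coord = λ v∈ → lift (∈-image⁻ v∈)
        }
        where
        lift : ∀ {v} → (∃ λ x → x ∈ˢ Y × ψ x ≡ v) → ∃ λ x → ψ (φ P x) ≡ v
        lift (x , x∈ , refl) = let y , eq = coord P x∈ in y , cong ψ eq

      dim-image : (∀ {x y} → ψ x ≡ ψ y → x ≡ y) → ∀ {Y} → Sub Y → dim (image Y) ≡ dim Y
      dim-image inj {Y} S = param-dim (image-sub S) (image-param inj (params S))

  -- Image and preimage under the coordinate map are inverse bijections that preserve dimension.
  -- This carries statements about all subspaces of F^d, such as the counts `gauss`, over to the
  -- subspaces of any `W`.
  ∑-subspacesOf-param : ∀ {n d} {W : VSet n} → Param W d → (h : ℕ → ℤ) →
    ∑ (allSubspaces d) (λ Y → h (dim Y)) ≡ ∑ (subspacesOf W) (λ V → h (dim V))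
  ∑-subspacesOf-param {n} {d} {W} P h = trans
    (∑-cong (allSubspaces d) (λ {Y} Y∈ → cong h (sym (dim-image ψ (linear P) (injective P) {Y} (∈-subspaces⁻ Y∈)))))
    (∑-bijection (image ψ) (preimage ψ) (subspaces-unique d) (subspacesOf-unique W)
      (λ {Y} Y∈ → ∈-subspacesOf⁺ (image-sub ψ (linear P) (∈-subspaces⁻ Y∈)) (image⊆ Y))
      (λ V∈ → ∈-subspaces⁺ (preimage-sub ψ (linear P) (proj₁ (∈-subspacesOf⁻ W V∈))))
      (λ {Y} _ → preimage-image Y)
      (λ {V} V∈ → image-preimage V (proj₂ (∈-subspacesOf⁻ W V∈)))
      (λ V → h (dim V)))
    where
    ψ = φ P
    image⊆ : ∀ Y → image ψ Y ⊆ W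
    image⊆ Y v∈ = let x , _ , eq = ∈-image⁻ ψ v∈ in subst (_∈ˢ W) eq (into P x)
    preimage-image : ∀ Y → preimage ψ (image ψ Y) ≡ Y
    preimage-image Y = ⊆-antisym
      (λ x∈ → let y , y∈ , eq = ∈-image⁻ ψ (∈-preimage⁻ ψ x∈) in subst (_∈ˢ Y) (injective P eq) y∈)
      (λ x∈ → ∈-preimage⁺ ψ (∈-image⁺ ψ x∈))
    image-preimage : ∀ V → V ⊆ W → image ψ (preimage ψ V) ≡ V
    image-preimage V V⊆W = ⊆-antisym
      (λ v∈ → let x , x∈ , eq = ∈-image⁻ ψ v∈ in subst (_∈ˢ V) eq (∈-preimage⁻ ψ x∈))
      (λ v∈ → let x , eq = coord P (V⊆W v∈)
              in subst (_∈ˢ image ψ (preimage ψ V)) eq (∈-image⁺ ψ (∈-preimage⁺ ψ (subst (_∈ˢ V) (sym eq) v∈))))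

  supspacesOf : ∀ {n} → VSet n → List (VSet n)
  supspacesOf {n} U = filterᵇ (λ V → U ⊆ᵇ V) (allSubspaces n)

  -- Taking complements replaces the quotient by `U` with the genuine subspace `perp U`, of
  -- dimension n - dim U. A `j`-dimensional subspace of it is the complement of a `V` of dimension n
  -- - j, whence the argument of `h`.
  ∑-supspacesOf : ∀ {n} {U : VSet n} → Sub U → (h : ℕ → ℤ) →
    ∑ (supspacesOf U) (λ V → h (dim V)) ≡ ∑ (range 0 (n ∸ dim U)) (λ j → + gauss (n ∸ dim U) j ℤ.* h (n ∸ j))
  ∑-supspacesOf {n} {U} S h = begin
    ∑ (supspacesOf U) (λ V → h (dim V))
      ≡⟨ ∑-cong (supspacesOf U) (λ {V} V∈ → cong h (dim-via-perp V (proj₁ (∈-sup⁻ V∈)))) ⟩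
    ∑ (supspacesOf U) (λ V → h (n ∸ dim (perp V)))
      ≡⟨ ∑-bijection perp perp (filterᵇ-unique (λ V → U ⊆ᵇ V) (allSubspaces n) (subspaces-unique n)) (subspacesOf-unique (perp U))
           (λ {V} V∈ → ∈-subspacesOf⁺ perp-sub (perp-antitone (proj₂ (∈-sup⁻ V∈))))
           (λ {V} V∈ → ∈-sup⁺ perp-sub (λ u∈ → perp-antitone (proj₂ (∈-subspacesOf⁻ (perp U) V∈)) (⊆-perp-perp u∈)))
           (λ V∈ → perp-perp (proj₁ (∈-sup⁻ V∈)))
           (λ V∈ → perp-perp (proj₁ (∈-subspacesOf⁻ (perp U) V∈)))
           (λ V → h (n ∸ dim V)) ⟩
    ∑ (subspacesOf (perp U)) (λ V → h (n ∸ dim V))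
      ≡⟨ sym (∑-subspacesOf-param perp-params (λ j → h (n ∸ j))) ⟩
    ∑ (allSubspaces l) (λ Y → h (n ∸ dim Y))
      ≡⟨ ∑-group (allSubspaces l) dim (λ j → h (n ∸ j)) (range 0 l) (range-unique 0 l)
           (λ Y∈ → ∈-range⁺ z≤n (dim-≤ (∈-subspaces⁻ Y∈))) ⟩
    ∑ (range 0 l) (λ j → + gauss l j ℤ.* h (n ∸ j)) ∎
    where
    open ≡-Reasoning
    l = n ∸ dim U
    dim-via-perp : ∀ V → Sub V → dim V ≡ n ∸ dim (perp V)
    dim-via-perp V SV = trans (sym (ℕₚ.m+n∸n≡m (dim V) (dim (perp V)))) (cong (_∸ dim (perp V)) (dim-perp SV))
    perp-params : Param (perp U) l
    perp-params = subst (Param (perp U)) (trans (sym (ℕₚ.m+n∸m≡n (dim U) (dim (perp U)))) (cong (_∸ dim U) (dim-perp S))) (params perp-sub)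
    ∈-sup⁻ : ∀ {V} → V ∈ supspacesOf U → Sub V × U ⊆ V
    ∈-sup⁻ {V} V∈ = let p , r = filterᵇ⁻ (λ V → U ⊆ᵇ V) (allSubspaces n) V∈ in ∈-subspaces⁻ p , (λ {v} → ⊆ᵇ⁻ U V r {v})
    ∈-sup⁺ : ∀ {V} → Sub V → U ⊆ V → V ∈ supspacesOf U
    ∈-sup⁺ {V} SV U⊆V = filterᵇ⁺ (λ V → U ⊆ᵇ V) (allSubspaces n) (∈-subspaces⁺ SV) (⊆ᵇ⁺ U V U⊆V)

  -- The subspaces of F × F^n with a given projection U to F^n are F × U and the graphs of the functionals on U.
  projection : ∀ {n} → VSet (suc n) → VSet n
  projection X = fromPred (λ v → any (λ a → member X (a ∷ v)) allF)

  ∈-projection⁺ : ∀ {n} {X : VSet (suc n)} {a v} → a ∷ v ∈ˢ X → v ∈ˢ projection X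
  ∈-projection⁺ {X = X} {a} {v} h = ∈-fromPred⁺ (λ v → any (λ a → member X (a ∷ v)) allF)
    (any-T⁺ (λ a → member X (a ∷ v)) allF (∈-allFin a) (unmem h))

  ∈-projection⁻ : ∀ {n} {X : VSet (suc n)} {v} → v ∈ˢ projection X → ∃ λ a → a ∷ v ∈ˢ X
  ∈-projection⁻ {X = X} {v} h =
    let a , _ , p = any-T⁻ (λ a → member X (a ∷ v)) allF (∈-fromPred⁻ (λ v → any (λ a → member X (a ∷ v)) allF) h)
    in a , mem p

  projection-sub : ∀ {n} {X : VSet (suc n)} → Sub X → Sub (projection X)
  projection-sub S = record
    { zero-closed = ∈-projection⁺ (zero-closed S)
    ; +-closed = λ u∈ v∈ → ∈-projection⁺ (+-closed S (proj₂ (∈-projection⁻ u∈)) (proj₂ (∈-projection⁻ v∈)))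
    ; ·-closed = λ c u∈ → ∈-projection⁺ (·-closed S c (proj₂ (∈-projection⁻ u∈)))
    }

  module Fibre {n d : ℕ} {U : VSet n} (S : Sub U) (P : Param U d) where

    private
      e₁ : Vect (suc n)
      e₁ = 1# ∷ zeroV

    cylinder : VSet (suc n)
    cylinder = fromPred (λ x → member U (Vec.tail x))

    cylinder⁺ : ∀ a {v} → v ∈ˢ U → a ∷ v ∈ˢ cylinder
    cylinder⁺ a v∈ = ∈-fromPred⁺ (λ x → member U (Vec.tail x)) (unmem v∈)

    cylinder⁻ : ∀ {a v} → a ∷ v ∈ˢ cylinder → v ∈ˢ U
    cylinder⁻ h = mem (∈-fromPred⁻ (λ x → member U (Vec.tail x)) h)

    cylinder-sub : Sub cylinder
    cylinder-sub = record
      { zero-closed = cylinder⁺ 0# (zero-closed S)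
      ; +-closed = λ { {a ∷ u} {b ∷ v} u∈ v∈ → cylinder⁺ (a +ᶠ b) (+-closed S (cylinder⁻ u∈) (cylinder⁻ v∈)) }
      ; ·-closed = λ { c {a ∷ u} u∈ → cylinder⁺ (c *ᶠ a) (·-closed S c (cylinder⁻ u∈)) }
      }

    dim-cylinder : dim cylinder ≡ suc d
    dim-cylinder = param-dim cylinder-sub record
      { φ = λ x → Vec.head x ∷ φ P (Vec.tail x)
      ; linear = record
        { +-hom = λ { (a ∷ x) (b ∷ y) → cong ((a +ᶠ b) ∷_) (+-hom (linear P) x y) }
        ; ·-hom = λ { c (a ∷ x) → cong ((c *ᶠ a) ∷_) (·-hom (linear P) c x) }
        }
      ; injective = λ { {a ∷ x} {b ∷ y} eq → cong₂ _∷_ (Vecₚ.∷-injectiveˡ eq) (injective P (Vecₚ.∷-injectiveʳ eq)) }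
      ; into = λ { (a ∷ x) → cylinder⁺ a (into P x) }
      ; coord = λ { {a ∷ v} v∈ → let x , eq = coord P (cylinder⁻ v∈) in a ∷ x , cong (a ∷_) eq }
      }

    graphMap : Vect d → Vect d → Vect (suc n)
    graphMap a x = dot a x ∷ φ P x

    graphMap-linear : ∀ a → Linear (graphMap a)
    graphMap-linear a = record
      { +-hom = λ x y → cong₂ _∷_ (dot-+ʳ a x y) (+-hom (linear P) x y)
      ; ·-hom = λ c x → cong₂ _∷_ (dot-·ʳ a c x) (·-hom (linear P) c x)
      }

    graphMap-injective : ∀ a {x y} → graphMap a x ≡ graphMap a y → x ≡ y
    graphMap-injective a eq = injective P (Vecₚ.∷-injectiveʳ eq)

    graph : Vect d → VSet (suc n)
    graph a = image (graphMap a) fullSpace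

    graph-sub : ∀ a → Sub (graph a)
    graph-sub a = image-sub (graphMap a) (graphMap-linear a) full-sub

    dim-graph : ∀ a → dim (graph a) ≡ d
    dim-graph a = param-dim (graph-sub a) (image-param (graphMap a) (graphMap-linear a) (graphMap-injective a) fullSpace-param)

    graph⁺ : ∀ a x → graphMap a x ∈ˢ graph a
    graph⁺ a x = ∈-image⁺ (graphMap a) (∈-full x)

    graph-functional : ∀ a {t x} → t ∷ φ P x ∈ˢ graph a → t ≡ dot a x
    graph-functional a {t} {x} h with ∈-image⁻ (graphMap a) {fullSpace} h
    ... | y , _ , eq = trans (sym (Vecₚ.∷-injectiveˡ eq)) (cong (dot a) (injective P (Vecₚ.∷-injectiveʳ eq)))

    graph-injective : ∀ {a b} → graph a ≡ graph b → a ≡ b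
    graph-injective {a} {b} eq = dot-nondegenerate a b λ x → graph-functional b (subst (graphMap a x ∈ˢ_) eq (graph⁺ a x))

    e₁∈cylinder : e₁ ∈ˢ cylinder
    e₁∈cylinder = cylinder⁺ 1# (zero-closed S)

    e₁∉graph : ∀ a → ¬ (e₁ ∈ˢ graph a)
    e₁∉graph a h = 0≢1 (sym (trans (graph-functional a {1#} {zeroV} (subst (λ v → 1# ∷ v ∈ˢ graph a) (sym (0-hom (linear P))) h)) (dot-zeroʳ a)))

    fibre : List (VSet (suc n))
    fibre = cylinder ∷ map graph (allVecs d)

    fibre-unique : Unique fibre
    fibre-unique = All.tabulate (λ X∈ → cylinder≢ (∈-map⁻ graph X∈)) ∷ Uniqueₚ.map⁺ graph-injective (allVecs-unique d)
      where
      cylinder≢ : ∀ {X} → (∃ λ a → a ∈ allVecs d × X ≡ graph a) → cylinder ≢ X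
      cylinder≢ (a , _ , refl) eq = e₁∉graph a (subst (e₁ ∈ˢ_) eq e₁∈cylinder)

    ∈-fibre⁻ : ∀ {X} → X ∈ fibre → Sub X × projection X ≡ U
    ∈-fibre⁻ (here refl) = cylinder-sub , ⊆-antisym (λ v∈ → cylinder⁻ (proj₂ (∈-projection⁻ v∈))) (λ v∈ → ∈-projection⁺ (cylinder⁺ 0# v∈))
    ∈-fibre⁻ (there X∈) with ∈-map⁻ graph X∈
    ... | a , _ , refl = graph-sub a , ⊆-antisym (λ v∈ → down (∈-image⁻ (graphMap a) (proj₂ (∈-projection⁻ v∈))))
      (λ {v} v∈ → let x , eq = coord P v∈ in subst (_∈ˢ projection (graph a)) eq (∈-projection⁺ (graph⁺ a x)))
      where
      down : ∀ {t v} → (∃ λ x → x ∈ˢ fullSpace × graphMap a x ≡ t ∷ v) → v ∈ˢ U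
      down (x , _ , eq) = subst (_∈ˢ U) (Vecₚ.∷-injectiveʳ eq) (into P x)

    module Classify {X : VSet (suc n)} (SX : Sub X) (proj≡ : projection X ≡ U) where

      X⇒U : ∀ {a v} → a ∷ v ∈ˢ X → v ∈ˢ U
      X⇒U {v = v} h = subst (v ∈ˢ_) proj≡ (∈-projection⁺ h)

      U⇒X : ∀ {v} → v ∈ˢ U → ∃ λ a → a ∷ v ∈ˢ X
      U⇒X {v} h = ∈-projection⁻ (subst (v ∈ˢ_) (sym proj≡) h)

      -- Adding multiples of `e₁` changes the first entry at will.
      isCylinder : e₁ ∈ˢ X → X ≡ cylinder
      isCylinder e₁∈X = ⊆-antisym (λ { {a ∷ v} h → cylinder⁺ a (X⇒U h) }) (λ { {a ∷ v} h → shift a (U⇒X (cylinder⁻ h)) })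
        where
        shift : ∀ a {v} → (∃ λ b → b ∷ v ∈ˢ X) → a ∷ v ∈ˢ X
        shift a {v} (b , bv∈) = subst (_∈ˢ X) (cong₂ _∷_ head≡ tail≡) (+-closed SX bv∈ (·-closed SX (a +ᶠ (-ᶠ b)) e₁∈X))
          where
          head≡ : b +ᶠ ((a +ᶠ (-ᶠ b)) *ᶠ 1#) ≡ a
          head≡ = trans (cong (b +ᶠ_) (trans (*-comm _ 1#) (*-identityˡ _)))
            (Vecₚ.∷-injectiveˡ (-v-restore (a ∷ []) (b ∷ [])))
          tail≡ : v +v ((a +ᶠ (-ᶠ b)) ·v zeroV) ≡ v
          tail≡ = trans (cong (v +v_) (·v-zero _)) (+v-identityʳ v)

      -- Two vectors of `X` with equal tails differ by a multiple of `e₁`, so here the tail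
      -- determines the first entry; closure of `X` makes this dependence linear, hence a dot
      -- product in the coordinates of `U`.
      isGraph : ¬ (e₁ ∈ˢ X) → ∃ λ a → X ≡ graph a
      isGraph e₁∉X = a , ⊆-antisym (λ { {t ∷ v} h → into-graph h (coord P (X⇒U h)) }) (λ h → from-graph (∈-image⁻ (graphMap a) h))
        where
        single-valued : ∀ {t t′ v} → t ∷ v ∈ˢ X → t′ ∷ v ∈ˢ X → t ≡ t′
        single-valued {t} {t′} {v} h h′ with (t +ᶠ (-ᶠ t′)) Finₚ.≟ 0#
        ... | yes eq = Vecₚ.∷-injectiveˡ (-v-zero⇒≡ (t ∷ []) (t′ ∷ []) (cong (_∷ []) eq))
        ... | no c≢0 = ⊥-elim (e₁∉X (subst (_∈ˢ X) scaled≡e₁ (·-closed SX (c ⁻¹) (-closed SX h h′))))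
          where
          c = t +ᶠ (-ᶠ t′)
          scaled≡e₁ : (c ⁻¹) ·v (c ∷ (v -v v)) ≡ e₁
          scaled≡e₁ = cong₂ _∷_ (trans (*-comm (c ⁻¹) c) (⁻¹-inverse c c≢0)) (trans (cong ((c ⁻¹) ·v_) (-v-self v)) (·v-zero (c ⁻¹)))
        g : Vect d → Fin q
        g x = proj₁ (U⇒X (into P x))
        g∈ : ∀ x → g x ∷ φ P x ∈ˢ X
        g∈ x = proj₂ (U⇒X (into P x))
        g-linear : Linear (λ x → g x ∷ [])
        g-linear = record
          { +-hom = λ x y → cong (_∷ []) (single-valued (g∈ (x +v y))
              (subst (λ v → (g x +ᶠ g y) ∷ v ∈ˢ X) (sym (+-hom (linear P) x y)) (+-closed SX (g∈ x) (g∈ y))))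
          ; ·-hom = λ c x → cong (_∷ []) (single-valued (g∈ (c ·v x))
              (subst (λ v → (c *ᶠ g x) ∷ v ∈ˢ X) (sym (·-hom (linear P) c x)) (·-closed SX c (g∈ x))))
          }
        a : Vect d
        a = proj₁ (functional⇒dot g g-linear)
        a-rep : ∀ x → dot a x ≡ g x
        a-rep = proj₂ (functional⇒dot g g-linear)
        into-graph : ∀ {t v} → t ∷ v ∈ˢ X → (∃ λ x → φ P x ≡ v) → t ∷ v ∈ˢ graph a
        into-graph h (x , refl) = subst (λ t → t ∷ φ P x ∈ˢ graph a) (trans (a-rep x) (single-valued (g∈ x) h)) (graph⁺ a x)
        from-graph : ∀ {w} → (∃ λ x → x ∈ˢ fullSpace × graphMap a x ≡ w) → w ∈ˢ X
        from-graph (x , _ , refl) = subst (λ t → t ∷ φ P x ∈ˢ X) (sym (a-rep x)) (g∈ x)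

    ∈-fibre⁺ : ∀ {X} → Sub X → projection X ≡ U → X ∈ fibre
    ∈-fibre⁺ {X} SX proj≡ = split (e₁ ∈ˢ? X)
      where
      open Classify SX proj≡
      split : Dec (e₁ ∈ˢ X) → X ∈ fibre
      split (yes e₁∈X) = here (isCylinder e₁∈X)
      split (no e₁∉X)  = let a , eq = isGraph e₁∉X in there (subst (_∈ map graph (allVecs d)) (sym eq) (∈-map⁺ graph (allVecs-complete a)))

    -- One cylinder of dimension d + 1, and a graph of dimension d for each of the q^d functionals.
    ∑-fibre-dim : ∀ h → ∑ fibre (λ X → h (dim X)) ≡ h (suc d) ℤ.+ + (q ^ d) ℤ.* h d
    ∑-fibre-dim h = cong₂ ℤ._+_ (cong h dim-cylinder) (begin
      ∑ (map graph (allVecs d)) (λ X → h (dim X))    ≡⟨ ∑-map graph (allVecs d) (λ X → h (dim X)) ⟩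
      ∑ (allVecs d) (λ a → h (dim (graph a)))        ≡⟨ ∑-cong (allVecs d) (λ {a} _ → cong h (dim-graph a)) ⟩
      ∑ (allVecs d) (λ _ → h d)                      ≡⟨ ∑-const (allVecs d) (h d) ⟩
      + length (allVecs d) ℤ.* h d                   ≡⟨ cong (λ t → + t ℤ.* h d) (length-allVecs d) ⟩
      + (q ^ d) ℤ.* h d                              ∎)
      where open ≡-Reasoning

  -- For `h` the indicator of a single dimension this is the Pascal recursion for Gaussian
  -- binomials.
  ∑-allSubspaces-suc : ∀ n (h : ℕ → ℤ) →
    ∑ (allSubspaces (suc n)) (λ X → h (dim X)) ≡ ∑ (allSubspaces n) (λ U → h (suc (dim U)) ℤ.+ + (q ^ dim U) ℤ.* h (dim U))
  ∑-allSubspaces-suc n h = trans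
    (∑-fibre (allSubspaces (suc n)) (allSubspaces n) (λ X U → projection X ≡ˢ U) (λ X → h (dim X)) (subspaces-unique n)
      (λ {X} X∈ → projection X , ∈-subspaces⁺ (projection-sub (∈-subspaces⁻ X∈)) , ≡ˢ⁺ (projection X) (projection X) refl
        , λ {U} eq → sym (≡ˢ⁻ (projection X) U eq)))
    (∑-cong (allSubspaces n) (λ {U} U∈ → over U (∈-subspaces⁻ U∈)))
    where
    over : ∀ U → Sub U →
      ∑ (filterᵇ (λ X → projection X ≡ˢ U) (allSubspaces (suc n))) (λ X → h (dim X)) ≡ h (suc (dim U)) ℤ.+ + (q ^ dim U) ℤ.* h (dim U)
    over U S = trans
      (∑-set (λ X → h (dim X)) (filterᵇ-unique (λ X → projection X ≡ˢ U) (allSubspaces (suc n)) (subspaces-unique (suc n))) fibre-unique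
        (λ {X} X∈ → let p , r = filterᵇ⁻ (λ X → projection X ≡ˢ U) (allSubspaces (suc n)) X∈ in ∈-fibre⁺ (∈-subspaces⁻ p) (≡ˢ⁻ (projection X) U r))
        (λ {X} X∈ → let SX , eq = ∈-fibre⁻ X∈ in filterᵇ⁺ (λ X → projection X ≡ˢ U) (allSubspaces (suc n)) (∈-subspaces⁺ SX) (≡ˢ⁺ (projection X) U eq)))
      (∑-fibre-dim h)
      where open Fibre S (params S)

  -- The Möbius function of the lattice of subspaces on an interval of length d.
  weight : ℕ → ℤ
  weight d = negOnePow d ℤ.* + (q ^ (d choose 2))

  -- Since (d+1 choose 2) = d + (d choose 2), a cylinder cancels exactly against the q^d graphs over
  -- the same `d`-dimensional subspace.
  weight-suc : ∀ d → weight (suc d) ℤ.+ + (q ^ d) ℤ.* weight d ≡ 0ℤ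
  weight-suc d = begin
    ℤ.- negOnePow d ℤ.* + (q ^ (suc d choose 2)) ℤ.+ + (q ^ d) ℤ.* weight d     ≡⟨ cong (λ t → ℤ.- negOnePow d ℤ.* t ℤ.+ + (q ^ d) ℤ.* weight d) power ⟩
    ℤ.- negOnePow d ℤ.* (+ (q ^ d) ℤ.* + (q ^ (d choose 2))) ℤ.+ + (q ^ d) ℤ.* weight d     ≡⟨ cancel (negOnePow d) (+ (q ^ d)) (+ (q ^ (d choose 2))) ⟩
    0ℤ ∎
    where
    open ≡-Reasoning
    cancel : ∀ a b c → ℤ.- a ℤ.* (b ℤ.* c) ℤ.+ b ℤ.* (a ℤ.* c) ≡ 0ℤ
    cancel = solve-∀
    power : + (q ^ (suc d choose 2)) ≡ + (q ^ d) ℤ.* + (q ^ (d choose 2))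
    power = begin
      + (q ^ (suc d choose 2))                ≡⟨ cong (λ t → + (q ^ t)) (sym (nCk+nC[k+1]≡[n+1]C[k+1] d 1)) ⟩
      + (q ^ (d choose 1 ℕ.+ d choose 2))          ≡⟨ cong (λ t → + (q ^ (t ℕ.+ d choose 2))) (nC1≡n d) ⟩
      + (q ^ (d ℕ.+ d choose 2))              ≡⟨ cong +_ (ℕₚ.^-distribˡ-+-* q d (d choose 2)) ⟩
      + (q ^ d ℕ.* q ^ (d choose 2))          ≡⟨ ℤₚ.pos-* (q ^ d) (q ^ (d choose 2)) ⟩
      + (q ^ d) ℤ.* + (q ^ (d choose 2))      ∎

  ∑-weight : ∀ n → ∑ (allSubspaces (suc n)) (λ X → weight (dim X)) ≡ 0ℤ
  ∑-weight n = trans (∑-allSubspaces-suc n weight) (∑-vanish (allSubspaces n) (λ {U} _ → weight-suc (dim U)))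

  ∑-weight-subspacesOf : ∀ {n} {W : VSet n} → Sub W → 1 ≤ dim W → ∑ (subspacesOf W) (λ V → weight (dim V)) ≡ 0ℤ
  ∑-weight-subspacesOf {n} {W} S 1≤d = vanish (dim W) 1≤d (params S)
    where
    vanish : ∀ d → 1 ≤ d → Param W d → ∑ (subspacesOf W) (λ V → weight (dim V)) ≡ 0ℤ
    vanish (suc d) _ P = trans (sym (∑-subspacesOf-param P weight)) (∑-weight d)

-- Möbius inversion in the lattice of subspaces.

module Inversion {q : ℕ} (F : FiniteField q) where

  open QMatroidTheory F hiding (f; s)
  open Subspaces F
  open Counting F

  properSubspacesOf : ∀ {n} → VSet n → List (VSet n)
  properSubspacesOf {n} W = filterᵇ (λ V → V ⊂ᵇ W) (allSubspaces n)

  ∈-proper⁺ : ∀ {n} {V W : VSet n} → Sub V → V ⊆ W → ¬ (W ⊆ V) → V ∈ properSubspacesOf W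
  ∈-proper⁺ {n} {V} {W} S V⊆W W⊈V = filterᵇ⁺ (λ V → V ⊂ᵇ W) (allSubspaces n) (∈-subspaces⁺ S) (⊂ᵇ⁺ V W V⊆W W⊈V)

  ∈-proper⁻ : ∀ {n} {V : VSet n} W → V ∈ properSubspacesOf W → Sub V × V ⊆ W × ¬ (W ⊆ V)
  ∈-proper⁻ {n} {V} W V∈ =
    let p , r = filterᵇ⁻ (λ V → V ⊂ᵇ W) (allSubspaces n) V∈
        V⊆W , W⊈V = ⊂ᵇ⁻ V W r
    in ∈-subspaces⁻ p , (λ {v} → V⊆W {v}) , W⊈V

  proper-unique : ∀ {n} (W : VSet n) → Unique (properSubspacesOf W)
  proper-unique {n} W = filterᵇ-unique (λ V → V ⊂ᵇ W) (allSubspaces n) (subspaces-unique n)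

  ∑-subspacesOf-split : ∀ {n} {W : VSet n} → Sub W → (a : VSet n → ℤ) →
    ∑ (subspacesOf W) a ≡ a W ℤ.+ ∑ (properSubspacesOf W) a
  ∑-subspacesOf-split {n} {W} S a = ∑-set a (subspacesOf-unique W)
    (All.tabulate (λ {V} V∈ W≡V → proj₂ (proj₂ (∈-proper⁻ W V∈)) (λ {v} → subst (v ∈ˢ_) W≡V)) ∷ proper-unique W)
    (λ {V} V∈ → let SV , V⊆W = ∈-subspacesOf⁻ W V∈ in classify V SV (λ {v} → V⊆W {v}) (W ⊆? V))
    backward
    where
    classify : ∀ V → Sub V → V ⊆ W → Dec (W ⊆ V) → V ∈ W ∷ properSubspacesOf W
    classify V SV V⊆W (yes W⊆V) = here (⊆-antisym V⊆W W⊆V)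
    classify V SV V⊆W (no W⊈V)  = there (∈-proper⁺ SV V⊆W W⊈V)
    backward : ∀ {V} → V ∈ W ∷ properSubspacesOf W → V ∈ subspacesOf W
    backward (here refl) = ∈-subspacesOf⁺ S id
    backward (there V∈)  = let SV , V⊆W , _ = ∈-proper⁻ W V∈ in ∈-subspacesOf⁺ SV V⊆W

  -- Summation over subspaces is unitriangular for the order by dimension. The sums are compared
  -- only below `W`, because the deletion identity to which this is applied holds there.
  zeta-injective : ∀ {n} {W : VSet n} → Sub W → (a b : VSet n → ℤ) →
    (∀ {V} → Sub V → V ⊆ W → ∑ (subspacesOf V) a ≡ ∑ (subspacesOf V) b) → a W ≡ b W
  zeta-injective {n} {W} S a b h = go (suc (dim W)) W S id ℕₚ.≤-refl
    where
    go : ∀ k V → Sub V → V ⊆ W → dim V < k → a V ≡ b V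
    go (suc k) V SV V⊆W d<k = +ℤ-cancelʳ (∑ (properSubspacesOf V) a) (a V) (b V) (begin
      a V ℤ.+ ∑ (properSubspacesOf V) a     ≡⟨ sym (∑-subspacesOf-split SV a) ⟩
      ∑ (subspacesOf V) a                   ≡⟨ h SV V⊆W ⟩
      ∑ (subspacesOf V) b                   ≡⟨ ∑-subspacesOf-split SV b ⟩
      b V ℤ.+ ∑ (properSubspacesOf V) b     ≡⟨ cong (ℤ._+_ (b V)) (sym (∑-cong (properSubspacesOf V) below)) ⟩
      b V ℤ.+ ∑ (properSubspacesOf V) a     ∎)
      where
      open ≡-Reasoning
      below : ∀ {U} → U ∈ properSubspacesOf V → a U ≡ b U
      below {U} U∈ = let SU , U⊆V , V⊈U = ∈-proper⁻ V U∈ in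
        go k U SU (λ u∈ → V⊆W (U⊆V u∈)) (ℕₚ.<-≤-trans (dim-strict SU SV U⊆V V⊈U) (ℕₚ.≤-pred d<k))

  -- The recursion descends along dimension, with the first argument as fuel. The default 0 is never
  -- consulted while the fuel exceeds the dimension of `W`, so n + 1 units serve every subspace.
  inverseUpTo : ∀ {n} → ℕ → (VSet n → ℤ) → VSet n → ℤ
  inverseUpTo zero    g W = 0ℤ
  inverseUpTo (suc k) g W = g W ℤ.- ∑ (properSubspacesOf W) (inverseUpTo k g)

  inverseUpTo-stable : ∀ {n} j k (g : VSet n → ℤ) {W} → Sub W → dim W < j → dim W < k →
    inverseUpTo j g W ≡ inverseUpTo k g W
  inverseUpTo-stable (suc j) (suc k) g {W} S d<j d<k = cong (λ t → g W ℤ.- t)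
    (∑-cong (properSubspacesOf W) λ V∈ → let SV , V⊆W , W⊈V = ∈-proper⁻ W V∈
                                             lt = dim-strict SV S V⊆W W⊈V in
      inverseUpTo-stable j k g SV (ℕₚ.<-≤-trans lt (ℕₚ.≤-pred d<j)) (ℕₚ.<-≤-trans lt (ℕₚ.≤-pred d<k)))

  inverse : ∀ {n} → (VSet n → ℤ) → VSet n → ℤ
  inverse {n} = inverseUpTo (suc n)

  ∑-inverse : ∀ {n} (g : VSet n → ℤ) {W} → Sub W → ∑ (subspacesOf W) (inverse g) ≡ g W
  ∑-inverse {n} g {W} S = begin
    ∑ (subspacesOf W) (inverse g)                                    ≡⟨ ∑-subspacesOf-split S (inverse g) ⟩
    inverse g W ℤ.+ ∑ (properSubspacesOf W) (inverse g)              ≡⟨ cong (ℤ._+_ (inverse g W)) (∑-cong (properSubspacesOf W) stable) ⟩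
    inverse g W ℤ.+ ∑ (properSubspacesOf W) (inverseUpTo n g)        ≡⟨ cancel (g W) _ ⟩
    g W                                                              ∎
    where
    open ≡-Reasoning
    cancel : ∀ a b → a ℤ.- b ℤ.+ b ≡ a
    cancel = solve-∀
    -- A proper subspace of `W` has dimension below `n`, so one unit of fuel fewer yields the same
    -- value.
    stable : ∀ {V} → V ∈ properSubspacesOf W → inverse g V ≡ inverseUpTo n g V
    stable {V} V∈ = let SV , V⊆W , W⊈V = ∈-proper⁻ W V∈
                        lt = ℕₚ.<-≤-trans (dim-strict SV S V⊆W W⊈V) (dim-≤ S) in
      inverseUpTo-stable (suc n) n g SV (ℕₚ.m≤n⇒m≤1+n lt) lt

-- Nullity, circuits over a subspace, and the sign of the Möbius inverse.

module Nullity {q : ℕ} (F : FiniteField q) {n : ℕ} (ρ : QMatroidTheory.VSet F n → ℕ)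
  (M : QMatroidTheory.IsQMatroid F n ρ) where

  open QMatroidTheory F hiding (f; s)
  open IsQMatroid M
  open Subspaces F
  open Counting F
  open Inversion F

  nul : VSet n → ℕ
  nul = nullity ρ

  rank-≤ : ∀ {X} → Sub X → ρ X ≤ dim X
  rank-≤ {X} S = rank-≤-dim X (isSubspace⁺ S)

  rank-⊆ : ∀ {X Y} → Sub X → Sub Y → X ⊆ Y → ρ X ≤ ρ Y
  rank-⊆ {X} {Y} SX SY X⊆Y = rank-mono X Y (isSubspace⁺ SX) (isSubspace⁺ SY) (⊆ᵇ⁺ X Y X⊆Y)

  nul+rank : ∀ {X} → Sub X → nul X ℕ.+ ρ X ≡ dim X
  nul+rank S = ℕₚ.m∸n+n≡m (rank-≤ S)

  nul-zeroSub : nul zeroSub ≡ 0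
  nul-zeroSub = trans (cong (_∸ ρ zeroSub) (dim-zero n)) (ℕₚ.0∸n≡0 (ρ zeroSub))

  rank-adjoin : ∀ {X} → Sub X → ∀ v → ρ (X ⊕ line v) ≤ suc (ρ X)
  rank-adjoin {X} S v = begin
    ρ (X ⊕ line v)                                ≤⟨ ℕₚ.m≤m+n _ _ ⟩
    ρ (X ⊕ line v) ℕ.+ ρ (X ∩ˢ line v)            ≤⟨ rank-submod X (line v) (isSubspace⁺ S) (isSubspace⁺ (line-sub v)) ⟩
    ρ X ℕ.+ ρ (line v)                            ≤⟨ ℕₚ.+-monoʳ-≤ (ρ X) (ℕₚ.≤-trans (rank-≤ (line-sub v)) (dim-line-≤ v)) ⟩
    ρ X ℕ.+ 1                                     ≡⟨ ℕₚ.+-comm (ρ X) 1 ⟩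
    suc (ρ X)                                     ∎
    where open ℕₚ.≤-Reasoning

  record Hyperplane (H W : VSet n) : Set where
    field
      subH  : Sub H
      subW  : Sub W
      H⊆W   : H ⊆ W
      codim : dim W ≡ suc (dim H)

    W⊈H : ¬ (W ⊆ H)
    W⊈H W⊆H = ℕₚ.<⇒≱ (ℕₚ.≤-reflexive (sym codim)) (dim-mono subW subH W⊆H)

    rank-step : ρ W ≤ suc (ρ H)
    rank-step = let v , v∈W , v∉H = ⊈-witness W⊈H in
      subst (λ Y → ρ Y ≤ suc (ρ H)) (hyperplane-⊕ subH subW H⊆W codim v∈W v∉H) (rank-adjoin subH v)

    -- Stated without subtraction, so that the lemmas below follow by cancellation. In effect,
    -- passing from a hyperplane to the whole raises exactly one of rank and nullity, by one.
    balance : nul W ℕ.+ ρ W ≡ suc (nul H) ℕ.+ ρ H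
    balance = trans (nul+rank subW) (trans codim (cong suc (sym (nul+rank subH))))

    nul-≤ : nul H ≤ nul W
    nul-≤ = ℕₚ.≤-pred (ℕₚ.+-cancelʳ-≤ (ρ H) (suc (nul H)) (suc (nul W)) (begin
      suc (nul H) ℕ.+ ρ H     ≡⟨ sym balance ⟩
      nul W ℕ.+ ρ W           ≤⟨ ℕₚ.+-monoʳ-≤ (nul W) rank-step ⟩
      nul W ℕ.+ suc (ρ H)     ≡⟨ ℕₚ.+-suc (nul W) (ρ H) ⟩
      suc (nul W) ℕ.+ ρ H     ∎))
      where open ℕₚ.≤-Reasoning

    nul-≤-suc : nul W ≤ suc (nul H)
    nul-≤-suc = ℕₚ.+-cancelʳ-≤ (ρ H) (nul W) (suc (nul H)) (begin
      nul W ℕ.+ ρ H           ≤⟨ ℕₚ.+-monoʳ-≤ (nul W) (rank-⊆ subH subW H⊆W) ⟩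
      nul W ℕ.+ ρ W           ≡⟨ balance ⟩
      suc (nul H) ℕ.+ ρ H     ∎)
      where open ℕₚ.≤-Reasoning

    rank-≡⇒nul-< : ρ W ≤ ρ H → nul H < nul W
    rank-≡⇒nul-< ρW≤ρH = ℕₚ.+-cancelʳ-≤ (ρ H) (suc (nul H)) (nul W) (begin
      suc (nul H) ℕ.+ ρ H     ≡⟨ sym balance ⟩
      nul W ℕ.+ ρ W           ≤⟨ ℕₚ.+-monoʳ-≤ (nul W) ρW≤ρH ⟩
      nul W ℕ.+ ρ H           ∎)
      where open ℕₚ.≤-Reasoning

    nul-<⇒rank-≡ : nul H < nul W → ρ W ≤ ρ H
    nul-<⇒rank-≡ lt = ℕₚ.+-cancelˡ-≤ (suc (nul H)) (ρ W) (ρ H) (begin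
      suc (nul H) ℕ.+ ρ W     ≤⟨ ℕₚ.+-monoˡ-≤ (ρ W) lt ⟩
      nul W ℕ.+ ρ W           ≡⟨ balance ⟩
      suc (nul H) ℕ.+ ρ H     ∎)
      where open ℕₚ.≤-Reasoning

  open Hyperplane public

  hyperplane : ∀ {X W} → Sub X → Sub W → X ⊆ W → ¬ (W ⊆ X) → ∃ λ H → X ⊆ H × Hyperplane H W
  hyperplane SX SW X⊆W W⊈X =
    let H , SH , X⊆H , H⊆W , d = hyperplane-above SX SW X⊆W W⊈X
    in H , (λ {v} → X⊆H {v}) , record { subH = SH ; subW = SW ; H⊆W = H⊆W ; codim = d }

  section : ∀ {H W C} → Hyperplane H W → Sub C → C ⊆ W → ¬ (C ⊆ H) → Hyperplane (C ∩ˢ H) C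
  section hyp SC C⊆W C⊈H = record
    { subH = ∩-sub SC (subH hyp)
    ; subW = SC
    ; H⊆W = ∩-⊆ˡ
    ; codim = dim-hyperplane-section (subH hyp) (subW hyp) SC (H⊆W hyp) (codim hyp) C⊆W C⊈H
    }

  -- Descend from `Y` to `X` through hyperplanes; `nul-≤` covers each step.
  nul-mono : ∀ {X Y} → Sub X → Sub Y → X ⊆ Y → nul X ≤ nul Y
  nul-mono {X} {Y} SX SY X⊆Y = go (suc (dim Y)) Y SY X⊆Y ℕₚ.≤-refl
    where
    go : ∀ k Y → Sub Y → X ⊆ Y → dim Y < k → nul X ≤ nul Y
    go (suc k) Y SY X⊆Y d<k = decide (Y ⊆? X)
      where
      decide : Dec (Y ⊆ X) → nul X ≤ nul Y
      decide (yes Y⊆X) = ℕₚ.≤-reflexive (cong nul (⊆-antisym X⊆Y Y⊆X))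
      decide (no Y⊈X) =
        let H , X⊆H , hyp = hyperplane SX SY X⊆Y Y⊈X
        in ℕₚ.≤-trans (go k H (subH hyp) X⊆H (subst (_≤ k) (codim hyp) (ℕₚ.≤-pred d<k))) (nul-≤ hyp)

  -- Submodularity of the rank for C and H, whose sum is W.
  nul-drop : ∀ {H W C} → Hyperplane H W → Sub C → C ⊆ W → ¬ (C ⊆ H) → nul (C ∩ˢ H) < nul C → nul H < nul W
  nul-drop {H} {W} {C} hyp SC C⊆W C⊈H lt = rank-≡⇒nul-< hyp (ℕₚ.+-cancelʳ-≤ (ρ (C ∩ˢ H)) (ρ W) (ρ H) (begin
    ρ W ℕ.+ ρ (C ∩ˢ H)              ≡⟨ cong (λ Y → ρ Y ℕ.+ ρ (C ∩ˢ H)) (sym C⊕H≡W) ⟩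
    ρ (C ⊕ H) ℕ.+ ρ (C ∩ˢ H)        ≤⟨ rank-submod C H (isSubspace⁺ SC) (isSubspace⁺ (subH hyp)) ⟩
    ρ C ℕ.+ ρ H                     ≤⟨ ℕₚ.+-monoˡ-≤ (ρ H) (nul-<⇒rank-≡ (section hyp SC C⊆W C⊈H) lt) ⟩
    ρ (C ∩ˢ H) ℕ.+ ρ H              ≡⟨ ℕₚ.+-comm (ρ (C ∩ˢ H)) (ρ H) ⟩
    ρ H ℕ.+ ρ (C ∩ˢ H)              ∎))
    where
    open ℕₚ.≤-Reasoning
    S⊕ : Sub (C ⊕ H)
    S⊕ = ⊕-sub SC (subH hyp)
    H<C⊕H : dim H < dim (C ⊕ H)
    H<C⊕H = dim-strict (subH hyp) S⊕ (⊆-⊕ʳ SC) (λ h → C⊈H (λ v∈ → h (⊆-⊕ˡ (subH hyp) v∈)))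
    C⊕H≡W : C ⊕ H ≡ W
    C⊕H≡W = ≡-by-dim S⊕ (subW hyp) (⊕-least (subW hyp) C⊆W (H⊆W hyp)) (subst (_≤ dim (C ⊕ H)) (sym (codim hyp)) H<C⊕H)

  -- The circuits of the contraction by Z, seen as subspaces containing Z.
  smaller : VSet n → VSet n → VSet n → Bool
  smaller Z C Y = (Y ⊂ᵇ C) ∧ ((Z ⊆ᵇ Y) ∧ (nul Y ℕ.≡ᵇ suc (nul Z)))

  isCircuitAbove : VSet n → VSet n → Bool
  isCircuitAbove Z C = ((Z ⊆ᵇ C) ∧ (nul C ℕ.≡ᵇ suc (nul Z))) ∧ not (any (smaller Z C) (allSubspaces n))

  circuitsAbove : VSet n → List (VSet n)
  circuitsAbove Z = filterᵇ (isCircuitAbove Z) (allSubspaces n)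

  record CircuitAbove (Z C : VSet n) : Set where
    field
      subC    : Sub C
      Z⊆C     : Z ⊆ C
      nul-C   : nul C ≡ suc (nul Z)
      minimal : ∀ {Y} → Sub Y → Z ⊆ Y → Y ⊆ C → nul Y ≡ suc (nul Z) → C ⊆ Y

  open CircuitAbove public

  ∈-circuitsAbove⁻ : ∀ {Z C} → C ∈ circuitsAbove Z → CircuitAbove Z C
  ∈-circuitsAbove⁻ {Z} {C} C∈ = record
    { subC = ∈-subspaces⁻ (proj₁ split)
    ; Z⊆C = ⊆ᵇ⁻ Z C (proj₁ above)
    ; nul-C = ℕₚ.≡ᵇ⇒≡ (nul C) (suc (nul Z)) (proj₂ above)
    ; minimal = λ {Y} SY Z⊆Y Y⊆C eq {v} v∈ → minimal′ Y SY Z⊆Y Y⊆C eq (C ⊆? Y) v∈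
    }
    where
    split = filterᵇ⁻ (isCircuitAbove Z) (allSubspaces n) C∈
    parts = ∧⁻ {(Z ⊆ᵇ C) ∧ (nul C ℕ.≡ᵇ suc (nul Z))} {not (any (smaller Z C) (allSubspaces n))} (proj₂ split)
    above = ∧⁻ {Z ⊆ᵇ C} {nul C ℕ.≡ᵇ suc (nul Z)} (proj₁ parts)
    minimal′ : ∀ Y → Sub Y → Z ⊆ Y → Y ⊆ C → nul Y ≡ suc (nul Z) → Dec (C ⊆ Y) → C ⊆ Y
    minimal′ Y SY Z⊆Y Y⊆C eq (yes C⊆Y) = C⊆Y
    minimal′ Y SY Z⊆Y Y⊆C eq (no C⊈Y)  = ⊥-elim (not⁻ {any (smaller Z C) (allSubspaces n)} (proj₂ parts)
      (any-T⁺ (smaller Z C) (allSubspaces n) (∈-subspaces⁺ SY)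
        (∧⁺ {Y ⊂ᵇ C} {(Z ⊆ᵇ Y) ∧ (nul Y ℕ.≡ᵇ suc (nul Z))} (⊂ᵇ⁺ Y C Y⊆C C⊈Y)
          (∧⁺ {Z ⊆ᵇ Y} {nul Y ℕ.≡ᵇ suc (nul Z)} (⊆ᵇ⁺ Z Y Z⊆Y) (ℕₚ.≡⇒≡ᵇ (nul Y) (suc (nul Z)) eq)))))

  circuitsAbove-unique : ∀ Z → Unique (circuitsAbove Z)
  circuitsAbove-unique Z = filterᵇ-unique (isCircuitAbove Z) (allSubspaces n) (subspaces-unique n)

  circuitAbove-exists : ∀ {Z Y} → Sub Y → Z ⊆ Y → nul Y ≡ suc (nul Z) → ∃ λ C → C ∈ circuitsAbove Z × C ⊆ Y
  circuitAbove-exists {Z} {Y} SY Z⊆Y eq = go (suc (dim Y)) Y SY Z⊆Y eq ℕₚ.≤-refl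
    where
    go : ∀ k Y → Sub Y → Z ⊆ Y → nul Y ≡ suc (nul Z) → dim Y < k → ∃ λ C → C ∈ circuitsAbove Z × C ⊆ Y
    go (suc k) Y SY Z⊆Y eq d<k = decide (T? (any (smaller Z Y) (allSubspaces n)))
      where
      decide : Dec (T (any (smaller Z Y) (allSubspaces n))) → ∃ λ C → C ∈ circuitsAbove Z × C ⊆ Y
      decide (no none) = Y , filterᵇ⁺ (isCircuitAbove Z) (allSubspaces n) (∈-subspaces⁺ SY)
        (∧⁺ {(Z ⊆ᵇ Y) ∧ (nul Y ℕ.≡ᵇ suc (nul Z))} {not (any (smaller Z Y) (allSubspaces n))}
          (∧⁺ {Z ⊆ᵇ Y} {nul Y ℕ.≡ᵇ suc (nul Z)} (⊆ᵇ⁺ Z Y Z⊆Y) (ℕₚ.≡⇒≡ᵇ (nul Y) (suc (nul Z)) eq)) (not⁺ none)) , id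
      decide (yes some) =
        let Y′ , Y′∈ , h = any-T⁻ (smaller Z Y) (allSubspaces n) some
            h₁ , h₂ = ∧⁻ {Y′ ⊂ᵇ Y} {(Z ⊆ᵇ Y′) ∧ (nul Y′ ℕ.≡ᵇ suc (nul Z))} h
            h₃ , h₄ = ∧⁻ {Z ⊆ᵇ Y′} {nul Y′ ℕ.≡ᵇ suc (nul Z)} h₂
            Y′⊆Y , Y⊈Y′ = ⊂ᵇ⁻ Y′ Y h₁
            SY′ = ∈-subspaces⁻ Y′∈
            C , C∈ , C⊆Y′ = go k Y′ SY′ (⊆ᵇ⁻ Z Y′ h₃) (ℕₚ.≡ᵇ⇒≡ (nul Y′) (suc (nul Z)) h₄)
              (ℕₚ.<-≤-trans (dim-strict SY′ SY Y′⊆Y Y⊈Y′) (ℕₚ.≤-pred d<k))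
        in C , C∈ , λ v∈ → Y′⊆Y (C⊆Y′ v∈)

  module _ {Z H W C : VSet n} (hyp : Hyperplane H W) (Z⊆H : Z ⊆ H) (circ : CircuitAbove Z C) (C⊆W : C ⊆ W) (C⊈H : ¬ (C ⊆ H)) where

    -- By minimality the proper section `C ∩ˢ H`, which still contains `Z`, has smaller nullity than
    -- `C`; submodularity transfers this drop to `H` and `W`.
    circuitAbove-drop : nul H < nul W
    circuitAbove-drop = nul-drop hyp (subC circ) C⊆W C⊈H
      (ℕₚ.≤∧≢⇒< (nul-mono SC∩H (subC circ) ∩-⊆ˡ)
        (λ eq → C⊈H (λ v∈ → ∩-⊆ʳ (minimal circ SC∩H (λ z∈ → ∈-∩⁺ (Z⊆C circ z∈) (Z⊆H z∈)) ∩-⊆ˡ (trans eq (nul-C circ)) v∈))))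
      where
      SC∩H : Sub (C ∩ˢ H)
      SC∩H = ∩-sub (subC circ) (subH hyp)

  -- If `C` were not inside `D`, take a hyperplane `K` of `C ⊕ D` containing `D`. The circuit `C`
  -- crosses it, so nul K < nul (C ⊕ D) ≤ nul Y = nul D ≤ nul K, which is absurd.
  circuitAbove-⊆ : ∀ {Z Y C D} → Sub Y → nul Y ≡ suc (nul Z) →
    CircuitAbove Z C → C ⊆ Y → CircuitAbove Z D → D ⊆ Y → C ⊆ D
  circuitAbove-⊆ {Z} {Y} {C} {D} SY nulY cC C⊆Y cD D⊆Y {v} v∈C = decide (C ⊆? D) v∈C
    where
    decide : Dec (C ⊆ D) → C ⊆ D
    decide (yes C⊆D) = C⊆D
    decide (no C⊈D)  = ⊥-elim (contradict (hyperplane (subC cD) S⊕ (⊆-⊕ʳ (subC cC)) (λ h → C⊈D (λ v∈ → h (⊆-⊕ˡ (subC cD) v∈)))))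
      where
      S⊕ : Sub (C ⊕ D)
      S⊕ = ⊕-sub (subC cC) (subC cD)
      contradict : (∃ λ K → D ⊆ K × Hyperplane K (C ⊕ D)) → ⊥
      contradict (K , D⊆K , hyp) = ℕₚ.<⇒≱
        (circuitAbove-drop hyp (λ z∈ → D⊆K (Z⊆C cD z∈)) cC (⊆-⊕ˡ (subC cD)) (λ C⊆K → W⊈H hyp (⊕-least (subH hyp) C⊆K D⊆K)))
        (begin
          nul (C ⊕ D)     ≤⟨ nul-mono S⊕ SY (⊕-least SY C⊆Y D⊆Y) ⟩
          nul Y           ≡⟨ trans nulY (sym (nul-C cD)) ⟩
          nul D           ≤⟨ nul-mono (subC cD) (subH hyp) D⊆K ⟩
          nul K           ∎)
        where open ℕₚ.≤-Reasoning

  circuitAbove-≡ : ∀ {Z Y C D} → Sub Y → nul Y ≡ suc (nul Z) →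
    CircuitAbove Z C → C ⊆ Y → CircuitAbove Z D → D ⊆ Y → C ≡ D
  circuitAbove-≡ SY nulY cC C⊆Y cD D⊆Y =
    ⊆-antisym (circuitAbove-⊆ SY nulY cC C⊆Y cD D⊆Y) (circuitAbove-⊆ SY nulY cD D⊆Y cC C⊆Y)

  -- The independent subspaces of the contraction by Z.
  indicator : VSet n → VSet n → ℤ
  indicator Z W = 𝟙 ((Z ⊆ᵇ W) ∧ (nul W ℕ.≡ᵇ nul Z))

  indicator-1 : ∀ {Z W} → Z ⊆ W → nul W ≡ nul Z → indicator Z W ≡ 1ℤ
  indicator-1 {Z} {W} Z⊆W eq = 𝟙-true (∧⁺ {Z ⊆ᵇ W} {nul W ℕ.≡ᵇ nul Z} (⊆ᵇ⁺ Z W Z⊆W) (ℕₚ.≡⇒≡ᵇ (nul W) (nul Z) eq))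

  indicator-⊈ : ∀ {Z W} → ¬ (Z ⊆ W) → indicator Z W ≡ 0ℤ
  indicator-⊈ {Z} {W} Z⊈W = 𝟙-false (λ h → Z⊈W (⊆ᵇ⁻ Z W (proj₁ (∧⁻ {Z ⊆ᵇ W} {nul W ℕ.≡ᵇ nul Z} h))))

  indicator-≢ : ∀ {Z W} → nul W ≢ nul Z → indicator Z W ≡ 0ℤ
  indicator-≢ {Z} {W} neq = 𝟙-false (λ h → neq (ℕₚ.≡ᵇ⇒≡ (nul W) (nul Z) (proj₂ (∧⁻ {Z ⊆ᵇ W} {nul W ℕ.≡ᵇ nul Z} h))))

  -- Keeping the whole lattice as domain avoids the quotient by `Z`: at subspaces that do not
  -- contain `Z`, both `indicator Z` and this inverse are 0.
  relMöbius : VSet n → VSet n → ℤ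
  relMöbius Z = inverse (indicator Z)

  -- Deleting the hyperplane H: a subspace Y above Z is dependent with Y ∩ H independent (over Z)
  -- exactly when Y has nullity one over Z and its unique circuit is not contained in H.
  module Deletion {Z H W : VSet n} (SZ : Sub Z) (hyp : Hyperplane H W) (Z⊆H : Z ⊆ H) where

    crosses : VSet n → Bool
    crosses C = (C ⊆ᵇ W) ∧ not (C ⊆ᵇ H)

    crossing : List (VSet n)
    crossing = filterᵇ crosses (circuitsAbove Z)

    crossing-unique : Unique crossing
    crossing-unique = filterᵇ-unique crosses (circuitsAbove Z) (circuitsAbove-unique Z)

    ∈-crossing⁻ : ∀ {C} → C ∈ crossing → CircuitAbove Z C × C ⊆ W × ¬ (C ⊆ H)
    ∈-crossing⁻ {C} C∈ =
      let p , r = filterᵇ⁻ crosses (circuitsAbove Z) C∈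
          r₁ , r₂ = ∧⁻ {C ⊆ᵇ W} {not (C ⊆ᵇ H)} r
      in ∈-circuitsAbove⁻ p , (λ {v} → ⊆ᵇ⁻ C W r₁ {v}) , λ C⊆H → not⁻ {C ⊆ᵇ H} r₂ (⊆ᵇ⁺ C H C⊆H)

    ∈-crossing⁺ : ∀ {C} → C ∈ circuitsAbove Z → C ⊆ W → ¬ (C ⊆ H) → C ∈ crossing
    ∈-crossing⁺ {C} C∈ C⊆W C⊈H = filterᵇ⁺ crosses (circuitsAbove Z) C∈
      (∧⁺ {C ⊆ᵇ W} {not (C ⊆ᵇ H)} (⊆ᵇ⁺ C W C⊆W) (not⁺ (λ h → C⊈H (⊆ᵇ⁻ C H h))))

    module Pointwise {Y : VSet n} (SY : Sub Y) (Y⊆W : Y ⊆ W) where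

      SY∩H : Sub (Y ∩ˢ H)
      SY∩H = ∩-sub SY (subH hyp)

      nul-Y-≤ : nul Y ≤ suc (nul (Y ∩ˢ H))
      nul-Y-≤ = decide (Y ⊆? H)
        where
        decide : Dec (Y ⊆ H) → nul Y ≤ suc (nul (Y ∩ˢ H))
        decide (yes Y⊆H) = ℕₚ.m≤n⇒m≤1+n (nul-mono SY SY∩H (λ v∈ → ∈-∩⁺ v∈ (Y⊆H v∈)))
        decide (no Y⊈H)  = nul-≤-suc (section hyp SY Y⊆W Y⊈H)

      no-crossing : nul Y ≢ suc (nul Z) → ∑ crossing (λ C → indicator C Y) ≡ 0ℤ
      no-crossing neq = ∑-vanish crossing λ {C} C∈ → indicator-≢ {C} {Y} λ eq → neq (trans eq (nul-C (proj₁ (∈-crossing⁻ C∈))))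

      identity : indicator Z Y ℤ.+ ∑ crossing (λ C → indicator C Y) ≡ indicator Z (Y ∩ˢ H)
      identity = decide (Z ⊆? Y)
        where
        decide : Dec (Z ⊆ Y) → indicator Z Y ℤ.+ ∑ crossing (λ C → indicator C Y) ≡ indicator Z (Y ∩ˢ H)
        decide (no Z⊈Y) = trans (cong₂ ℤ._+_ (indicator-⊈ {Z} {Y} Z⊈Y) (∑-vanish crossing λ {C} C∈ →
            indicator-⊈ {C} {Y} (λ C⊆Y → Z⊈Y (λ z∈ → C⊆Y (Z⊆C (proj₁ (∈-crossing⁻ C∈)) z∈)))))
          (sym (indicator-⊈ {Z} {Y ∩ˢ H} (λ h → Z⊈Y (λ z∈ → ∩-⊆ˡ (h z∈)))))
        decide (yes Z⊆Y) = compare (nul Y ℕₚ.≟ nul Z) (nul Y ℕₚ.≟ suc (nul Z)) (nul (Y ∩ˢ H) ℕₚ.≟ nul Z)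
          where
          Z⊆Y∩H : Z ⊆ Y ∩ˢ H
          Z⊆Y∩H z∈ = ∈-∩⁺ (Z⊆Y z∈) (Z⊆H z∈)
          lower : nul Z ≤ nul (Y ∩ˢ H)
          lower = nul-mono SZ SY∩H Z⊆Y∩H
          upper : nul (Y ∩ˢ H) ≤ nul Y
          upper = nul-mono SY∩H SY ∩-⊆ˡ
          compare : Dec (nul Y ≡ nul Z) → Dec (nul Y ≡ suc (nul Z)) → Dec (nul (Y ∩ˢ H) ≡ nul Z) →
            indicator Z Y ℤ.+ ∑ crossing (λ C → indicator C Y) ≡ indicator Z (Y ∩ˢ H)
          compare (yes eq) _ _ = trans
            (cong₂ ℤ._+_ (indicator-1 {Z} {Y} Z⊆Y eq) (no-crossing (λ eq′ → ℕₚ.1+n≢n (trans (sym eq′) eq))))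
            (sym (indicator-1 {Z} {Y ∩ˢ H} Z⊆Y∩H (ℕₚ.≤-antisym (subst (nul (Y ∩ˢ H) ≤_) eq upper) lower)))
          -- Cutting with `H` lowers the nullity by at most one, so nullity two or more over `Z`
          -- cannot disappear.
          compare (no neq) (no neq′) (yes eq∩) = ⊥-elim (neq (ℕₚ.≤-antisym
            (ℕₚ.≤-pred (ℕₚ.≤∧≢⇒< (subst (λ t → nul Y ≤ suc t) eq∩ nul-Y-≤) neq′)) (ℕₚ.≤-trans lower upper)))
          compare (no neq) (no neq′) (no neq∩) = trans
            (cong₂ ℤ._+_ (indicator-≢ {Z} {Y} neq) (no-crossing neq′)) (sym (indicator-≢ {Z} {Y ∩ˢ H} neq∩))
          -- The circuit inside `Y` crosses `H`, since otherwise it would lie in `Y ∩ˢ H`, which is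
          -- independent over `Z`. Its term 1 makes up for the vanishing `indicator Z Y`.
          compare (no neq) (yes eq) (yes eq∩) = unique-crossing (circuitAbove-exists SY Z⊆Y eq)
            where
            unique-crossing : (∃ λ C → C ∈ circuitsAbove Z × C ⊆ Y) →
              indicator Z Y ℤ.+ ∑ crossing (λ C → indicator C Y) ≡ indicator Z (Y ∩ˢ H)
            unique-crossing (C , C∈ , C⊆Y) = trans
              (cong₂ ℤ._+_ (indicator-≢ {Z} {Y} neq) (trans
                (∑-single (λ C → indicator C Y) crossing-unique (∈-crossing⁺ C∈ (λ v∈ → Y⊆W (C⊆Y v∈)) C⊈H) others)
                (indicator-1 {C} {Y} C⊆Y (trans eq (sym (nul-C cC))))))
              (sym (indicator-1 {Z} {Y ∩ˢ H} Z⊆Y∩H eq∩))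
              where
              cC : CircuitAbove Z C
              cC = ∈-circuitsAbove⁻ C∈
              C⊈H : ¬ (C ⊆ H)
              C⊈H C⊆H = ℕₚ.1+n≰n (subst (_≤ nul Z) (nul-C cC)
                (subst (nul C ≤_) eq∩ (nul-mono (subC cC) SY∩H (λ v∈ → ∈-∩⁺ (C⊆Y v∈) (C⊆H v∈)))))
              others : ∀ {D} → D ∈ crossing → D ≢ C → indicator D Y ≡ 0ℤ
              others {D} D∈ D≢C = indicator-⊈ {D} {Y} λ D⊆Y → D≢C (circuitAbove-≡ SY eq (proj₁ (∈-crossing⁻ D∈)) D⊆Y cC C⊆Y)
          -- Here `Y ∩ˢ H` already contains a circuit over `Z`; by uniqueness it is the only one in
          -- `Y`, so no crossing circuit lies in `Y`.
          compare (no neq) (yes eq) (no neq∩) = trans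
            (cong₂ ℤ._+_ (indicator-≢ {Z} {Y} neq) (∑-vanish crossing λ {D} D∈ → outside D∈ (circuitAbove-exists SY∩H Z⊆Y∩H nul∩)))
            (sym (indicator-≢ {Z} {Y ∩ˢ H} neq∩))
            where
            nul∩ : nul (Y ∩ˢ H) ≡ suc (nul Z)
            nul∩ = ℕₚ.≤-antisym (subst (nul (Y ∩ˢ H) ≤_) eq upper) (ℕₚ.≤∧≢⇒< lower (λ e → neq∩ (sym e)))
            outside : ∀ {D} → D ∈ crossing → (∃ λ C → C ∈ circuitsAbove Z × C ⊆ Y ∩ˢ H) → indicator D Y ≡ 0ℤ
            outside {D} D∈ (C , C∈ , C⊆) = indicator-⊈ {D} {Y} λ D⊆Y → proj₂ (proj₂ (∈-crossing⁻ D∈))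
              (λ v∈ → ∩-⊆ʳ (C⊆ (circuitAbove-⊆ SY eq (proj₁ (∈-crossing⁻ D∈)) D⊆Y (∈-circuitsAbove⁻ C∈) (λ w∈ → ∩-⊆ˡ (C⊆ w∈)) v∈)))

    -- Chosen because the subspaces of `Y` inside `H` are those of `Y ∩ˢ H`, so its sums are values
    -- of the indicator there, while at `W` itself it is 0.
    restricted : VSet n → ℤ
    restricted V = 𝟙 (V ⊆ᵇ H) ℤ.* relMöbius Z V

    expanded : VSet n → ℤ
    expanded V = relMöbius Z V ℤ.+ ∑ crossing (λ C → relMöbius C V)

    ∑-expanded : ∀ {Y} → Sub Y → ∑ (subspacesOf Y) expanded ≡ indicator Z Y ℤ.+ ∑ crossing (λ C → indicator C Y)
    ∑-expanded {Y} SY = begin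
      ∑ (subspacesOf Y) expanded
        ≡⟨ ∑-+ (subspacesOf Y) (relMöbius Z) (λ V → ∑ crossing (λ C → relMöbius C V)) ⟩
      ∑ (subspacesOf Y) (relMöbius Z) ℤ.+ ∑ (subspacesOf Y) (λ V → ∑ crossing (λ C → relMöbius C V))
        ≡⟨ cong₂ ℤ._+_ (∑-inverse (indicator Z) SY) (∑-comm (subspacesOf Y) crossing (λ V C → relMöbius C V)) ⟩
      indicator Z Y ℤ.+ ∑ crossing (λ C → ∑ (subspacesOf Y) (relMöbius C))
        ≡⟨ cong (ℤ._+_ (indicator Z Y)) (∑-cong crossing (λ {C} _ → ∑-inverse (indicator C) SY)) ⟩
      indicator Z Y ℤ.+ ∑ crossing (λ C → indicator C Y) ∎
      where open ≡-Reasoning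

    ∑-restricted : ∀ {Y} → Sub Y → ∑ (subspacesOf Y) restricted ≡ indicator Z (Y ∩ˢ H)
    ∑-restricted {Y} SY = begin
      ∑ (subspacesOf Y) restricted
        ≡⟨ sym (∑-filter (λ V → V ⊆ᵇ H) (subspacesOf Y) (relMöbius Z)) ⟩
      ∑ (filterᵇ (λ V → V ⊆ᵇ H) (subspacesOf Y)) (relMöbius Z)
        ≡⟨ ∑-set (relMöbius Z) (filterᵇ-unique (λ V → V ⊆ᵇ H) (subspacesOf Y) (subspacesOf-unique Y)) (subspacesOf-unique (Y ∩ˢ H)) to from ⟩
      ∑ (subspacesOf (Y ∩ˢ H)) (relMöbius Z)
        ≡⟨ ∑-inverse (indicator Z) (∩-sub SY (subH hyp)) ⟩
      indicator Z (Y ∩ˢ H) ∎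
      where
      open ≡-Reasoning
      to : ∀ {V} → V ∈ filterᵇ (λ V → V ⊆ᵇ H) (subspacesOf Y) → V ∈ subspacesOf (Y ∩ˢ H)
      to {V} V∈ = let p , r = filterᵇ⁻ (λ V → V ⊆ᵇ H) (subspacesOf Y) V∈
                      SV , V⊆Y = ∈-subspacesOf⁻ Y p
                  in ∈-subspacesOf⁺ SV (λ v∈ → ∈-∩⁺ (V⊆Y v∈) (⊆ᵇ⁻ V H r v∈))
      from : ∀ {V} → V ∈ subspacesOf (Y ∩ˢ H) → V ∈ filterᵇ (λ V → V ⊆ᵇ H) (subspacesOf Y)
      from {V} V∈ = let SV , V⊆ = ∈-subspacesOf⁻ (Y ∩ˢ H) V∈
                    in filterᵇ⁺ (λ V → V ⊆ᵇ H) (subspacesOf Y) (∈-subspacesOf⁺ SV (λ v∈ → ∩-⊆ˡ (V⊆ v∈))) (⊆ᵇ⁺ V H (λ v∈ → ∩-⊆ʳ (V⊆ v∈)))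

    -- By `Pointwise.identity`, `expanded` and `restricted` have equal sums over the subspaces of
    -- every subspace of `W`. Hence they agree at `W`, where the latter vanishes.
    expansion : relMöbius Z W ≡ ℤ.- ∑ crossing (λ C → relMöbius C W)
    expansion = +ℤ-inverseˡ-unique (relMöbius Z W) (∑ crossing (λ C → relMöbius C W)) (trans
      (zeta-injective (subW hyp) expanded restricted
        (λ SV V⊆W → trans (∑-expanded SV) (trans (Pointwise.identity SV V⊆W) (sym (∑-restricted SV)))))
      (cong (ℤ._* relMöbius Z W) (𝟙-false (λ h → W⊈H hyp (⊆ᵇ⁻ W H h)))))

  -- Between `Z` and `W` the nullity is constant, so below `W` the indicator only tests for
  -- containing `Z`; the inverse of that test is the delta function at `Z`.
  relMöbius-base : ∀ {Z W} → Sub Z → Sub W → nul W ≡ nul Z → relMöbius Z W ≡ 𝟙 (W ≡ˢ Z)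
  relMöbius-base {Z} {W} SZ SW eq = zeta-injective SW (relMöbius Z) (λ V → 𝟙 (V ≡ˢ Z)) λ {Y} SY Y⊆W →
    trans (∑-inverse (indicator Z) SY) (decide Y SY Y⊆W (Z ⊆? Y))
    where
    decide : ∀ Y → Sub Y → Y ⊆ W → Dec (Z ⊆ Y) → indicator Z Y ≡ ∑ (subspacesOf Y) (λ V → 𝟙 (V ≡ˢ Z))
    decide Y SY Y⊆W (yes Z⊆Y) = trans
      (indicator-1 {Z} {Y} Z⊆Y (ℕₚ.≤-antisym (subst (nul Y ≤_) eq (nul-mono SY SW Y⊆W)) (nul-mono SZ SY Z⊆Y)))
      (sym (trans (∑-single (λ V → 𝟙 (V ≡ˢ Z)) (subspacesOf-unique Y) (∈-subspacesOf⁺ SZ Z⊆Y)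
        (λ {V} _ V≢Z → 𝟙-false (λ h → V≢Z (≡ˢ⁻ V Z h)))) (𝟙-true (≡ˢ⁺ Z Z refl))))
    decide Y SY Y⊆W (no Z⊈Y) = trans (indicator-⊈ {Z} {Y} Z⊈Y)
      (sym (∑-vanish (subspacesOf Y) λ {V} V∈ → 𝟙-false (λ h → Z⊈Y
        (λ {v} z∈ → proj₂ (∈-subspacesOf⁻ Y V∈) (subst (v ∈ˢ_) (sym (≡ˢ⁻ V Z h)) z∈)))))

  -- `Z` varies in the induction: each circuit `C` in `expansion` becomes the new base, over which
  -- `W` has nullity `k`, and the minus sign there accounts for the change from k + 1 to `k`.
  relMöbius-sign : ∀ k {Z W} → Sub Z → Sub W → Z ⊆ W → nul W ≡ nul Z ℕ.+ k → 0ℤ ℤ.≤ negOnePow k ℤ.* relMöbius Z W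
  relMöbius-sign zero {Z} {W} SZ SW Z⊆W eq = subst (0ℤ ℤ.≤_)
    (sym (trans (ℤₚ.*-identityˡ _) (relMöbius-base SZ SW (trans eq (ℕₚ.+-identityʳ _))))) (𝟙-nonneg (W ≡ˢ Z))
    where
    𝟙-nonneg : ∀ b → 0ℤ ℤ.≤ 𝟙 b
    𝟙-nonneg true  = ℤ.+≤+ z≤n
    𝟙-nonneg false = ℤ.+≤+ z≤n
  relMöbius-sign (suc k) {Z} {W} SZ SW Z⊆W eq = expand (hyperplane SZ SW Z⊆W W⊈Z)
    where
    W⊈Z : ¬ (W ⊆ Z)
    W⊈Z W⊆Z = ℕₚ.m≢1+m+n (nul Z) (trans (sym (cong nul (⊆-antisym W⊆Z Z⊆W))) (trans eq (ℕₚ.+-suc (nul Z) k)))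
    expand : (∃ λ H → Z ⊆ H × Hyperplane H W) → 0ℤ ℤ.≤ negOnePow (suc k) ℤ.* relMöbius Z W
    expand (H , Z⊆H , hyp) = subst (0ℤ ℤ.≤_) (sym rewritten) (∑-nonneg crossing λ {C} C∈ → summand C (∈-crossing⁻ C∈))
      where
      open Deletion SZ hyp Z⊆H
      rewritten : negOnePow (suc k) ℤ.* relMöbius Z W ≡ ∑ crossing (λ C → negOnePow k ℤ.* relMöbius C W)
      rewritten = trans (cong (negOnePow (suc k) ℤ.*_) expansion)
        (trans (neg*neg (negOnePow k) _) (sym (∑-*ˡ crossing (negOnePow k) (λ C → relMöbius C W))))
        where
        neg*neg : ∀ a b → ℤ.- a ℤ.* ℤ.- b ≡ a ℤ.* b
        neg*neg = solve-∀
      summand : ∀ C → CircuitAbove Z C × C ⊆ W × ¬ (C ⊆ H) → 0ℤ ℤ.≤ negOnePow k ℤ.* relMöbius C W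
      summand C (circ , C⊆W , _) = relMöbius-sign k (subC circ) SW C⊆W
        (trans eq (trans (ℕₚ.+-suc (nul Z) k) (cong (ℕ._+ k) (sym (nul-C circ)))))

-- Sums over ranges, and alternating sums over sublists.

∑-upTo-suc : ∀ n (f : ℕ → ℤ) → ∑ (upTo (suc n)) f ≡ f 0 ℤ.+ ∑ (upTo n) (f ∘ suc)
∑-upTo-suc n f = cong (ℤ._+_ (f 0)) (trans (cong (λ xs → ∑ xs f) (sym (Listₚ.map-upTo suc n))) (∑-map suc (upTo n) f))

∑-range-0 : ∀ n (f : ℕ → ℤ) → ∑ (range 0 n) f ≡ ∑ (upTo (suc n)) f
∑-range-0 n f = trans (∑-map (ℕ._+ 0) (upTo (suc n)) f) (∑-cong (upTo (suc n)) (λ {k} _ → cong f (ℕₚ.+-identityʳ k)))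

∑-pick : ∀ {ks : List ℕ} (k : ℕ) (g : ℕ → ℤ) → Unique ks → k ∈ ks → ∑ ks (λ j → 𝟙 (k ℕ.≡ᵇ j) ℤ.* g j) ≡ g k
∑-pick k g u k∈ = trans
  (∑-single (λ j → 𝟙 (k ℕ.≡ᵇ j) ℤ.* g j) u k∈ (λ {j} _ j≢k → cong (ℤ._* g j) (𝟙-false (λ h → j≢k (sym (ℕₚ.≡ᵇ⇒≡ k j h))))))
  (trans (cong (ℤ._* g k) (𝟙-true (ℕₚ.≡⇒≡ᵇ k k refl))) (ℤₚ.*-identityˡ (g k)))

∑-pick-∉ : ∀ {ks : List ℕ} (k : ℕ) (g : ℕ → ℤ) → ¬ (k ∈ ks) → ∑ ks (λ j → 𝟙 (k ℕ.≡ᵇ j) ℤ.* g j) ≡ 0ℤ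
∑-pick-∉ {ks} k g k∉ = ∑-vanish ks λ {j} j∈ →
  cong (ℤ._* g j) (𝟙-false (λ h → k∉ (subst (_∈ ks) (sym (ℕₚ.≡ᵇ⇒≡ k j h)) j∈)))

negOnePow-even : ∀ m → negOnePow (m ℕ.+ m) ≡ 1ℤ
negOnePow-even m = trans (negOnePow-+ m m) (negOnePow-square m)

∣negOnePow∣ : ∀ m → ℤ.∣ negOnePow m ∣ ≡ 1
∣negOnePow∣ zero    = refl
∣negOnePow∣ (suc m) = trans (ℤₚ.∣-i∣≡∣i∣ (negOnePow m)) (∣negOnePow∣ m)

module _ {A : Set} where

  sublists-⊆ : ∀ (xs : List A) {ys y} → ys ∈ sublists xs → y ∈ ys → y ∈ xs
  sublists-⊆ [] (here refl) ()
  sublists-⊆ (x ∷ xs) ys∈ y∈ with ∈-++⁻ (sublists xs) ys∈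
  ... | inj₁ ys∈xs = there (sublists-⊆ xs ys∈xs y∈)
  ... | inj₂ ys∈map with ∈-map⁻ (x ∷_) ys∈map
  sublists-⊆ (x ∷ xs) ys∈ (here refl) | inj₂ _ | zs , zs∈ , refl = here refl
  sublists-⊆ (x ∷ xs) ys∈ (there y∈)  | inj₂ _ | zs , zs∈ , refl = there (sublists-⊆ xs zs∈ y∈)

  sublists-length : ∀ (xs : List A) {ys} → ys ∈ sublists xs → length ys ≤ length xs
  sublists-length [] (here refl) = z≤n
  sublists-length (x ∷ xs) ys∈ with ∈-++⁻ (sublists xs) ys∈
  ... | inj₁ ys∈xs = ℕₚ.m≤n⇒m≤1+n (sublists-length xs ys∈xs)
  ... | inj₂ ys∈map with ∈-map⁻ (x ∷_) ys∈map
  ...   | zs , zs∈ , refl = s≤s (sublists-length xs zs∈)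

  -- If `m` entries satisfy `p`, this is the alternating sum over all subsets of an `m`-element set,
  -- (1 - 1)^m, which is nonzero only for m = 0.
  ∑-sublists : ∀ (p : A → Bool) xs →
    ∑ (sublists xs) (λ ys → 𝟙 (all p ys) ℤ.* negOnePow (length ys)) ≡ 𝟙 (not (any p xs))
  ∑-sublists p [] = refl
  ∑-sublists p (x ∷ xs) = begin
    ∑ (sublists xs ++ map (x ∷_) (sublists xs)) term
      ≡⟨ ∑-++ (sublists xs) (map (x ∷_) (sublists xs)) term ⟩
    ∑ (sublists xs) term ℤ.+ ∑ (map (x ∷_) (sublists xs)) term
      ≡⟨ cong (ℤ._+_ (∑ (sublists xs) term)) (∑-map (x ∷_) (sublists xs) term) ⟩
    ∑ (sublists xs) term ℤ.+ ∑ (sublists xs) (λ ys → 𝟙 (p x ∧ all p ys) ℤ.* ℤ.- negOnePow (length ys))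
      ≡⟨ cong (ℤ._+_ (∑ (sublists xs) term)) (trans
           (∑-cong (sublists xs) (λ {ys} _ → trans (cong (ℤ._* ℤ.- negOnePow (length ys)) (𝟙-∧ (p x) (all p ys)))
             (rearrange (𝟙 (p x)) (𝟙 (all p ys)) (negOnePow (length ys)))))
           (∑-*ˡ (sublists xs) (ℤ.- 𝟙 (p x)) term)) ⟩
    ∑ (sublists xs) term ℤ.+ ℤ.- 𝟙 (p x) ℤ.* ∑ (sublists xs) term
      ≡⟨ cong (λ t → t ℤ.+ ℤ.- 𝟙 (p x) ℤ.* t) (∑-sublists p xs) ⟩
    𝟙 (not (any p xs)) ℤ.+ ℤ.- 𝟙 (p x) ℤ.* 𝟙 (not (any p xs))
      ≡⟨ exclude (p x) (any p xs) ⟩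
    𝟙 (not (p x ∨ any p xs)) ∎
    where
    open ≡-Reasoning
    term : List A → ℤ
    term ys = 𝟙 (all p ys) ℤ.* negOnePow (length ys)
    rearrange : ∀ a b c → a ℤ.* b ℤ.* ℤ.- c ≡ ℤ.- a ℤ.* (b ℤ.* c)
    rearrange = solve-∀
    exclude : ∀ a b → 𝟙 (not b) ℤ.+ ℤ.- 𝟙 a ℤ.* 𝟙 (not b) ≡ 𝟙 (not (a ∨ b))
    exclude true  true  = refl
    exclude true  false = refl
    exclude false true  = refl
    exclude false false = refl

-- The Euler characteristic as a weighted sum over independent subspaces.

module EulerCharacteristic {q : ℕ} (F : FiniteField q) {n : ℕ}
  (ρ : QMatroidTheory.VSet F n → ℕ) (M : QMatroidTheory.IsQMatroid F n ρ) where

  open QMatroidTheory F hiding (f; s)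
  open Subspaces F
  open Counting F
  open Inversion F
  open Nullity F ρ M

  subs : List (VSet n)
  subs = allSubspaces n

  independent : VSet n → ℤ
  independent = indicator zeroSub

  w : VSet n → ℤ
  w V = weight (dim V)

  w-zero : w zeroSub ≡ 1ℤ
  w-zero = cong weight (dim-zero n)

  dim-≢0 : ∀ {V : VSet n} → Sub V → V ≢ zeroSub → 1 ≤ dim V
  dim-≢0 {V} S V≢0 = ℕₚ.≤-trans (s≤s z≤n) (dim-strict zeroSub-sub S (zeroSub-⊆ S) (λ V⊆0 → V≢0 (⊆-antisym V⊆0 (zeroSub-⊆ S))))

  ∈-vertices⁺ : ∀ {V} → Sub V → nul V ≡ 0 → V ≢ zeroSub → V ∈ vertices ρ
  ∈-vertices⁺ {V} S eq V≢0 = filterᵇ⁺ (λ X → isIndependent ρ X ∧ not (X ≡ˢ zeroSub)) (allVSets n) (allVSets-complete V)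
    (∧⁺ {isIndependent ρ V} {not (V ≡ˢ zeroSub)}
      (∧⁺ {isSubspace V} {ρ V ℕ.≡ᵇ dim V} (isSubspace⁺ S) (ℕₚ.≡⇒≡ᵇ (ρ V) (dim V) (trans (cong (ℕ._+ ρ V) (sym eq)) (nul+rank S))))
      (not⁺ (λ h → V≢0 (≡ˢ⁻ V zeroSub h))))
    where open Vectors F using (allVSets-complete)

  ∈-vertices⁻ : ∀ {V} → V ∈ vertices ρ → Sub V × nul V ≡ 0 × V ≢ zeroSub
  ∈-vertices⁻ {V} V∈ =
    let h₁ , h₂ = ∧⁻ {isIndependent ρ V} {not (V ≡ˢ zeroSub)} (proj₂ (filterᵇ⁻ (λ X → isIndependent ρ X ∧ not (X ≡ˢ zeroSub)) (allVSets n) V∈))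
        h₃ , h₄ = ∧⁻ {isSubspace V} {ρ V ℕ.≡ᵇ dim V} h₁
    in isSubspace⁻ V h₃ , trans (cong (dim V ∸_) (ℕₚ.≡ᵇ⇒≡ (ρ V) (dim V) h₄)) (ℕₚ.n∸n≡0 (dim V))
      , λ V≡0 → not⁻ {V ≡ˢ zeroSub} h₂ (≡ˢ⁺ V zeroSub V≡0)

  vertices-unique : Unique (vertices ρ)
  vertices-unique = filterᵇ-unique (λ X → isIndependent ρ X ∧ not (X ≡ˢ zeroSub)) (allVSets n) (allVSets-unique n)
    where open Vectors F using (allVSets-unique)

  zeroSub∷-unique : ∀ {Vs : List (VSet n)} → (∀ {V} → V ∈ Vs → V ≢ zeroSub) → Unique Vs → Unique (zeroSub ∷ Vs)
  zeroSub∷-unique h u = All.tabulate (λ V∈ eq → h V∈ (sym eq)) ∷ u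

  -- Philip Hall's theorem: the chains ending at V, counted with signs, give the Möbius function.
  module ChainCount where

    -- `N` bounds the length of the chains. The dimension grows along a chain of nonzero subspaces,
    -- so the count is complete once N ≥ dim V.
    signedChains : ℕ → VSet n → ℤ
    signedChains N V = ∑ (upTo N) (λ k → negOnePow (suc k) ℤ.* + chainsEndingAt ρ (suc k) V)

    verticesBelow : VSet n → List (VSet n)
    verticesBelow V = filterᵇ (λ W → W ⊂ᵇ V) (vertices ρ)

    ∈-verticesBelow⁻ : ∀ {V W} → W ∈ verticesBelow V → W ∈ vertices ρ × W ⊆ V × ¬ (V ⊆ W)
    ∈-verticesBelow⁻ {V} {W} W∈ =
      let p , r = filterᵇ⁻ (λ W → W ⊂ᵇ V) (vertices ρ) W∈
          W⊆V , V⊈W = ⊂ᵇ⁻ W V r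
      in p , (λ {v} → W⊆V {v}) , V⊈W

    -- The chain consisting of `V` alone gives -1. Any longer chain loses `V` to become a chain of
    -- opposite sign that ends at a vertex below `V`.
    signedChains-suc : ∀ N V → signedChains (suc N) V ≡ ℤ.- (1ℤ ℤ.+ ∑ (verticesBelow V) (signedChains N))
    signedChains-suc N V = begin
      signedChains (suc N) V
        ≡⟨ ∑-upTo-suc N (λ k → negOnePow (suc k) ℤ.* + chainsEndingAt ρ (suc k) V) ⟩
      ℤ.- 1ℤ ℤ.+ ∑ (upTo N) (λ k → ℤ.- negOnePow (suc k) ℤ.* + sum (map (chainsEndingAt ρ (suc k)) (verticesBelow V)))
        ≡⟨ cong (λ t → ℤ.- 1ℤ ℤ.+ t) (trans (∑-cong (upTo N) (λ {k} _ → pull k)) (∑-neg (upTo N) _)) ⟩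
      ℤ.- 1ℤ ℤ.+ ℤ.- ∑ (upTo N) (λ k → ∑ (verticesBelow V) (λ W → negOnePow (suc k) ℤ.* + chainsEndingAt ρ (suc k) W))
        ≡⟨ sym (ℤₚ.neg-distrib-+ 1ℤ (∑ (upTo N) (λ k → ∑ (verticesBelow V) (λ W → negOnePow (suc k) ℤ.* + chainsEndingAt ρ (suc k) W)))) ⟩
      ℤ.- (1ℤ ℤ.+ ∑ (upTo N) (λ k → ∑ (verticesBelow V) (λ W → negOnePow (suc k) ℤ.* + chainsEndingAt ρ (suc k) W)))
        ≡⟨ cong (λ t → ℤ.- (1ℤ ℤ.+ t)) (∑-comm (upTo N) (verticesBelow V) (λ k W → negOnePow (suc k) ℤ.* + chainsEndingAt ρ (suc k) W)) ⟩
      ℤ.- (1ℤ ℤ.+ ∑ (verticesBelow V) (signedChains N)) ∎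
      where
      open ≡-Reasoning
      pull : ∀ k → ℤ.- negOnePow (suc k) ℤ.* + sum (map (chainsEndingAt ρ (suc k)) (verticesBelow V))
        ≡ ℤ.- ∑ (verticesBelow V) (λ W → negOnePow (suc k) ℤ.* + chainsEndingAt ρ (suc k) W)
      pull k = trans (cong (ℤ.- negOnePow (suc k) ℤ.*_) (+-sum (verticesBelow V) (chainsEndingAt ρ (suc k))))
        (trans (sym (ℤₚ.neg-distribˡ-* (negOnePow (suc k)) _))
          (cong ℤ.-_ (sym (∑-*ˡ (verticesBelow V) (negOnePow (suc k)) (λ W → + chainsEndingAt ρ (suc k) W)))))

    -- Subspaces of an independent space are independent, so the vertices below `V` are all its
    -- proper nonzero subspaces; the summand 1 is the weight of the zero space.
    ∑-verticesBelow : ∀ {V} → V ∈ vertices ρ → 1ℤ ℤ.+ ∑ (verticesBelow V) w ≡ ∑ (properSubspacesOf V) w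
    ∑-verticesBelow {V} V∈ = trans (cong (ℤ._+ ∑ (verticesBelow V) w) (sym w-zero)) (∑-set w
      (zeroSub∷-unique (λ W∈ → proj₂ (proj₂ (∈-vertices⁻ (proj₁ (∈-verticesBelow⁻ W∈))))) (filterᵇ-unique (λ W → W ⊂ᵇ V) (vertices ρ) vertices-unique))
      (proper-unique V) to from)
      where
      SV : Sub V
      SV = proj₁ (∈-vertices⁻ V∈)
      to : ∀ {W} → W ∈ zeroSub ∷ verticesBelow V → W ∈ properSubspacesOf V
      to (here refl) = ∈-proper⁺ zeroSub-sub (zeroSub-⊆ SV) (λ V⊆0 → proj₂ (proj₂ (∈-vertices⁻ V∈)) (⊆-antisym V⊆0 (zeroSub-⊆ SV)))
      to (there W∈) = let W∈v , W⊆V , V⊈W = ∈-verticesBelow⁻ W∈ in ∈-proper⁺ (proj₁ (∈-vertices⁻ W∈v)) W⊆V V⊈W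
      from : ∀ {W} → W ∈ properSubspacesOf V → W ∈ zeroSub ∷ verticesBelow V
      from {W} W∈ = let SW , W⊆V , V⊈W = ∈-proper⁻ V W∈ in place SW W⊆V V⊈W (T? (W ≡ˢ zeroSub))
        where
        place : Sub W → W ⊆ V → ¬ (V ⊆ W) → Dec (T (W ≡ˢ zeroSub)) → W ∈ zeroSub ∷ verticesBelow V
        place SW W⊆V V⊈W (yes h) = here (≡ˢ⁻ W zeroSub h)
        place SW W⊆V V⊈W (no ¬h) = there (filterᵇ⁺ (λ W → W ⊂ᵇ V) (vertices ρ)
          (∈-vertices⁺ SW (ℕₚ.n≤0⇒n≡0 (subst (nul W ≤_) (proj₁ (proj₂ (∈-vertices⁻ V∈))) (nul-mono SW SV W⊆V))) (λ eq → ¬h (≡ˢ⁺ W zeroSub eq)))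
          (⊂ᵇ⁺ W V W⊆V V⊈W))

    -- Both sides obey the Möbius recursion on the subspaces of `V`: for `w` this is the vanishing
    -- of the weight sum over a nonzero space.
    signedChains≡w : ∀ N {V} → V ∈ vertices ρ → dim V ≤ N → signedChains N V ≡ w V
    signedChains≡w zero {V} V∈ d≤0 = let SV , _ , V≢0 = ∈-vertices⁻ V∈ in ⊥-elim (ℕₚ.<⇒≱ (dim-≢0 SV V≢0) d≤0)
    signedChains≡w (suc N) {V} V∈ d≤ = begin
      signedChains (suc N) V                                   ≡⟨ signedChains-suc N V ⟩
      ℤ.- (1ℤ ℤ.+ ∑ (verticesBelow V) (signedChains N))        ≡⟨ cong (λ t → ℤ.- (1ℤ ℤ.+ t)) (∑-cong (verticesBelow V) below) ⟩
      ℤ.- (1ℤ ℤ.+ ∑ (verticesBelow V) w)                       ≡⟨ cong ℤ.-_ (∑-verticesBelow V∈) ⟩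
      ℤ.- ∑ (properSubspacesOf V) w                            ≡⟨ sym (+ℤ-inverseˡ-unique (w V) (∑ (properSubspacesOf V) w) (trans (sym (∑-subspacesOf-split SV w)) (∑-weight-subspacesOf SV (dim-≢0 SV V≢0)))) ⟩
      w V                                                      ∎
      where
      open ≡-Reasoning
      SV = proj₁ (∈-vertices⁻ V∈)
      V≢0 = proj₂ (proj₂ (∈-vertices⁻ V∈))
      below : ∀ {W} → W ∈ verticesBelow V → signedChains N W ≡ w W
      below W∈ = let W∈v , W⊆V , V⊈W = ∈-verticesBelow⁻ W∈ in
        signedChains≡w N W∈v (ℕₚ.≤-pred (ℕₚ.<-≤-trans (dim-strict (proj₁ (∈-vertices⁻ W∈v)) SV W⊆V V⊈W) d≤))

    ∑-independent : 1ℤ ℤ.+ ∑ (vertices ρ) w ≡ ∑ subs (λ V → independent V ℤ.* w V)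
    ∑-independent = begin
      1ℤ ℤ.+ ∑ (vertices ρ) w                         ≡⟨ cong (ℤ._+ ∑ (vertices ρ) w) (sym w-zero) ⟩
      ∑ (zeroSub ∷ vertices ρ) w                      ≡⟨ ∑-set w (zeroSub∷-unique (λ V∈ → proj₂ (proj₂ (∈-vertices⁻ V∈))) vertices-unique)
                                                           (filterᵇ-unique isInd subs (subspaces-unique n)) to from ⟩
      ∑ (filterᵇ isInd subs) w                        ≡⟨ ∑-filter isInd subs w ⟩
      ∑ subs (λ V → independent V ℤ.* w V)            ∎
      where
      open ≡-Reasoning
      isInd : VSet n → Bool
      isInd V = (zeroSub ⊆ᵇ V) ∧ (nul V ℕ.≡ᵇ nul zeroSub)
      isInd⁺ : ∀ {V} → Sub V → nul V ≡ nul zeroSub → V ∈ filterᵇ isInd subs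
      isInd⁺ {V} S eq = filterᵇ⁺ isInd subs (∈-subspaces⁺ S)
        (∧⁺ {zeroSub ⊆ᵇ V} {nul V ℕ.≡ᵇ nul zeroSub} (⊆ᵇ⁺ zeroSub V (zeroSub-⊆ S)) (ℕₚ.≡⇒≡ᵇ (nul V) (nul zeroSub) eq))
      to : ∀ {V} → V ∈ zeroSub ∷ vertices ρ → V ∈ filterᵇ isInd subs
      to (here refl) = isInd⁺ zeroSub-sub refl
      to (there V∈)  = let S , eq , _ = ∈-vertices⁻ V∈ in isInd⁺ S (trans eq (sym nul-zeroSub))
      from : ∀ {V} → V ∈ filterᵇ isInd subs → V ∈ zeroSub ∷ vertices ρ
      from {V} V∈ = let p , r = filterᵇ⁻ isInd subs V∈
                        _ , eq = ∧⁻ {zeroSub ⊆ᵇ V} {nul V ℕ.≡ᵇ nul zeroSub} r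
                    in place (∈-subspaces⁻ p) (trans (ℕₚ.≡ᵇ⇒≡ (nul V) (nul zeroSub) eq) nul-zeroSub) (T? (V ≡ˢ zeroSub))
        where
        place : Sub V → nul V ≡ 0 → Dec (T (V ≡ˢ zeroSub)) → V ∈ zeroSub ∷ vertices ρ
        place S eq (yes h) = here (≡ˢ⁻ V zeroSub h)
        place S eq (no ¬h) = there (∈-vertices⁺ S eq (λ e → ¬h (≡ˢ⁺ V zeroSub e)))

    χ-as-sum : χ ρ ≡ ℤ.- ∑ subs (λ V → independent V ℤ.* w V)
    χ-as-sum = begin
      χ ρ
        ≡⟨ ∑-range-0 n (λ k → signPow ((+ k) ℤ.- + 1) ℤ.* + f k) ⟩
      ∑ (upTo (suc n)) (λ k → signPow ((+ k) ℤ.- + 1) ℤ.* + f k)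
        ≡⟨ ∑-upTo-suc n (λ k → signPow ((+ k) ℤ.- + 1) ℤ.* + f k) ⟩
      -- The empty chain has coefficient (-1)^(-1) = -1; it will account for the zero subspace,
      -- which is no vertex.
      ℤ.- 1ℤ ℤ.+ ∑ (upTo n) (λ k → signPow ((+ suc k) ℤ.- + 1) ℤ.* + f (suc k))
        ≡⟨ cong (λ t → ℤ.- 1ℤ ℤ.+ t) (trans (∑-cong (upTo n) (λ {k} _ → pull k)) (∑-neg (upTo n) _)) ⟩
      ℤ.- 1ℤ ℤ.+ ℤ.- ∑ (upTo n) (λ k → ∑ (vertices ρ) (λ V → negOnePow (suc k) ℤ.* + chainsEndingAt ρ (suc k) V))
        ≡⟨ sym (ℤₚ.neg-distrib-+ 1ℤ (∑ (upTo n) (λ k → ∑ (vertices ρ) (λ V → negOnePow (suc k) ℤ.* + chainsEndingAt ρ (suc k) V)))) ⟩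
      ℤ.- (1ℤ ℤ.+ ∑ (upTo n) (λ k → ∑ (vertices ρ) (λ V → negOnePow (suc k) ℤ.* + chainsEndingAt ρ (suc k) V)))
        ≡⟨ cong (λ t → ℤ.- (1ℤ ℤ.+ t)) (∑-comm (upTo n) (vertices ρ) (λ k V → negOnePow (suc k) ℤ.* + chainsEndingAt ρ (suc k) V)) ⟩
      ℤ.- (1ℤ ℤ.+ ∑ (vertices ρ) (signedChains n))
        ≡⟨ cong (λ t → ℤ.- (1ℤ ℤ.+ t)) (∑-cong (vertices ρ) (λ V∈ → signedChains≡w n V∈ (dim-≤ (proj₁ (∈-vertices⁻ V∈))))) ⟩
      ℤ.- (1ℤ ℤ.+ ∑ (vertices ρ) w)
        ≡⟨ cong ℤ.-_ ∑-independent ⟩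
      ℤ.- ∑ subs (λ V → independent V ℤ.* w V) ∎
      where
      open ≡-Reasoning
      f = QMatroidTheory.f F ρ
      pull : ∀ k → signPow ((+ suc k) ℤ.- + 1) ℤ.* + f (suc k)
        ≡ ℤ.- ∑ (vertices ρ) (λ V → negOnePow (suc k) ℤ.* + chainsEndingAt ρ (suc k) V)
      pull k = trans (cong₂ ℤ._*_ (signPow-pred (suc k)) (+-sum (vertices ρ) (chainsEndingAt ρ (suc k))))
        (trans (sym (ℤₚ.neg-distribˡ-* (negOnePow (suc k)) _))
          (cong ℤ.-_ (sym (∑-*ˡ (vertices ρ) (negOnePow (suc k)) (λ V → + chainsEndingAt ρ (suc k) V)))))

-- The lattice of cycles, coloops, and spans of circuits.

module Cycles {q : ℕ} (F : FiniteField q) {n : ℕ} (ρ : QMatroidTheory.VSet F n → ℕ)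
  (M : QMatroidTheory.IsQMatroid F n ρ) where

  open QMatroidTheory F hiding (f; s)
  open Subspaces F
  open Counting F
  open Inversion F
  open Nullity F ρ M

  private
    drops : VSet n → VSet n → Bool
    drops X Y = (Y ⊂ᵇ X) ∧ (nullity ρ Y ℕ.≡ᵇ nullity ρ X)

  μ₀ : VSet n → ℤ
  μ₀ = relMöbius zeroSub

  IsCycle : VSet n → Set
  IsCycle X = ∀ {Y} → Sub Y → Y ⊆ X → nul Y ≡ nul X → X ⊆ Y

  ∈-cycles⁺ : ∀ {X} → Sub X → IsCycle X → X ∈ cycles ρ
  ∈-cycles⁺ {X} S cyc = filterᵇ⁺ (isCycle ρ) (allSubspaces n) (∈-subspaces⁺ S)
    (∧⁺ {isSubspace X} {not (any (drops X) (allSubspaces n))} (isSubspace⁺ S) (not⁺ λ h →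
      let Y , Y∈ , p = any-T⁻ (drops X) (allSubspaces n) h
          p₁ , p₂ = ∧⁻ {Y ⊂ᵇ X} {nullity ρ Y ℕ.≡ᵇ nullity ρ X} p
          Y⊆X , X⊈Y = ⊂ᵇ⁻ Y X p₁
      in X⊈Y (cyc (∈-subspaces⁻ Y∈) Y⊆X (ℕₚ.≡ᵇ⇒≡ (nul Y) (nul X) p₂))))

  ∈-cycles⁻ : ∀ {X} → X ∈ cycles ρ → Sub X × IsCycle X
  ∈-cycles⁻ {X} X∈ = ∈-subspaces⁻ (proj₁ split) , λ {Y} SY Y⊆X eq {v} v∈ → minimal′ Y SY Y⊆X eq (X ⊆? Y) v∈
    where
    split = filterᵇ⁻ (isCycle ρ) (allSubspaces n) X∈
    none : T (not (any (drops X) (allSubspaces n)))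
    none = proj₂ (∧⁻ {isSubspace X} {not (any (drops X) (allSubspaces n))} (proj₂ split))
    minimal′ : ∀ Y → Sub Y → Y ⊆ X → nul Y ≡ nul X → Dec (X ⊆ Y) → X ⊆ Y
    minimal′ Y SY Y⊆X eq (yes X⊆Y) = X⊆Y
    minimal′ Y SY Y⊆X eq (no X⊈Y)  = ⊥-elim (not⁻ {any (drops X) (allSubspaces n)} none
      (any-T⁺ (drops X) (allSubspaces n) (∈-subspaces⁺ SY)
        (∧⁺ {Y ⊂ᵇ X} {nullity ρ Y ℕ.≡ᵇ nullity ρ X} (⊂ᵇ⁺ Y X Y⊆X X⊈Y) (ℕₚ.≡⇒≡ᵇ (nul Y) (nul X) eq))))

  -- A subspace that is not a cycle has a proper subspace of equal nullity, hence a hyperplane `H`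
  -- of equal nullity. A crossing circuit would force a drop, so the expansion along `H` is an empty
  -- sum.
  μ₀-vanishes : ∀ {W} → Sub W → ¬ (W ∈ cycles ρ) → μ₀ W ≡ 0ℤ
  μ₀-vanishes {W} SW W∉ = search (T? (any (drops W) (allSubspaces n)))
    where
    search : Dec (T (any (drops W) (allSubspaces n))) → μ₀ W ≡ 0ℤ
    search (no none) = ⊥-elim (W∉ (filterᵇ⁺ (isCycle ρ) (allSubspaces n) (∈-subspaces⁺ SW)
      (∧⁺ {isSubspace W} {not (any (drops W) (allSubspaces n))} (isSubspace⁺ SW) (not⁺ none))))
    search (yes some) = cut (hyperplane SY SW Y⊆W W⊈Y)
      where
      found = any-T⁻ (drops W) (allSubspaces n) some
      Y = proj₁ found
      SY : Sub Y
      SY = ∈-subspaces⁻ (proj₁ (proj₂ found))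
      parts = ∧⁻ {Y ⊂ᵇ W} {nullity ρ Y ℕ.≡ᵇ nullity ρ W} (proj₂ (proj₂ found))
      Y⊆W : Y ⊆ W
      Y⊆W = proj₁ (⊂ᵇ⁻ Y W (proj₁ parts))
      W⊈Y : ¬ (W ⊆ Y)
      W⊈Y = proj₂ (⊂ᵇ⁻ Y W (proj₁ parts))
      cut : (∃ λ H → Y ⊆ H × Hyperplane H W) → μ₀ W ≡ 0ℤ
      cut (H , Y⊆H , hyp) = trans expansion (cong ℤ.-_ (∑-vanish crossing λ {C} C∈ → ⊥-elim (no-crossing C (∈-crossing⁻ C∈))))
        where
        open Deletion zeroSub-sub hyp (zeroSub-⊆ (subH hyp))
        no-crossing : ∀ C → ¬ (CircuitAbove zeroSub C × C ⊆ W × ¬ (C ⊆ H))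
        no-crossing C (circ , C⊆W , C⊈H) = ℕₚ.<⇒≱
          (circuitAbove-drop hyp (zeroSub-⊆ (subH hyp)) circ C⊆W C⊈H)
          (subst (_≤ nul H) (ℕₚ.≡ᵇ⇒≡ (nul Y) (nul W) (proj₂ parts)) (nul-mono SY (subH hyp) Y⊆H))

  nul-cycle-≢0 : ∀ {X} → X ∈ cycles ρ → X ≢ zeroSub → nul X ≢ 0
  nul-cycle-≢0 X∈ X≢0 eq = let SX , cyc = ∈-cycles⁻ X∈ in
    X≢0 (⊆-antisym (cyc zeroSub-sub (zeroSub-⊆ SX) (trans nul-zeroSub (sym eq))) (zeroSub-⊆ SX))

  -- Since `μ₀` is 0 off the cycles, the recursion in L and the one in the full subspace lattice
  -- have the same sums.
  ∑-cyclesBelow : ∀ y → ∑ (filterᵇ (λ z → z ⊂ᵇ y) (cycles ρ)) μ₀ ≡ ∑ (properSubspacesOf y) μ₀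
  ∑-cyclesBelow y = begin
    ∑ (filterᵇ below (cycles ρ)) μ₀
      ≡⟨ ∑-filter below (cycles ρ) μ₀ ⟩
    ∑ (cycles ρ) (λ z → 𝟙 (below z) ℤ.* μ₀ z)
      ≡⟨ ∑-filter (isCycle ρ) (allSubspaces n) (λ z → 𝟙 (below z) ℤ.* μ₀ z) ⟩
    ∑ (allSubspaces n) (λ z → 𝟙 (isCycle ρ z) ℤ.* (𝟙 (below z) ℤ.* μ₀ z))
      ≡⟨ ∑-cong (allSubspaces n) (λ {z} z∈ → drop-indicator z z∈ (T? (isCycle ρ z))) ⟩
    ∑ (allSubspaces n) (λ z → 𝟙 (below z) ℤ.* μ₀ z)
      ≡⟨ sym (∑-filter below (allSubspaces n) μ₀) ⟩
    ∑ (properSubspacesOf y) μ₀ ∎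
    where
    open ≡-Reasoning
    below : VSet n → Bool
    below z = z ⊂ᵇ y
    drop-indicator : ∀ z → z ∈ allSubspaces n → Dec (T (isCycle ρ z)) →
      𝟙 (isCycle ρ z) ℤ.* (𝟙 (below z) ℤ.* μ₀ z) ≡ 𝟙 (below z) ℤ.* μ₀ z
    drop-indicator z z∈ (yes cyc) = trans (cong (ℤ._* (𝟙 (below z) ℤ.* μ₀ z)) (𝟙-true cyc)) (ℤₚ.*-identityˡ _)
    drop-indicator z z∈ (no ¬cyc) = trans
      (cong (𝟙 (isCycle ρ z) ℤ.*_) vanish) (trans (ℤₚ.*-zeroʳ (𝟙 (isCycle ρ z))) (sym vanish))
      where
      vanish : 𝟙 (below z) ℤ.* μ₀ z ≡ 0ℤ
      vanish = trans (cong (𝟙 (below z) ℤ.*_) (μ₀-vanishes (∈-subspaces⁻ z∈)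
        (λ z∈c → ¬cyc (proj₂ (filterᵇ⁻ (isCycle ρ) (allSubspaces n) z∈c))))) (ℤₚ.*-zeroʳ (𝟙 (below z)))

  -- Fuel beyond the dimension is enough, because dimension strictly drops along the recursion.
  mobius-cycle : ∀ k {y} → y ∈ cycles ρ → dim y < k → mobius ρ k y ≡ μ₀ y
  mobius-cycle (suc k) {y} y∈ d<k = decide (y ≡ˢ zeroSub) refl
    where
    Sy : Sub y
    Sy = proj₁ (∈-cycles⁻ y∈)
    branch : Bool → ℤ
    branch b = if b then + 1 else ℤ.- sumℤ (map (mobius ρ k) (filterᵇ (λ z → z ⊂ᵇ y) (cycles ρ)))
    decide : ∀ b → (y ≡ˢ zeroSub) ≡ b → branch (y ≡ˢ zeroSub) ≡ μ₀ y
    decide true eq = trans (cong branch eq) (sym (trans (cong μ₀ y≡0)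
      (trans (relMöbius-base zeroSub-sub zeroSub-sub refl) (𝟙-true (≡ˢ⁺ {n} zeroSub zeroSub refl)))))
      where
      y≡0 : y ≡ zeroSub
      y≡0 = ≡ˢ⁻ y zeroSub (subst T (sym eq) _)
    decide false eq = trans (cong branch eq) (begin
      ℤ.- ∑ (filterᵇ (λ z → z ⊂ᵇ y) (cycles ρ)) (mobius ρ k)
        ≡⟨ cong ℤ.-_ (∑-cong (filterᵇ (λ z → z ⊂ᵇ y) (cycles ρ)) below) ⟩
      ℤ.- ∑ (filterᵇ (λ z → z ⊂ᵇ y) (cycles ρ)) μ₀
        ≡⟨ cong ℤ.-_ (∑-cyclesBelow y) ⟩
      ℤ.- ∑ (properSubspacesOf y) μ₀
        ≡⟨ sym (+ℤ-inverseˡ-unique (μ₀ y) (∑ (properSubspacesOf y) μ₀) total) ⟩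
      μ₀ y ∎)
      where
      open ≡-Reasoning
      -- The total is the independence indicator at `y`, and a nonzero cycle is dependent: if its
      -- nullity were 0, the zero space would contradict its minimality.
      total : μ₀ y ℤ.+ ∑ (properSubspacesOf y) μ₀ ≡ 0ℤ
      total = trans (sym (∑-subspacesOf-split Sy μ₀)) (trans (∑-inverse (indicator zeroSub) Sy)
        (indicator-≢ {zeroSub} {y} λ e → nul-cycle-≢0 y∈ (λ y≡0 → subst T eq (≡ˢ⁺ y zeroSub y≡0)) (trans e nul-zeroSub)))
      below : ∀ {z} → z ∈ filterᵇ (λ z → z ⊂ᵇ y) (cycles ρ) → mobius ρ k z ≡ μ₀ z
      below {z} z∈ =
        let z∈c , r = filterᵇ⁻ (λ z → z ⊂ᵇ y) (cycles ρ) z∈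
            z⊆y , y⊈z = ⊂ᵇ⁻ z y r
        in mobius-cycle k z∈c (ℕₚ.<-≤-trans (dim-strict (proj₁ (∈-cycles⁻ z∈c)) Sy z⊆y y⊈z) (ℕₚ.≤-pred d<k))

  -- Whatever the fold accepts contains every cycle, the full space among them; its default value is
  -- the full space as well.
  topL-full : fullSpace ∈ cycles ρ → topL ρ ≡ fullSpace
  topL-full E∈ = go (cycles ρ)
    where
    go : ∀ ys → foldr (λ y acc → if all (λ z → z ⊆ᵇ y) (cycles ρ) then y else acc) fullSpace ys ≡ fullSpace
    go [] = refl
    go (y ∷ ys) with all (λ z → z ⊆ᵇ y) (cycles ρ) in eq
    ... | true  = ⊆-antisym (λ {v} _ → ∈-full v)
      (⊆ᵇ⁻ fullSpace y (all-T⁻ (λ z → z ⊆ᵇ y) (cycles ρ) (subst T (sym eq) _) E∈))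
    ... | false = go ys

  μL-full : fullSpace ∈ cycles ρ → μL ρ ≡ μ₀ fullSpace
  μL-full E∈ = trans (cong (mobius ρ (suc n)) (topL-full E∈)) (mobius-cycle (suc n) E∈ (s≤s (dim-≤ full-sub)))

  nul-full+rk : nul fullSpace ℕ.+ rk ρ ≡ n
  nul-full+rk = trans (nul+rank full-sub) (dim-full n)

  private
    isColoop : VSet n → Bool
    isColoop X = (dim X ℕ.≡ᵇ 1) ∧ does (ρ* ρ X ℤ.≟ + 0)

  ρ*-zero⁻ : ∀ {X} → ρ* ρ X ≡ + 0 → dim X ℕ.+ ρ (perp X) ≡ rk ρ
  ρ*-zero⁻ {X} eq = ℤₚ.+-injective (+ℤ-cancelʳ (ℤ.- (+ rk ρ)) (+ (dim X ℕ.+ ρ (perp X))) (+ rk ρ) (trans eq (sym (ℤₚ.+-inverseʳ (+ rk ρ)))))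

  ρ*-zero⁺ : ∀ {X} → dim X ℕ.+ ρ (perp X) ≡ rk ρ → ρ* ρ X ≡ + 0
  ρ*-zero⁺ {X} eq = trans (cong (λ t → + t ℤ.- + rk ρ) eq) (ℤₚ.+-inverseʳ (+ rk ρ))

  -- For a coloop `X` the hyperplane `perp X` has rank one less than E, hence the same nullity,
  -- against the minimality of E.
  coloop⇒full-not-cycle : T (hasColoop ρ) → ¬ (fullSpace ∈ cycles ρ)
  coloop⇒full-not-cycle h E∈ = absurd (any-T⁻ isColoop (allSubspaces n) h)
    where
    absurd : (∃ λ X → X ∈ allSubspaces n × T (isColoop X)) → ⊥
    absurd (X , X∈ , p) = ℕₚ.<⇒≱ (ℕₚ.≤-reflexive (trans (sym (cong (ℕ._+ dim X⊥) dimX≡1)) (dim-perp SX)))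
      (subst (_≤ dim X⊥) (dim-full n) (dim-mono full-sub perp-sub (proj₂ (∈-cycles⁻ E∈) perp-sub (λ {v} _ → ∈-full v) same-nul)))
      where
      SX : Sub X
      SX = ∈-subspaces⁻ X∈
      X⊥ = perp X
      parts = ∧⁻ {dim X ℕ.≡ᵇ 1} {does (ρ* ρ X ℤ.≟ + 0)} p
      dimX≡1 : dim X ≡ 1
      dimX≡1 = ℕₚ.≡ᵇ⇒≡ (dim X) 1 (proj₁ parts)
      rank⊥ : dim X ℕ.+ ρ X⊥ ≡ rk ρ
      rank⊥ = ρ*-zero⁻ {X} (does⁻ (ρ* ρ X ℤ.≟ + 0) (proj₂ parts))
      same-nul : nul X⊥ ≡ nul fullSpace
      same-nul = begin
        dim X⊥ ∸ ρ X⊥                                  ≡⟨ sym (ℕₚ.[m+n]∸[m+o]≡n∸o (dim X) (dim X⊥) (ρ X⊥)) ⟩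
        (dim X ℕ.+ dim X⊥) ∸ (dim X ℕ.+ ρ X⊥)          ≡⟨ cong₂ _∸_ (trans (dim-perp SX) (sym (dim-full n))) rank⊥ ⟩
        nul fullSpace                                  ∎
        where open ≡-Reasoning

  -- A proper `Y` with the nullity of E lies in a hyperplane `H` with that nullity. Then `H` has
  -- rank one less than E, and `perp H` is a coloop.
  no-coloop⇒full-cycle : ¬ T (hasColoop ρ) → fullSpace ∈ cycles ρ
  no-coloop⇒full-cycle none = ∈-cycles⁺ full-sub λ {Y} SY _ eq {v} v∈ → covers Y SY eq (fullSpace ⊆? Y) v∈
    where
    covers : ∀ Y → Sub Y → nul Y ≡ nul fullSpace → Dec (fullSpace ⊆ Y) → fullSpace ⊆ Y
    covers Y SY eq (yes E⊆Y) = E⊆Y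
    covers Y SY eq (no E⊈Y)  = ⊥-elim (coloop (hyperplane SY full-sub (λ {v} _ → ∈-full v) E⊈Y))
      where
      coloop : (∃ λ H → Y ⊆ H × Hyperplane H fullSpace) → ⊥
      coloop (H , Y⊆H , hyp) = none (any-T⁺ isColoop (allSubspaces n) (∈-subspaces⁺ (perp-sub {X = H}))
        (∧⁺ {dim H⊥ ℕ.≡ᵇ 1} {does (ρ* ρ H⊥ ℤ.≟ + 0)} (ℕₚ.≡⇒≡ᵇ (dim H⊥) 1 dimH⊥≡1) (does⁺ (ρ* ρ H⊥ ℤ.≟ + 0) (ρ*-zero⁺ {H⊥} ranks))))
        where
        H⊥ = perp H
        dimH⊥≡1 : dim H⊥ ≡ 1
        dimH⊥≡1 = ℕₚ.+-cancelˡ-≡ (dim H) (dim H⊥) 1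
          (trans (dim-perp (subH hyp)) (trans (sym (dim-full n)) (trans (codim hyp) (ℕₚ.+-comm 1 (dim H)))))
        nul≡ : nul H ≡ nul fullSpace
        nul≡ = ℕₚ.≤-antisym (nul-≤ hyp) (subst (_≤ nul H) eq (nul-mono SY (subH hyp) Y⊆H))
        ranks : dim H⊥ ℕ.+ ρ (perp H⊥) ≡ rk ρ
        ranks = trans (cong₂ ℕ._+_ dimH⊥≡1 (cong ρ (perp-perp (subH hyp))))
          (ℕₚ.+-cancelˡ-≡ (nul H) (suc (ρ H)) (rk ρ)
            (trans (ℕₚ.+-suc (nul H) (ρ H)) (trans (sym (balance hyp)) (cong (ℕ._+ rk ρ) (sym nul≡)))))

  -- Origin of the sign (-1)^r: as n is the sum of rank and nullity of E, the nullity part of (-1)^n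
  -- turns `μ₀ fullSpace` into its absolute value. With a coloop both sides are 0.
  signed-μbar : negOnePow n ℤ.* μ₀ fullSpace ≡ negOnePow (rk ρ) ℤ.* + μbar ρ
  signed-μbar = decide (hasColoop ρ) refl
    where
    value : Bool → ℕ
    value b = if b then 0 else ℤ.∣ μL ρ ∣
    decide : ∀ b → hasColoop ρ ≡ b → negOnePow n ℤ.* μ₀ fullSpace ≡ negOnePow (rk ρ) ℤ.* + value (hasColoop ρ)
    decide true eq = trans
      (trans (cong (negOnePow n ℤ.*_) (μ₀-vanishes full-sub (coloop⇒full-not-cycle (subst T (sym eq) _)))) (ℤₚ.*-zeroʳ (negOnePow n)))
      (sym (trans (cong (λ b → negOnePow (rk ρ) ℤ.* + value b) eq) (ℤₚ.*-zeroʳ (negOnePow (rk ρ)))))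
    decide false eq = begin
      negOnePow n ℤ.* μ₀ fullSpace
        ≡⟨ cong (λ t → negOnePow t ℤ.* μ₀ fullSpace) (trans (sym nul-full+rk) (ℕₚ.+-comm (nul fullSpace) (rk ρ))) ⟩
      negOnePow (rk ρ ℕ.+ k) ℤ.* μ₀ fullSpace
        ≡⟨ cong (ℤ._* μ₀ fullSpace) (negOnePow-+ (rk ρ) k) ⟩
      negOnePow (rk ρ) ℤ.* negOnePow k ℤ.* μ₀ fullSpace
        ≡⟨ ℤₚ.*-assoc (negOnePow (rk ρ)) (negOnePow k) (μ₀ fullSpace) ⟩
      negOnePow (rk ρ) ℤ.* (negOnePow k ℤ.* μ₀ fullSpace)
        ≡⟨ cong (negOnePow (rk ρ) ℤ.*_) (sym (ℤₚ.0≤i⇒+∣i∣≡i sign)) ⟩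
      negOnePow (rk ρ) ℤ.* + ℤ.∣ negOnePow k ℤ.* μ₀ fullSpace ∣
        ≡⟨ cong (λ t → negOnePow (rk ρ) ℤ.* + t) absolute ⟩
      negOnePow (rk ρ) ℤ.* + value false
        ≡⟨ cong (λ b → negOnePow (rk ρ) ℤ.* + value b) (sym eq) ⟩
      negOnePow (rk ρ) ℤ.* + value (hasColoop ρ) ∎
      where
      open ≡-Reasoning
      k = nul fullSpace
      sign : 0ℤ ℤ.≤ negOnePow k ℤ.* μ₀ fullSpace
      sign = relMöbius-sign k zeroSub-sub full-sub (λ {v} _ → ∈-full v) (cong (ℕ._+ k) (sym nul-zeroSub))
      absolute : ℤ.∣ negOnePow k ℤ.* μ₀ fullSpace ∣ ≡ ℤ.∣ μL ρ ∣
      absolute = begin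
        ℤ.∣ negOnePow k ℤ.* μ₀ fullSpace ∣             ≡⟨ ℤₚ.abs-* (negOnePow k) (μ₀ fullSpace) ⟩
        ℤ.∣ negOnePow k ∣ ℕ.* ℤ.∣ μ₀ fullSpace ∣       ≡⟨ cong (ℕ._* ℤ.∣ μ₀ fullSpace ∣) (∣negOnePow∣ k) ⟩
        1 ℕ.* ℤ.∣ μ₀ fullSpace ∣                       ≡⟨ ℕₚ.*-identityˡ _ ⟩
        ℤ.∣ μ₀ fullSpace ∣                             ≡⟨ cong ℤ.∣_∣ (sym (μL-full (no-coloop⇒full-cycle (λ h → subst T eq h)))) ⟩
        ℤ.∣ μL ρ ∣                                     ∎

  ∈-circuits⁻ : ∀ {C} → C ∈ circuits ρ → Sub C × nul C ≡ 1
  ∈-circuits⁻ {C} C∈ =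
    let p , r = filterᵇ⁻ (λ X → nullity ρ X ℕ.≡ᵇ 1) (cycles ρ) C∈
    in proj₁ (∈-cycles⁻ p) , ℕₚ.≡ᵇ⇒≡ (nul C) 1 r

  -- Along a descending sequence of hyperplanes the nullity falls to 0 in steps of at most one, so
  -- it passes through 1; there a minimal subspace of nullity one is a circuit.
  circuit-exists : ∀ {W} → Sub W → 1 ≤ nul W → ∃ λ C → C ∈ circuits ρ × C ⊆ W
  circuit-exists {W} SW 1≤ = go (suc (dim W)) W SW 1≤ ℕₚ.≤-refl
    where
    nul-1 : ∀ W → Sub W → nul W ≡ 1 → ∃ λ C → C ∈ circuits ρ × C ⊆ W
    nul-1 W SW eq =
      let C , C∈ , C⊆W = circuitAbove-exists SW (zeroSub-⊆ SW) (trans eq (cong suc (sym nul-zeroSub)))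
          circ = ∈-circuitsAbove⁻ C∈
      in C , filterᵇ⁺ (λ X → nullity ρ X ℕ.≡ᵇ 1) (cycles ρ)
           (∈-cycles⁺ (subC circ) λ SY Y⊆C eq′ → minimal circ SY (zeroSub-⊆ SY) Y⊆C (trans eq′ (nul-C circ)))
           (ℕₚ.≡⇒≡ᵇ (nul C) 1 (trans (nul-C circ) (cong suc nul-zeroSub)))
         , (λ {v} → C⊆W {v})
    go : ∀ k W → Sub W → 1 ≤ nul W → dim W < k → ∃ λ C → C ∈ circuits ρ × C ⊆ W
    go (suc k) W SW 1≤ d<k = decide (nul W ℕₚ.≟ 1)
      where
      W⊈0 : ¬ (W ⊆ zeroSub)
      W⊈0 h = ℕₚ.<⇒≱ 1≤ (subst (nul W ≤_) nul-zeroSub (nul-mono SW zeroSub-sub h))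
      decide : Dec (nul W ≡ 1) → ∃ λ C → C ∈ circuits ρ × C ⊆ W
      decide (yes eq) = nul-1 W SW eq
      decide (no neq) =
        let H , _ , hyp = hyperplane zeroSub-sub SW (zeroSub-⊆ SW) W⊈0
            C , C∈ , C⊆H = go k H (subH hyp) (ℕₚ.≤-pred (ℕₚ.≤-trans (ℕₚ.≤∧≢⇒< 1≤ (λ e → neq (sym e))) (nul-≤-suc hyp)))
              (subst (_≤ k) (codim hyp) (ℕₚ.≤-pred d<k))
        in C , C∈ , λ v∈ → H⊆W hyp (C⊆H v∈)

  span-sub : ∀ (Cs : List (VSet n)) → (∀ {C} → C ∈ Cs → Sub C) → Sub (span Cs)
  span-sub []       h = zeroSub-sub
  span-sub (C ∷ Cs) h = ⊕-sub (h (here refl)) (span-sub Cs (h ∘ there))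

  span-⊆ : ∀ {W} (Cs : List (VSet n)) → Sub W → (∀ {C} → C ∈ Cs → C ⊆ W) → span Cs ⊆ W
  span-⊆ []       SW h = zeroSub-⊆ SW
  span-⊆ (C ∷ Cs) SW h = ⊕-least SW (h (here refl)) (span-⊆ Cs SW (h ∘ there))

  ⊆-span : ∀ {C} (Cs : List (VSet n)) → (∀ {C} → C ∈ Cs → Sub C) → C ∈ Cs → C ⊆ span Cs
  ⊆-span (C ∷ Cs) h (here refl) v∈ = ⊆-⊕ˡ (span-sub Cs (h ∘ there)) v∈
  ⊆-span (C ∷ Cs) h (there C∈)  v∈ = ⊆-⊕ʳ (h (here refl)) (⊆-span Cs (h ∘ there) C∈ v∈)

  circuitSets : List (List (VSet n))
  circuitSets = sublists (circuits ρ)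

  circuitSet-sub : ∀ {X} → X ∈ circuitSets → ∀ {C} → C ∈ X → Sub C
  circuitSet-sub X∈ C∈ = proj₁ (∈-circuits⁻ (sublists-⊆ (circuits ρ) X∈ C∈))

  -- Crosscut theorem: the spans of sets of circuits, counted with signs, invert the independence indicator.
  signedSpans : VSet n → ℤ
  signedSpans W = ∑ circuitSets (λ X → 𝟙 (span X ≡ˢ W) ℤ.* negOnePow (length X))

  -- A set of circuits has its span inside `W` exactly when each of its members is inside `W`. What
  -- remains is the alternating sum over all sets of circuits in `W`, which is 1 if there is no such
  -- circuit and 0 otherwise.
  ∑-signedSpans : ∀ {W} → Sub W → ∑ (subspacesOf W) signedSpans ≡ indicator zeroSub W
  ∑-signedSpans {W} SW = begin
    ∑ (subspacesOf W) signedSpans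
      ≡⟨ ∑-comm (subspacesOf W) circuitSets (λ V X → 𝟙 (span X ≡ˢ V) ℤ.* negOnePow (length X)) ⟩
    ∑ circuitSets (λ X → ∑ (subspacesOf W) (λ V → 𝟙 (span X ≡ˢ V) ℤ.* negOnePow (length X)))
      ≡⟨ ∑-cong circuitSets (λ {X} X∈ → trans (∑-*ʳ (subspacesOf W) (negOnePow (length X)) (λ V → 𝟙 (span X ≡ˢ V)))
           (cong (ℤ._* negOnePow (length X)) (spans-within X (λ {C} → circuitSet-sub X∈ {C}) (T? (all (λ C → C ⊆ᵇ W) X))))) ⟩
    ∑ circuitSets (λ X → 𝟙 (all (λ C → C ⊆ᵇ W) X) ℤ.* negOnePow (length X))
      ≡⟨ ∑-sublists (λ C → C ⊆ᵇ W) (circuits ρ) ⟩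
    𝟙 (not (any (λ C → C ⊆ᵇ W) (circuits ρ)))
      ≡⟨ none-within (nul W ℕₚ.≟ 0) ⟩
    indicator zeroSub W ∎
    where
    open ≡-Reasoning
    spans-within : ∀ X → (∀ {C} → C ∈ X → Sub C) → Dec (T (all (λ C → C ⊆ᵇ W) X)) →
      ∑ (subspacesOf W) (λ V → 𝟙 (span X ≡ˢ V)) ≡ 𝟙 (all (λ C → C ⊆ᵇ W) X)
    spans-within X h (yes inside) = trans
      (∑-single (λ V → 𝟙 (span X ≡ˢ V)) (subspacesOf-unique W)
        (∈-subspacesOf⁺ (span-sub X h) (span-⊆ X SW (λ {C} C∈ {v} → ⊆ᵇ⁻ C W (all-T⁻ (λ C → C ⊆ᵇ W) X inside C∈) {v})))
        (λ {V} _ V≢ → 𝟙-false (λ e → V≢ (sym (≡ˢ⁻ (span X) V e)))))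
      (trans (𝟙-true (≡ˢ⁺ (span X) (span X) refl)) (sym (𝟙-true inside)))
    spans-within X h (no outside) = trans
      (∑-vanish (subspacesOf W) λ {V} V∈ → 𝟙-false λ e → outside (all-T⁺ (λ C → C ⊆ᵇ W) X λ {C} C∈ →
        ⊆ᵇ⁺ C W λ {v} v∈ → proj₂ (∈-subspacesOf⁻ W V∈) (subst (v ∈ˢ_) (≡ˢ⁻ (span X) V e) (⊆-span X h C∈ v∈))))
      (sym (𝟙-false outside))
    -- Containing no circuit is the same as having nullity 0.
    none-within : Dec (nul W ≡ 0) → 𝟙 (not (any (λ C → C ⊆ᵇ W) (circuits ρ))) ≡ indicator zeroSub W
    none-within (yes eq) = trans
      (𝟙-true (not⁺ λ h → let C , C∈ , p = any-T⁻ (λ C → C ⊆ᵇ W) (circuits ρ) h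
                              SC , nulC = ∈-circuits⁻ C∈
                          in ℕₚ.1+n≰n (subst (_≤ 0) nulC (subst (nul C ≤_) eq (nul-mono SC SW (⊆ᵇ⁻ C W p))))))
      (sym (indicator-1 {zeroSub} {W} (zeroSub-⊆ SW) (trans eq (sym nul-zeroSub))))
    none-within (no neq) = trans
      (𝟙-false λ h → let C , C∈ , C⊆W = circuit-exists SW (ℕₚ.n≢0⇒n>0 neq) in
        not⁻ {any (λ C → C ⊆ᵇ W) (circuits ρ)} h (any-T⁺ (λ C → C ⊆ᵇ W) (circuits ρ) C∈ (⊆ᵇ⁺ C W C⊆W)))
      (sym (indicator-≢ {zeroSub} {W} (λ e → neq (trans e nul-zeroSub))))

  signedSpans≡μ₀ : ∀ {W} → Sub W → signedSpans W ≡ μ₀ W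
  signedSpans≡μ₀ SW = zeta-injective SW signedSpans μ₀
    (λ SV _ → trans (∑-signedSpans SV) (sym (∑-inverse (indicator zeroSub) SV)))

-- Comparing both sides, one set of circuits at a time.

module Assembly {q : ℕ} (F : FiniteField q) {n : ℕ} (1≤n : 1 ≤ n)
  (ρ : QMatroidTheory.VSet F n → ℕ) (M : QMatroidTheory.IsQMatroid F n ρ) where

  open QMatroidTheory F hiding (f)
  open Subspaces F
  open Counting F
  open Nullity F ρ M
  open EulerCharacteristic F ρ M
  open Cycles F ρ M

  codimension : VSet n → ℕ
  codimension X = n ∸ dim X

  Φ : ℕ → ℤ
  Φ l = ∑ (range 0 l) (λ j → + gauss l j ℤ.* weight (n ∸ j))

  Φ-codimension : ∀ {W} → Sub W → Φ (codimension W) ≡ ∑ subs (λ V → 𝟙 (W ⊆ᵇ V) ℤ.* w V)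
  Φ-codimension {W} SW = trans (sym (∑-supspacesOf SW weight)) (∑-filter (λ V → W ⊆ᵇ V) subs w)

  Φ-full : Φ 0 ≡ weight n
  Φ-full = begin
    Φ 0                               ≡⟨ cong Φ (sym (trans (cong (n ∸_) (dim-full n)) (ℕₚ.n∸n≡0 n))) ⟩
    Φ (codimension fullSpace)         ≡⟨ Φ-codimension full-sub ⟩
    ∑ subs (λ V → 𝟙 (fullSpace ⊆ᵇ V) ℤ.* w V)
      ≡⟨ ∑-single (λ V → 𝟙 (fullSpace ⊆ᵇ V) ℤ.* w V) (subspaces-unique n) (∈-subspaces⁺ full-sub)
           (λ {V} _ V≢E → cong (ℤ._* w V) (𝟙-false λ h → V≢E (⊆-antisym (λ {v} _ → ∈-full v) (⊆ᵇ⁻ fullSpace V h)))) ⟩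
    𝟙 (fullSpace {n} ⊆ᵇ fullSpace) ℤ.* w fullSpace
      ≡⟨ trans (cong (ℤ._* w fullSpace) (𝟙-true (⊆ᵇ⁺ {n} fullSpace fullSpace id))) (ℤₚ.*-identityˡ (w fullSpace)) ⟩
    w fullSpace                       ≡⟨ cong weight (dim-full n) ⟩
    weight n                          ∎
    where open ≡-Reasoning

  Φ-zero : Φ n ≡ 0ℤ
  Φ-zero = begin
    Φ n                               ≡⟨ cong (λ d → Φ (n ∸ d)) (sym (dim-zero n)) ⟩
    Φ (codimension zeroSub)           ≡⟨ Φ-codimension zeroSub-sub ⟩
    ∑ subs (λ V → 𝟙 (zeroSub ⊆ᵇ V) ℤ.* w V)
      ≡⟨ ∑-cong subs (λ {V} V∈ → trans (cong (ℤ._* w V) (𝟙-true (⊆ᵇ⁺ zeroSub V (zeroSub-⊆ (∈-subspaces⁻ V∈))))) (ℤₚ.*-identityˡ (w V))) ⟩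
    ∑ subs w                          ≡⟨ ∑-set w (subspaces-unique n) (subspacesOf-unique fullSpace)
                                           (λ V∈ → ∈-subspacesOf⁺ (∈-subspaces⁻ V∈) (λ {v} _ → ∈-full v))
                                           (λ V∈ → ∈-subspaces⁺ (proj₁ (∈-subspacesOf⁻ fullSpace V∈))) ⟩
    -- Here n ≥ 1 matters: for the zero space the sum would be 1.
    ∑ (subspacesOf fullSpace) w       ≡⟨ ∑-weight-subspacesOf (full-sub {n}) (subst (1 ≤_) (sym (dim-full n)) 1≤n) ⟩
    0ℤ                                ∎
    where open ≡-Reasoning

  sgn : List (VSet n) → ℤ
  sgn X = negOnePow (length X)

  codimensionOf : List (VSet n) → ℕ
  codimensionOf X = codimension (span X)

  -- The outer index is the set `X` of circuits rather than its span, because the numbers λ count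
  -- sets.
  ∑-independent-w : ∑ subs (λ V → independent V ℤ.* w V) ≡ ∑ circuitSets (λ X → sgn X ℤ.* Φ (codimensionOf X))
  ∑-independent-w = begin
    ∑ subs (λ V → independent V ℤ.* w V)
      ≡⟨ ∑-cong subs (λ {V} V∈ → cong (ℤ._* w V) (sym (within V (∈-subspaces⁻ V∈)))) ⟩
    ∑ subs (λ V → ∑ circuitSets (λ X → 𝟙 (span X ⊆ᵇ V) ℤ.* sgn X) ℤ.* w V)
      ≡⟨ ∑-cong subs (λ {V} _ → sym (∑-*ʳ circuitSets (w V) (λ X → 𝟙 (span X ⊆ᵇ V) ℤ.* sgn X))) ⟩
    ∑ subs (λ V → ∑ circuitSets (λ X → 𝟙 (span X ⊆ᵇ V) ℤ.* sgn X ℤ.* w V))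
      ≡⟨ ∑-comm subs circuitSets (λ V X → 𝟙 (span X ⊆ᵇ V) ℤ.* sgn X ℤ.* w V) ⟩
    ∑ circuitSets (λ X → ∑ subs (λ V → 𝟙 (span X ⊆ᵇ V) ℤ.* sgn X ℤ.* w V))
      ≡⟨ ∑-cong circuitSets (λ {X} X∈ → trans
           (∑-cong subs (λ {V} _ → rotate (𝟙 (span X ⊆ᵇ V)) (sgn X) (w V)))
           (trans (∑-*ˡ subs (sgn X) (λ V → 𝟙 (span X ⊆ᵇ V) ℤ.* w V))
             (cong (sgn X ℤ.*_) (sym (Φ-codimension (span-sub X (circuitSet-sub X∈))))))) ⟩
    ∑ circuitSets (λ X → sgn X ℤ.* Φ (codimensionOf X)) ∎
    where
    open ≡-Reasoning
    rotate : ∀ a b c → a ℤ.* b ℤ.* c ≡ b ℤ.* (a ℤ.* c)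
    rotate = solve-∀
    within : ∀ V → Sub V → ∑ circuitSets (λ X → 𝟙 (span X ⊆ᵇ V) ℤ.* sgn X) ≡ independent V
    within V SV = trans
      (∑-cong circuitSets (λ {X} X∈ → trans
        (cong (ℤ._* sgn X) (sym (containing X (span-sub X (circuitSet-sub X∈)) (span X ⊆? V))))
        (sym (∑-*ʳ (subspacesOf V) (sgn X) (λ U → 𝟙 (span X ≡ˢ U))))))
      (trans (sym (∑-comm (subspacesOf V) circuitSets (λ U X → 𝟙 (span X ≡ˢ U) ℤ.* sgn X))) (∑-signedSpans SV))
      where
      containing : ∀ X → Sub (span X) → Dec (span X ⊆ V) → ∑ (subspacesOf V) (λ U → 𝟙 (span X ≡ˢ U)) ≡ 𝟙 (span X ⊆ᵇ V)
      containing X SX (yes X⊆V) = trans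
        (∑-single (λ U → 𝟙 (span X ≡ˢ U)) (subspacesOf-unique V) (∈-subspacesOf⁺ SX X⊆V)
          (λ {U} _ U≢ → 𝟙-false (λ e → U≢ (sym (≡ˢ⁻ (span X) U e)))))
        (trans (𝟙-true (≡ˢ⁺ (span X) (span X) refl)) (sym (𝟙-true (⊆ᵇ⁺ (span X) V X⊆V))))
      containing X SX (no X⊈V) = trans
        (∑-vanish (subspacesOf V) λ {U} U∈ → 𝟙-false λ e →
          X⊈V (λ {v} v∈ → proj₂ (∈-subspacesOf⁻ V U∈) (subst (v ∈ˢ_) (≡ˢ⁻ (span X) U e) v∈)))
        (sym (𝟙-false λ h → X⊈V (⊆ᵇ⁻ (span X) V h)))

  term : ℕ → ℕ → ℕ → ℤ
  term l i j = signPow ((+ (n ℕ.+ i ℕ.+ j)) ℤ.- + 1) ℤ.* + (q ^ ((n ∸ j) choose 2)) ℤ.* + gauss l j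

  G : ℕ → ℕ → ℤ
  G l i = ∑ (range 0 l) (term l i)

  -- n + i + j and i + (n − j) have the same parity.
  G-Φ : ∀ {l} i → l ≤ n → G l i ≡ ℤ.- negOnePow i ℤ.* Φ l
  G-Φ {l} i l≤n = trans
    (∑-cong (range 0 l) (λ {j} j∈ → summand j (ℕₚ.≤-trans (proj₂ (∈-range⁻ {0} {l} j∈)) l≤n)))
    (∑-*ˡ (range 0 l) (ℤ.- negOnePow i) (λ j → + gauss l j ℤ.* weight (n ∸ j)))
    where
    parity : ∀ j → j ≤ n → negOnePow (n ℕ.+ i ℕ.+ j) ≡ negOnePow i ℤ.* negOnePow (n ∸ j)
    parity j j≤n = begin
      negOnePow (n ℕ.+ i ℕ.+ j)
        ≡⟨ cong (λ t → negOnePow (t ℕ.+ i ℕ.+ j)) (sym (ℕₚ.m∸n+n≡m j≤n)) ⟩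
      negOnePow (((n ∸ j) ℕ.+ j) ℕ.+ i ℕ.+ j)
        ≡⟨ cong negOnePow (regroup (n ∸ j) j i) ⟩
      negOnePow (i ℕ.+ (n ∸ j) ℕ.+ (j ℕ.+ j))
        ≡⟨ negOnePow-+ (i ℕ.+ (n ∸ j)) (j ℕ.+ j) ⟩
      negOnePow (i ℕ.+ (n ∸ j)) ℤ.* negOnePow (j ℕ.+ j)
        ≡⟨ cong (negOnePow (i ℕ.+ (n ∸ j)) ℤ.*_) (negOnePow-even j) ⟩
      negOnePow (i ℕ.+ (n ∸ j)) ℤ.* 1ℤ
        ≡⟨ trans (ℤₚ.*-identityʳ _) (negOnePow-+ i (n ∸ j)) ⟩
      negOnePow i ℤ.* negOnePow (n ∸ j) ∎
      where
      open ≡-Reasoning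
      regroup : ∀ a j i → a ℕ.+ j ℕ.+ i ℕ.+ j ≡ i ℕ.+ a ℕ.+ (j ℕ.+ j)
      regroup = ℕ-solve-∀
    summand : ∀ j → j ≤ n → term l i j ≡ ℤ.- negOnePow i ℤ.* (+ gauss l j ℤ.* weight (n ∸ j))
    summand j j≤n = trans
      (cong (λ t → t ℤ.* + (q ^ ((n ∸ j) choose 2)) ℤ.* + gauss l j)
        (trans (signPow-pred (n ℕ.+ i ℕ.+ j)) (cong ℤ.-_ (parity j j≤n))))
      (rearrange (negOnePow i) (negOnePow (n ∸ j)) (+ (q ^ ((n ∸ j) choose 2))) (+ gauss l j))
      where
      rearrange : ∀ a b c d → ℤ.- (a ℤ.* b) ℤ.* c ℤ.* d ≡ ℤ.- a ℤ.* (d ℤ.* (b ℤ.* c))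
      rearrange = solve-∀

  middle : List ℕ
  middle = range 1 (n ∸ 1)

  -- What a single set of circuits adds to the double sum once each λ is written as a sum of
  -- indicators; it is 0 when the codimension or the size of `X` falls outside the ranges.
  share : List (VSet n) → ℤ
  share X = ∑ middle (λ l → 𝟙 (codimensionOf X ℕ.≡ᵇ l) ℤ.* ∑ (range 1 (s ρ)) (λ i → 𝟙 (length X ℕ.≡ᵇ i) ℤ.* G l i))

  secondSum : ℤ
  secondSum = ∑ middle (λ l → ∑ (range 1 (s ρ)) (λ i → + lam ρ i l ℤ.* G l i))

  secondSum≡ : secondSum ≡ ∑ circuitSets share
  secondSum≡ = begin
    secondSum
      ≡⟨ ∑-cong middle (λ {l} _ → ∑-cong (range 1 (s ρ)) (λ {i} _ → trans
           (cong (ℤ._* G l i) (length-filter (chosen l i) circuitSets))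
           (sym (∑-*ʳ circuitSets (G l i) (λ X → 𝟙 (chosen l i X)))))) ⟩
    ∑ middle (λ l → ∑ (range 1 (s ρ)) (λ i → ∑ circuitSets (λ X → 𝟙 (chosen l i X) ℤ.* G l i)))
      ≡⟨ ∑-cong middle (λ {l} _ → ∑-comm (range 1 (s ρ)) circuitSets (λ i X → 𝟙 (chosen l i X) ℤ.* G l i)) ⟩
    ∑ middle (λ l → ∑ circuitSets (λ X → ∑ (range 1 (s ρ)) (λ i → 𝟙 (chosen l i X) ℤ.* G l i)))
      ≡⟨ ∑-comm middle circuitSets (λ l X → ∑ (range 1 (s ρ)) (λ i → 𝟙 (chosen l i X) ℤ.* G l i)) ⟩
    ∑ circuitSets (λ X → ∑ middle (λ l → ∑ (range 1 (s ρ)) (λ i → 𝟙 (chosen l i X) ℤ.* G l i)))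
      ≡⟨ ∑-cong circuitSets (λ {X} _ → ∑-cong middle (λ {l} _ → trans
           (∑-cong (range 1 (s ρ)) (λ {i} _ → trans
             (cong (ℤ._* G l i) (𝟙-∧ (length X ℕ.≡ᵇ i) (codimensionOf X ℕ.≡ᵇ l)))
             (rotate (𝟙 (length X ℕ.≡ᵇ i)) (𝟙 (codimensionOf X ℕ.≡ᵇ l)) (G l i))))
           (∑-*ˡ (range 1 (s ρ)) (𝟙 (codimensionOf X ℕ.≡ᵇ l)) (λ i → 𝟙 (length X ℕ.≡ᵇ i) ℤ.* G l i)))) ⟩
    ∑ circuitSets share ∎
    where
    open ≡-Reasoning
    chosen : ℕ → ℕ → List (VSet n) → Bool
    chosen l i X = (length X ℕ.≡ᵇ i) ∧ ((n ∸ dim (span X)) ℕ.≡ᵇ l)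
    rotate : ∀ a b c → a ℤ.* b ℤ.* c ≡ b ℤ.* (a ℤ.* c)
    rotate = solve-∀

  -- In the middle codimensions the two summands cancel by `G-Φ`. At the extremes the share is 0,
  -- and only sets of circuits that span E survive.
  share-balance : ∀ {X} → X ∈ circuitSets →
    sgn X ℤ.* Φ (codimensionOf X) ℤ.+ share X ≡ 𝟙 (span X ≡ˢ fullSpace) ℤ.* sgn X ℤ.* weight n
  share-balance {X} X∈ = classify (codimensionOf X ℕₚ.≟ 0) (codimensionOf X ℕₚ.≟ n)
    where
    c = codimensionOf X
    SX : Sub (span X)
    SX = span-sub X (circuitSet-sub X∈)
    inner : ℕ → ℤ
    inner l = ∑ (range 1 (s ρ)) (λ i → 𝟙 (length X ℕ.≡ᵇ i) ℤ.* G l i)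
    full⇒c≡0 : span X ≡ fullSpace → c ≡ 0
    full⇒c≡0 eq = trans (cong codimension eq) (trans (cong (n ∸_) (dim-full n)) (ℕₚ.n∸n≡0 n))
    c≡0⇒full : c ≡ 0 → span X ≡ fullSpace
    c≡0⇒full eq = ≡-by-dim SX full-sub (λ {v} _ → ∈-full v) (subst (_≤ dim (span X)) (sym (dim-full n)) (ℕₚ.m∸n≡0⇒m≤n eq))
    not-middle : ∀ t → sgn X ℤ.* Φ c ≡ t → ¬ (c ∈ middle) → sgn X ℤ.* Φ c ℤ.+ share X ≡ t
    not-middle t eq c∉ = trans (cong₂ ℤ._+_ eq (∑-pick-∉ c inner c∉)) (ℤₚ.+-identityʳ t)
    classify : Dec (c ≡ 0) → Dec (c ≡ n) →
      sgn X ℤ.* Φ c ℤ.+ share X ≡ 𝟙 (span X ≡ˢ fullSpace) ℤ.* sgn X ℤ.* weight n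
    classify (yes c≡0) _ = not-middle _
      (trans (cong (λ t → sgn X ℤ.* Φ t) c≡0) (trans (cong (sgn X ℤ.*_) Φ-full)
        (cong (ℤ._* weight n) (sym (trans (cong (ℤ._* sgn X) (𝟙-true (≡ˢ⁺ (span X) fullSpace (c≡0⇒full c≡0)))) (ℤₚ.*-identityˡ (sgn X)))))))
      (λ c∈ → ℕₚ.<⇒≱ (proj₁ (∈-range⁻ c∈)) (ℕₚ.≤-reflexive c≡0))
    -- Codimension `n` is missing from the double sum, and `Φ-zero` removes it on the other side.
    -- The empty set of circuits is handled here.
    classify (no c≢0) (yes c≡n) = not-middle _
      (trans (trans (cong (λ t → sgn X ℤ.* Φ t) c≡n) (trans (cong (sgn X ℤ.*_) Φ-zero) (ℤₚ.*-zeroʳ (sgn X)))) (sym not-full))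
      (λ c∈ → ℕₚ.<⇒≱ (ℕₚ.≤-reflexive (ℕₚ.m+[n∸m]≡n 1≤n)) (subst (_≤ n ∸ 1) c≡n (proj₂ (∈-range⁻ c∈))))
      where
      not-full : 𝟙 (span X ≡ˢ fullSpace) ℤ.* sgn X ℤ.* weight n ≡ 0ℤ
      not-full = cong (λ t → t ℤ.* sgn X ℤ.* weight n) (𝟙-false λ h → c≢0 (full⇒c≡0 (≡ˢ⁻ (span X) fullSpace h)))
    classify (no c≢0) (no c≢n) = begin
      sgn X ℤ.* Φ c ℤ.+ share X
        ≡⟨ cong (λ t → sgn X ℤ.* Φ c ℤ.+ t) (trans
             (∑-pick c inner (range-unique 1 (n ∸ 1)) (∈-range⁺ (ℕₚ.n≢0⇒n>0 c≢0) c≤n-1))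
             (trans (∑-pick (length X) (G c) (range-unique 1 (s ρ)) (∈-range⁺ nonempty (sublists-length (circuits ρ) X∈)))
               (G-Φ (length X) (ℕₚ.m∸n≤m n (dim (span X)))))) ⟩
      sgn X ℤ.* Φ c ℤ.+ ℤ.- sgn X ℤ.* Φ c
        ≡⟨ cancel (sgn X) (Φ c) ⟩
      0ℤ
        ≡⟨ sym (cong (λ t → t ℤ.* sgn X ℤ.* weight n) (𝟙-false λ h → c≢0 (full⇒c≡0 (≡ˢ⁻ (span X) fullSpace h)))) ⟩
      𝟙 (span X ≡ˢ fullSpace) ℤ.* sgn X ℤ.* weight n ∎
      where
      open ≡-Reasoning
      cancel : ∀ a b → a ℤ.* b ℤ.+ ℤ.- a ℤ.* b ≡ 0ℤ
      cancel = solve-∀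
      c≤n-1 : c ≤ n ∸ 1
      c≤n-1 = ℕₚ.≤-pred (subst (c <_) (sym (ℕₚ.m+[n∸m]≡n 1≤n)) (ℕₚ.≤∧≢⇒< (ℕₚ.m∸n≤m n (dim (span X))) c≢n))
      -- The inner range starts at 1. The empty set spans 0 and so has codimension `n`, a case
      -- already settled.
      nonempty : 1 ≤ length X
      nonempty = ℕₚ.n≢0⇒n>0 λ eq → c≢n (empty X eq)
        where
        empty : ∀ Y → length Y ≡ 0 → codimensionOf Y ≡ n
        empty [] _ = cong (n ∸_) (dim-zero n)

  total : ∑ subs (λ V → independent V ℤ.* w V) ℤ.+ secondSum ≡ μ₀ fullSpace ℤ.* weight n
  total = begin
    ∑ subs (λ V → independent V ℤ.* w V) ℤ.+ secondSum
      ≡⟨ cong₂ ℤ._+_ ∑-independent-w secondSum≡ ⟩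
    ∑ circuitSets (λ X → sgn X ℤ.* Φ (codimensionOf X)) ℤ.+ ∑ circuitSets share
      ≡⟨ sym (∑-+ circuitSets (λ X → sgn X ℤ.* Φ (codimensionOf X)) share) ⟩
    ∑ circuitSets (λ X → sgn X ℤ.* Φ (codimensionOf X) ℤ.+ share X)
      ≡⟨ ∑-cong circuitSets share-balance ⟩
    ∑ circuitSets (λ X → 𝟙 (span X ≡ˢ fullSpace) ℤ.* sgn X ℤ.* weight n)
      ≡⟨ ∑-*ʳ circuitSets (weight n) (λ X → 𝟙 (span X ≡ˢ fullSpace) ℤ.* sgn X) ⟩
    signedSpans fullSpace ℤ.* weight n
      ≡⟨ cong (ℤ._* weight n) (signedSpans≡μ₀ full-sub) ⟩
    μ₀ fullSpace ℤ.* weight n ∎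
    where open ≡-Reasoning

  firstTerm : ℤ
  firstTerm = signPow ((+ rk ρ) ℤ.- + 1) ℤ.* (+ (q ^ (n choose 2))) ℤ.* (+ μbar ρ)

  firstTerm≡ : firstTerm ≡ ℤ.- (μ₀ fullSpace ℤ.* weight n)
  firstTerm≡ = begin
    signPow ((+ rk ρ) ℤ.- + 1) ℤ.* Q ℤ.* + μbar ρ          ≡⟨ cong (λ t → t ℤ.* Q ℤ.* + μbar ρ) (signPow-pred (rk ρ)) ⟩
    ℤ.- negOnePow (rk ρ) ℤ.* Q ℤ.* + μbar ρ                ≡⟨ gather (negOnePow (rk ρ)) Q (+ μbar ρ) ⟩
    ℤ.- (negOnePow (rk ρ) ℤ.* + μbar ρ ℤ.* Q)              ≡⟨ cong (λ t → ℤ.- (t ℤ.* Q)) (sym signed-μbar) ⟩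
    ℤ.- (negOnePow n ℤ.* μ₀ fullSpace ℤ.* Q)               ≡⟨ scatter (negOnePow n) (μ₀ fullSpace) Q ⟩
    ℤ.- (μ₀ fullSpace ℤ.* weight n)                        ∎
    where
    open ≡-Reasoning
    Q = + (q ^ (n choose 2))
    gather : ∀ a b c → ℤ.- a ℤ.* b ℤ.* c ≡ ℤ.- (a ℤ.* c ℤ.* b)
    gather = solve-∀
    scatter : ∀ a b c → ℤ.- (a ℤ.* b ℤ.* c) ≡ ℤ.- (b ℤ.* (a ℤ.* c))
    scatter = solve-∀

  χ≡rhs : χ ρ ≡ rhs ρ
  χ≡rhs = begin
    χ ρ
      ≡⟨ ChainCount.χ-as-sum ⟩
    ℤ.- I
      ≡⟨ transpose I secondSum (μ₀ fullSpace ℤ.* weight n) total ⟩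
    ℤ.- (μ₀ fullSpace ℤ.* weight n) ℤ.+ secondSum
      ≡⟨ cong (ℤ._+ secondSum) (sym firstTerm≡) ⟩
    firstTerm ℤ.+ secondSum ∎
    where
    open ≡-Reasoning
    I = ∑ subs (λ V → independent V ℤ.* w V)
    transpose : ∀ a b c → a ℤ.+ b ≡ c → ℤ.- a ≡ ℤ.- c ℤ.+ b
    transpose a b .(a ℤ.+ b) refl = expand a b
      where
      expand : ∀ a b → ℤ.- a ≡ ℤ.- (a ℤ.+ b) ℤ.+ b
      expand = solve-∀

theorem4p2 : (q : ℕ) (F : FiniteField q) (n : ℕ) → 1 ≤ n →
    (ρ : QMatroidTheory.VSet F n → ℕ) → QMatroidTheory.IsQMatroid F n ρ →
    QMatroidTheory.χ F ρ ≡ QMatroidTheory.rhs F ρ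
theorem4p2 q F n 1≤n ρ M = Assembly.χ≡rhs F 1≤n ρ M
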